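{- Let $d\ge 2$ be an integer, let $f:\mathbb{N}\to\mathbb{N}$ be a function of subexponential growth, and let $\{G_n\}_{n=1}^\infty\subset \mathrm{Graph}_d^f$ be a weakly convergent sequence of finite graphs. Then for any $\epsilon>0$ there exist a constant $K>0$ and, for every connected simple graph $H\in \mathrm{Graph}_d^f$ with $|V(H)|\le K$, a real constant $c_H$ such that for every $n\ge 1$ one can remove at most $\epsilon|E(G_n)|$ edges from $G_n$ so that, denoting by $G_n'$ the remaining graph (on the same vertex set), the following conditions are satisfied: (1) the number of vertices in each component of $G_n'$ is not greater than $K$; (2) if $V_H^n\subseteq V(G_n)$ is the set of vertices that are contained in a component of $G_n'$ isomorphic to $H$, then for every connected simple graph $H\in \mathrm{Graph}_d^f$ with $|V(H)|\le K$, $$\lim_{n\to\infty}\frac{|V_H^n|}{|V(G_n)|}=c_H .$$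
   Context: $\mathrm{Graph}_d$ is the set of finite simple graphs (up to isomorphism) in which every vertex has degree at most $d$. For a vertex $x$ of a graph, $B_r(x)$ is the ball of radius $r$ around $x$ (the vertices at graph distance at most $r$ from $x$ with the induced graph structure, rooted at $x$); $|B_r(x)|$ is its number of vertices. A function $f:\mathbb{N}\to\mathbb{N}$ has subexponential growth if for every $\delta>0$ there is $C_\delta>0$ such that $f(n)\le C_\delta(1+\delta)^n$ for all $n\ge1$. $\mathrm{Graph}_d^f$ is the class of graphs $G\in\mathrm{Graph}_d$ such that $|B_r(x)|\le f(r)$ for each $x\in V(G)$ and each $r\ge 1$. For $r\ge1$, $U^{r,d}$ denotes the finite set of rooted isomorphism classes of rooted $(r,d)$-balls, i.e. finite simple connected graphs of maximum degree at most $d$ with a distinguished root such that every vertex is at distance at most $r$ from the root. For $\alpha\in U^{r,d}$ and a finite graph $G\in \mathrm{Graph}_d$, $T(G,\alpha)$ is the set of $x\in V(G)$ such that $B_r(x)$ is rooted isomorphic to $\alpha$, and $p_G(\alpha)=|T(G,\alpha)|/|V(G)|$. A sequence $\{G_n\}\subset\mathrm{Graph}_d$ with $|V(G_n)|\to\infty$ is weakly convergent if $\lim_{n\to\infty}p_{G_n}(\alpha)$ exists for every $r\ge1$ and $\alpha\in U^{r,d}$. -}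

module Defs where

open import Data.Fin as Fin using (Fin; zero; suc; toℕ; fromℕ<)
import Data.Fin.Properties as Fin
import Data.Integer as ℤ
open import Data.List using (List; length; filter; lookup; allFin; cartesianProduct)
open import Data.List.Membership.Propositional.Properties using (∈-filter⁺; ∈-allFin)
open import Data.List.Relation.Unary.Any using (index)
open import Data.Nat as ℕ using (ℕ; zero; suc; _⊔_)
import Data.Nat.Properties as ℕ
open import Data.Product using (Σ; ∃; _×_; _,_; proj₁; proj₂)
open import Data.Rational as ℚ using (ℚ; 0ℚ; 1ℚ; ½)
import Data.Rational.Properties as ℚ
open import Data.Rational.Solver using (module +-*-Solver)
open import Data.Sum using (_⊎_; inj₁; inj₂)
open import Data.Unit using (⊤; tt)
open import Data.Vec as Vec using (Vec; []; _∷_)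
import Data.Vec.Properties as Vec
open import Function.Base using (_∘_)
open import Function.Bundles using (_↔_; _⇔_; mk↔ₛ′; mk⇔; Inverse; Equivalence)
open import Relation.Binary.Core using (Rel)
open import Relation.Binary.Definitions using (Decidable; Symmetric; Irreflexive)
open import Relation.Binary.Construct.Closure.ReflexiveTransitive using (Star; ε; _◅_; _◅◅_)
open import Relation.Binary.PropositionalEquality
open import Relation.Nullary using (¬_; Dec; yes; no)
open import Relation.Nullary.Decidable using (_×-dec_; _⊎-dec_; _→-dec_; ¬?; map′)
open import Relation.Unary using (Pred) renaming (Decidable to Decidable₁)
open import Level using (0ℓ)

-- Cauchy sequences of rationals.  Propositional equality on ℝ is too fine to
-- serve as equality of real numbers; reals are only compared through _<ᴿ_.

record ℝ : Set where
  constructor mkℝ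
  field
    seq    : ℕ → ℚ
    cauchy : ∀ e → 0ℚ ℚ.< e →
             ∃ λ N → ∀ m n → N ℕ.≤ m → N ℕ.≤ n → ℚ.∣ seq m ℚ.- seq n ∣ ℚ.< e

open ℝ public

private

  half-pos : ∀ {e} → 0ℚ ℚ.< e → 0ℚ ℚ.< ½ ℚ.* e
  half-pos {e} 0<e =
    subst (ℚ._< ½ ℚ.* e) (ℚ.*-zeroʳ ½) (ℚ.*-monoʳ-<-pos ½ 0<e)

  halves : ∀ e → ½ ℚ.* e ℚ.+ ½ ℚ.* e ≡ e
  halves e = trans (sym (ℚ.*-distribʳ-+ e ½ ½)) (ℚ.*-identityˡ e)

  ∣∣≤ : ∀ {p t} → p ℚ.≤ t → ℚ.- p ℚ.≤ t → ℚ.∣ p ∣ ℚ.≤ t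
  ∣∣≤ {p} {t} a b with ℚ.∣p∣≡p∨∣p∣≡-p p
  ... | inj₁ q = subst (ℚ._≤ t) (sym q) a
  ... | inj₂ q = subst (ℚ._≤ t) (sym q) b

  ∣p∣-∣q∣≤∣p-q∣ : ∀ p q → ℚ.∣ p ∣ ℚ.- ℚ.∣ q ∣ ℚ.≤ ℚ.∣ p ℚ.- q ∣
  ∣p∣-∣q∣≤∣p-q∣ p q = begin
    ℚ.∣ p ∣ ℚ.- ℚ.∣ q ∣
      ≡⟨ cong (λ z → ℚ.∣ z ∣ ℚ.- ℚ.∣ q ∣) (solve 2 (λ p q → p := (p :- q) :+ q) refl p q) ⟩
    ℚ.∣ (p ℚ.- q) ℚ.+ q ∣ ℚ.- ℚ.∣ q ∣
      ≤⟨ ℚ.+-monoˡ-≤ (ℚ.- ℚ.∣ q ∣) (ℚ.∣p+q∣≤∣p∣+∣q∣ (p ℚ.- q) q) ⟩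
    (ℚ.∣ p ℚ.- q ∣ ℚ.+ ℚ.∣ q ∣) ℚ.- ℚ.∣ q ∣
      ≡⟨ solve 2 (λ a b → (a :+ b) :- b := a) refl ℚ.∣ p ℚ.- q ∣ ℚ.∣ q ∣ ⟩
    ℚ.∣ p ℚ.- q ∣ ∎
    where
    open ℚ.≤-Reasoning
    open +-*-Solver

  ∣p-q∣≡∣q-p∣ : ∀ p q → ℚ.∣ p ℚ.- q ∣ ≡ ℚ.∣ q ℚ.- p ∣
  ∣p-q∣≡∣q-p∣ p q = trans (sym (ℚ.∣-p∣≡∣p∣ (p ℚ.- q)))
    (cong ℚ.∣_∣ (solve 2 (λ p q → :- (p :- q) := q :- p) refl p q))
    where open +-*-Solver

  ∣∣p∣-∣q∣∣≤∣p-q∣ : ∀ p q → ℚ.∣ ℚ.∣ p ∣ ℚ.- ℚ.∣ q ∣ ∣ ℚ.≤ ℚ.∣ p ℚ.- q ∣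
  ∣∣p∣-∣q∣∣≤∣p-q∣ p q = ∣∣≤ (∣p∣-∣q∣≤∣p-q∣ p q)
    (subst₂ ℚ._≤_ (solve 2 (λ a b → a :- b := :- (b :- a)) refl ℚ.∣ q ∣ ℚ.∣ p ∣)
      (∣p-q∣≡∣q-p∣ q p) (∣p∣-∣q∣≤∣p-q∣ q p))
    where open +-*-Solver

  tailBound : ∀ x → ∃ λ A → ∃ λ N → 0ℚ ℚ.< A × (∀ n → N ℕ.≤ n → ℚ.∣ seq x n ∣ ℚ.≤ A)
  tailBound x with cauchy x 1ℚ (ℚ.positive⁻¹ 1ℚ)
  ... | N , c = ℚ.∣ a ∣ ℚ.+ 1ℚ , N , pos , bound
    where
    a = seq x N
    pos : 0ℚ ℚ.< ℚ.∣ a ∣ ℚ.+ 1ℚ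
    pos = ℚ.+-mono-≤-< (ℚ.0≤∣p∣ a) (ℚ.positive⁻¹ 1ℚ)
    bound : ∀ n → N ℕ.≤ n → ℚ.∣ seq x n ∣ ℚ.≤ ℚ.∣ a ∣ ℚ.+ 1ℚ
    bound n N≤n = begin
      ℚ.∣ seq x n ∣
        ≡⟨ solve 2 (λ u v → u := v :+ (u :- v)) refl ℚ.∣ seq x n ∣ ℚ.∣ a ∣ ⟩
      ℚ.∣ a ∣ ℚ.+ (ℚ.∣ seq x n ∣ ℚ.- ℚ.∣ a ∣)
        ≤⟨ ℚ.+-monoʳ-≤ ℚ.∣ a ∣ (∣p∣-∣q∣≤∣p-q∣ (seq x n) a) ⟩
      ℚ.∣ a ∣ ℚ.+ ℚ.∣ seq x n ℚ.- a ∣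
        ≤⟨ ℚ.+-monoʳ-≤ ℚ.∣ a ∣ (ℚ.<⇒≤ (c n N N≤n ℕ.≤-refl)) ⟩
      ℚ.∣ a ∣ ℚ.+ 1ℚ ∎
      where
      open ℚ.≤-Reasoning
      open +-*-Solver

  product-difference : ∀ a b c d →
    a ℚ.* b ℚ.- c ℚ.* d ≡ a ℚ.* (b ℚ.- d) ℚ.+ (a ℚ.- c) ℚ.* d
  product-difference = solve 4 (λ a b c d → a :* b :- c :* d := a :* (b :- d) :+ (a :- c) :* d) refl
    where
    open +-*-Solver

  factor : ∀ a b c i → a ℚ.* (c ℚ.* i) ℚ.+ (c ℚ.* i) ℚ.* b ≡ c ℚ.* ((a ℚ.+ b) ℚ.* i)
  factor = solve 4 (λ a b c i → a :* (c :* i) :+ (c :* i) :* b := c :* ((a :+ b) :* i)) refl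
    where
    open +-*-Solver

  split : ∀ A B e → 0ℚ ℚ.< A → 0ℚ ℚ.< B → 0ℚ ℚ.< e →
          ∃ λ h → 0ℚ ℚ.< h × A ℚ.* h ℚ.+ h ℚ.* B ≡ e
  split A B e 0<A 0<B 0<e = e ℚ.* i , 0<h , (begin
    A ℚ.* (e ℚ.* i) ℚ.+ (e ℚ.* i) ℚ.* B  ≡⟨ factor A B e i ⟩
    e ℚ.* (S ℚ.* i)                      ≡⟨ cong (e ℚ.*_) (ℚ.*-inverseʳ S {{S≢0}}) ⟩
    e ℚ.* 1ℚ                             ≡⟨ ℚ.*-identityʳ e ⟩
    e                                    ∎)
    where
    open ≡-Reasoning
    S : ℚ
    S = A ℚ.+ B
    S>0 : ℚ.Positive S
    S>0 = ℚ.positive (ℚ.+-mono-< 0<A 0<B)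
    S≢0 : ℚ.NonZero S
    S≢0 = ℚ.pos⇒nonZero S {{S>0}}
    i : ℚ
    i = ℚ.1/_ S {{S≢0}}
    0<h : 0ℚ ℚ.< e ℚ.* i
    0<h = subst (ℚ._< e ℚ.* i) (ℚ.*-zeroˡ i)
      (ℚ.*-monoˡ-<-pos i {{ℚ.1/pos⇒pos S {{S>0}}}} 0<e)

  sum-bound : ∀ a u v b A B h → 0ℚ ℚ.< A → 0ℚ ℚ.< B →
    ℚ.∣ a ∣ ℚ.≤ A → ℚ.∣ b ∣ ℚ.≤ B → ℚ.∣ v ∣ ℚ.< h → ℚ.∣ u ∣ ℚ.< h →
    ℚ.∣ a ℚ.* u ℚ.+ v ℚ.* b ∣ ℚ.< A ℚ.* h ℚ.+ h ℚ.* B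
  sum-bound a u v b A B h 0<A 0<B a≤A b≤B v<h u<h = ℚ.≤-<-trans
    (ℚ.∣p+q∣≤∣p∣+∣q∣ (a ℚ.* u) (v ℚ.* b))
    (ℚ.+-mono-< {ℚ.∣ a ℚ.* u ∣} {A ℚ.* h} {ℚ.∣ v ℚ.* b ∣} {h ℚ.* B} left right)
    where
    left : ℚ.∣ a ℚ.* u ∣ ℚ.< A ℚ.* h
    left = subst (ℚ._< A ℚ.* h) (sym (ℚ.∣p*q∣≡∣p∣*∣q∣ a u))
      (ℚ.≤-<-trans {ℚ.∣ a ∣ ℚ.* ℚ.∣ u ∣} {A ℚ.* ℚ.∣ u ∣} {A ℚ.* h}
        (ℚ.*-monoʳ-≤-nonNeg ℚ.∣ u ∣ {{ℚ.∣-∣-nonNeg u}} {ℚ.∣ a ∣} {A} a≤A)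
        (ℚ.*-monoʳ-<-pos A {{ℚ.positive 0<A}} {ℚ.∣ u ∣} {h} u<h))
    right : ℚ.∣ v ℚ.* b ∣ ℚ.< h ℚ.* B
    right = subst (ℚ._< h ℚ.* B) (sym (ℚ.∣p*q∣≡∣p∣*∣q∣ v b))
      (ℚ.≤-<-trans {ℚ.∣ v ∣ ℚ.* ℚ.∣ b ∣} {ℚ.∣ v ∣ ℚ.* B} {h ℚ.* B}
        (ℚ.*-monoˡ-≤-nonNeg ℚ.∣ v ∣ {{ℚ.∣-∣-nonNeg v}} {ℚ.∣ b ∣} {B} b≤B)
        (ℚ.*-monoˡ-<-pos B {{ℚ.positive 0<B}} {ℚ.∣ v ∣} {h} v<h))

  product-close : ∀ a b c d A B h → 0ℚ ℚ.< A → 0ℚ ℚ.< B →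
    ℚ.∣ a ∣ ℚ.≤ A → ℚ.∣ d ∣ ℚ.≤ B → ℚ.∣ a ℚ.- c ∣ ℚ.< h → ℚ.∣ b ℚ.- d ∣ ℚ.< h →
    ℚ.∣ a ℚ.* b ℚ.- c ℚ.* d ∣ ℚ.< A ℚ.* h ℚ.+ h ℚ.* B
  product-close a b c d A B h 0<A 0<B a≤A d≤B ac bd =
    subst (λ z → ℚ.∣ z ∣ ℚ.< A ℚ.* h ℚ.+ h ℚ.* B) (sym (product-difference a b c d))
      (sum-bound a (b ℚ.- d) (a ℚ.- c) d A B h 0<A 0<B a≤A d≤B ac bd)

infix  4 _<ᴿ_ _≤ᴿ_
infixl 6 _+ᴿ_ _-ᴿ_
infixl 7 _*ᴿ_
infixr 8 _^ᴿ_

fromℚ : ℚ → ℝ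
fromℚ q = mkℝ (λ _ → q)
  λ e 0<e → 0 , λ _ _ _ _ → subst (ℚ._< e) (sym (cong ℚ.∣_∣ (ℚ.+-inverseʳ q))) 0<e

fromℕ : ℕ → ℝ
fromℕ n = fromℚ (ℤ.+ n ℚ./ 1)

0ᴿ 1ᴿ : ℝ
0ᴿ = fromℚ 0ℚ
1ᴿ = fromℚ 1ℚ

_+ᴿ_ : ℝ → ℝ → ℝ
x +ᴿ y = mkℝ (λ n → seq x n ℚ.+ seq y n) proof
  where
  proof : ∀ e → 0ℚ ℚ.< e → ∃ λ N → ∀ m n → N ℕ.≤ m → N ℕ.≤ n →
          ℚ.∣ (seq x m ℚ.+ seq y m) ℚ.- (seq x n ℚ.+ seq y n) ∣ ℚ.< e
  proof e 0<e with cauchy x (½ ℚ.* e) (half-pos 0<e) | cauchy y (½ ℚ.* e) (half-pos 0<e)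
  ... | M , f | N , g = M ⊔ N , λ m n p q → begin-strict
    ℚ.∣ (seq x m ℚ.+ seq y m) ℚ.- (seq x n ℚ.+ seq y n) ∣
      ≡⟨ cong ℚ.∣_∣ (solve 4 (λ a b c d → (a :+ b) :- (c :+ d) := (a :- c) :+ (b :- d)) refl
           (seq x m) (seq y m) (seq x n) (seq y n)) ⟩
    ℚ.∣ (seq x m ℚ.- seq x n) ℚ.+ (seq y m ℚ.- seq y n) ∣
      ≤⟨ ℚ.∣p+q∣≤∣p∣+∣q∣ (seq x m ℚ.- seq x n) (seq y m ℚ.- seq y n) ⟩
    ℚ.∣ seq x m ℚ.- seq x n ∣ ℚ.+ ℚ.∣ seq y m ℚ.- seq y n ∣
      <⟨ ℚ.+-mono-< (f m n (ℕ.m⊔n≤o⇒m≤o M N p) (ℕ.m⊔n≤o⇒m≤o M N q))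
                    (g m n (ℕ.m⊔n≤o⇒n≤o M N p) (ℕ.m⊔n≤o⇒n≤o M N q)) ⟩
    ½ ℚ.* e ℚ.+ ½ ℚ.* e
      ≡⟨ halves e ⟩
    e ∎
    where
    open ℚ.≤-Reasoning
    open +-*-Solver

-ᴿ_ : ℝ → ℝ
-ᴿ x = mkℝ (λ n → ℚ.- seq x n) λ e 0<e → let (N , f) = cauchy x e 0<e in
  N , λ m n p q → subst (ℚ._< e)
    (trans (∣p-q∣≡∣q-p∣ (seq x m) (seq x n))
      (cong ℚ.∣_∣ (solve 2 (λ a b → b :- a := :- a :- :- b) refl (seq x m) (seq x n))))
    (f m n p q)
  where open +-*-Solver

_-ᴿ_ : ℝ → ℝ → ℝ
x -ᴿ y = x +ᴿ (-ᴿ y)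

∣_∣ᴿ : ℝ → ℝ
∣ x ∣ᴿ = mkℝ (λ n → ℚ.∣ seq x n ∣) λ e 0<e → let (N , f) = cauchy x e 0<e in
  N , λ m n p q → ℚ.≤-<-trans (∣∣p∣-∣q∣∣≤∣p-q∣ (seq x m) (seq x n)) (f m n p q)

_*ᴿ_ : ℝ → ℝ → ℝ
x *ᴿ y = mkℝ (λ n → seq x n ℚ.* seq y n) λ e 0<e →
  let A , N₁ , 0<A , x≤A = tailBound x
      B , N₂ , 0<B , y≤B = tailBound y
      h , 0<h , Ah+hB≡e  = split A B e 0<A 0<B 0<e
      N₃ , x-close = cauchy x h 0<h
      N₄ , y-close = cauchy y h 0<h
  in (N₁ ⊔ N₂) ⊔ (N₃ ⊔ N₄) , λ m n p q →
    let p₁₂ = ℕ.m⊔n≤o⇒m≤o (N₁ ⊔ N₂) (N₃ ⊔ N₄) p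
        q₁₂ = ℕ.m⊔n≤o⇒m≤o (N₁ ⊔ N₂) (N₃ ⊔ N₄) q
        p₃₄ = ℕ.m⊔n≤o⇒n≤o (N₁ ⊔ N₂) (N₃ ⊔ N₄) p
        q₃₄ = ℕ.m⊔n≤o⇒n≤o (N₁ ⊔ N₂) (N₃ ⊔ N₄) q
    in subst (ℚ.∣ seq x m ℚ.* seq y m ℚ.- seq x n ℚ.* seq y n ∣ ℚ.<_) Ah+hB≡e
         (product-close (seq x m) (seq y m) (seq x n) (seq y n) A B h 0<A 0<B
           (x≤A m (ℕ.m⊔n≤o⇒m≤o N₁ N₂ p₁₂)) (y≤B n (ℕ.m⊔n≤o⇒n≤o N₁ N₂ q₁₂))
           (x-close m n (ℕ.m⊔n≤o⇒m≤o N₃ N₄ p₃₄) (ℕ.m⊔n≤o⇒m≤o N₃ N₄ q₃₄))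
           (y-close m n (ℕ.m⊔n≤o⇒n≤o N₃ N₄ p₃₄) (ℕ.m⊔n≤o⇒n≤o N₃ N₄ q₃₄)))

_^ᴿ_ : ℝ → ℕ → ℝ
x ^ᴿ zero  = 1ᴿ
x ^ᴿ suc n = x *ᴿ x ^ᴿ n

_<ᴿ_ : Rel ℝ 0ℓ
x <ᴿ y = ∃ λ e → 0ℚ ℚ.< e × ∃ λ N → ∀ n → N ℕ.≤ n → seq x n ℚ.+ e ℚ.≤ seq y n

_≤ᴿ_ : Rel ℝ 0ℓ
x ≤ᴿ y = ¬ (y <ᴿ x)

infix 4 _⟶_
_⟶_ : (ℕ → ℝ) → ℝ → Set
a ⟶ l = ∀ e → 0ᴿ <ᴿ e → ∃ λ N → ∀ n → N ℕ.≤ n → ∣ a n -ᴿ l ∣ᴿ <ᴿ e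

-- a / b, with the convention a / 0 = 0.
ratio : ℕ → ℕ → ℝ
ratio a zero      = 0ᴿ
ratio a b@(suc _) = fromℚ (ℤ.+ a ℚ./ b)

Subexponential : (ℕ → ℕ) → Set
Subexponential f = ∀ δ → 0ᴿ <ᴿ δ → Σ ℝ λ C → 0ᴿ <ᴿ C ×
  (∀ n → 1 ℕ.≤ n → fromℕ (f n) ≤ᴿ C *ᴿ (1ᴿ +ᴿ δ) ^ᴿ n)

record Graph (n : ℕ) : Set₁ where
  infix 4 _~_ _~?_
  field
    _~_         : Rel (Fin n) 0ℓ
    _~?_        : Decidable _~_
    symmetric   : Symmetric _~_
    irreflexive : Irreflexive _≡_ _~_

infix 4 _⊢_~_
_⊢_~_ : ∀ {n} → Graph n → Rel (Fin n) 0ℓ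
G ⊢ x ~ y = Graph._~_ G x y

vertices : ∀ {n} {P : Pred (Fin n) 0ℓ} → Decidable₁ P → List (Fin n)
vertices P? = filter P? (allFin _)

#_ : ∀ {n} {P : Pred (Fin n) 0ℓ} → Decidable₁ P → ℕ
# P? = length (vertices P?)

induced : ∀ {n} (G : Graph n) {P : Pred (Fin n) 0ℓ} (P? : Decidable₁ P) → Graph (# P?)
induced G P? = record
  { _~_         = λ i j → lookup (vertices P?) i ~ lookup (vertices P?) j
  ; _~?_        = λ i j → lookup (vertices P?) i ~? lookup (vertices P?) j
  ; symmetric   = symmetric
  ; irreflexive = irreflexive ∘ cong (lookup (vertices P?))
  }
  where open Graph G

pairs : ∀ n → List (Fin n × Fin n)
pairs n = cartesianProduct (allFin n) (allFin n)

-- Each edge {x, y} is counted once, as the pair with x < y.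
edgeCount : ∀ {n} → Graph n → ℕ
edgeCount {n} G = length (filter (λ (x , y) → (x Fin.<? y) ×-dec (x ~? y)) (pairs n))
  where open Graph G

_⊑_ : ∀ {n} → Graph n → Graph n → Set
G′ ⊑ G = ∀ x y → G′ ⊢ x ~ y → G ⊢ x ~ y

removedCount : ∀ {n} → Graph n → Graph n → ℕ
removedCount {n} G G′ = length (filter
  (λ (x , y) → (x Fin.<? y) ×-dec (Graph._~?_ G x y) ×-dec ¬? (Graph._~?_ G′ x y)) (pairs n))

degree : ∀ {n} → Graph n → Fin n → ℕ
degree G x = # (λ y → Graph._~?_ G x y)

MaxDegree≤ : ∀ {n} → ℕ → Graph n → Set
MaxDegree≤ d G = ∀ x → degree G x ℕ.≤ d

data Dist≤ {n} (G : Graph n) : ℕ → Rel (Fin n) 0ℓ where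
  here : ∀ {r x} → Dist≤ G r x x
  step : ∀ {r x y z} → G ⊢ x ~ y → Dist≤ G r y z → Dist≤ G (suc r) x z

dist≤? : ∀ {n} (G : Graph n) r → Decidable (Dist≤ G r)
dist≤? G zero x y = map′ (λ { refl → here }) (λ { here → refl }) (x Fin.≟ y)
dist≤? G (suc r) x y = map′
  (λ { (inj₁ refl) → here ; (inj₂ (z , e , w)) → step e w })
  (λ { here → inj₁ refl ; (step e w) → inj₂ (_ , e , w) })
  ((x Fin.≟ y) ⊎-dec Fin.any? (λ z → (Graph._~?_ G x z) ×-dec dist≤? G r z y))

Reachable : ∀ {n} → Graph n → Rel (Fin n) 0ℓ
Reachable G = Star (Graph._~_ G)

Connected : ∀ {n} → Graph n → Set
Connected G = ∀ x y → Reachable G x y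

private

  -- Floyd–Warshall: Via k is reachability through intermediate vertices of index below k.
  module FloydWarshall {n} (G : Graph n) where
    open Graph G

    Via : (k : ℕ) → k ℕ.≤ n → Rel (Fin n) 0ℓ
    Via zero    _ x y = x ≡ y ⊎ x ~ y
    Via (suc k) p x y = Via k (ℕ.<⇒≤ p) x y ⊎
      (Via k (ℕ.<⇒≤ p) x (fromℕ< p) × Via k (ℕ.<⇒≤ p) (fromℕ< p) y)

    via? : ∀ k p → Decidable (Via k p)
    via? zero    p x y = (x Fin.≟ y) ⊎-dec (x ~? y)
    via? (suc k) p x y = via? k _ x y ⊎-dec (via? k _ x _ ×-dec via? k _ _ y)

    sound : ∀ k p {x y} → Via k p x y → Star _~_ x y
    sound zero    p (inj₁ refl)    = ε
    sound zero    p (inj₂ e)       = e ◅ ε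
    sound (suc k) p (inj₁ a)       = sound k _ a
    sound (suc k) p (inj₂ (a , b)) = sound k _ a ◅◅ sound k _ b

    edge : ∀ k p {x y} → x ≡ y ⊎ x ~ y → Via k p x y
    edge zero    p e = e
    edge (suc k) p e = inj₁ (edge k _ e)

    compose : ∀ k p {x y} z → toℕ z ℕ.< k → Via k p x z → Via k p z y → Via k p x y
    compose (suc k) p {x} {y} z z<k u v with toℕ z ℕ.≟ k
    ... | yes z≡k = inj₂ (toV u , fromV v)
      where
      w≡z : fromℕ< p ≡ z
      w≡z = Fin.toℕ-injective (trans (Fin.toℕ-fromℕ< p) (sym z≡k))
      toV : Via (suc k) p x z → Via k (ℕ.<⇒≤ p) x (fromℕ< p)
      toV (inj₁ a)       = subst (Via k _ x) (sym w≡z) a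
      toV (inj₂ (a , _)) = a
      fromV : Via (suc k) p z y → Via k (ℕ.<⇒≤ p) (fromℕ< p) y
      fromV (inj₁ a)       = subst (λ t → Via k _ t y) (sym w≡z) a
      fromV (inj₂ (_ , a)) = a
    ... | no z≢k = go u v
      where
      z<k′ : toℕ z ℕ.< k
      z<k′ = ℕ.≤∧≢⇒< (ℕ.s≤s⁻¹ z<k) z≢k
      go : Via (suc k) p x z → Via (suc k) p z y → Via (suc k) p x y
      go (inj₁ a)       (inj₁ b)       = inj₁ (compose k _ z z<k′ a b)
      go (inj₁ a)       (inj₂ (b , c)) = inj₂ (compose k _ z z<k′ a b , c)
      go (inj₂ (a , b)) (inj₁ c)       = inj₂ (a , compose k _ z z<k′ b c)
      go (inj₂ (a , _)) (inj₂ (_ , d)) = inj₂ (a , d)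

    complete : ∀ {x y} → Star _~_ x y → Via n ℕ.≤-refl x y
    complete ε        = edge n _ (inj₁ refl)
    complete (_◅_ {j = z} e es) =
      compose n _ z (Fin.toℕ<n z) (edge n _ (inj₂ e)) (complete es)

reachable? : ∀ {n} (G : Graph n) → Decidable (Reachable G)
reachable? {n} G x y = map′ (sound n _) complete (via? n _ x y)
  where open FloydWarshall G

componentSize : ∀ {n} → Graph n → Fin n → ℕ
componentSize G x = # (reachable? G x)

component : ∀ {n} (G : Graph n) (x : Fin n) → Graph (componentSize G x)
component G x = induced G (reachable? G x)

ballSize : ∀ {n} → Graph n → ℕ → Fin n → ℕ
ballSize G r x = # (dist≤? G r x)

ball : ∀ {n} (G : Graph n) (r : ℕ) (x : Fin n) → Graph (ballSize G r x)
ball G r x = induced G (dist≤? G r x)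

centre : ∀ {n} (G : Graph n) (r : ℕ) (x : Fin n) → Fin (ballSize G r x)
centre G r x = index (∈-filter⁺ (dist≤? G r x) (∈-allFin x) here)

record Graph[_,_] (d : ℕ) (f : ℕ → ℕ) {n} (G : Graph n) : Set where
  field
    maxDegree : MaxDegree≤ d G
    growth    : ∀ x r → 1 ℕ.≤ r → ballSize G r x ℕ.≤ f r

record _≅_ {m n} (G : Graph m) (H : Graph n) : Set where
  field
    bijection : Fin m ↔ Fin n
  open Inverse bijection public using (to; from)
  field
    adjacency : ∀ x y → G ⊢ x ~ y ⇔ H ⊢ to x ~ to y

record RootedGraph : Set₁ where
  field
    {order} : ℕ
    graph   : Graph order
    root    : Fin order

_≅∙_ : RootedGraph → RootedGraph → Set
A ≅∙ B = Σ (graph A ≅ graph B) λ i → _≅_.to i (root A) ≡ root B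
  where open RootedGraph

private

  anyVec? : ∀ {m n} {P : Pred (Vec (Fin n) m) 0ℓ} → Decidable₁ P → Dec (∃ P)
  anyVec? {zero}  P? = map′ (λ p → [] , p) (λ { ([] , p) → p }) (P? [])
  anyVec? {suc m} P? = map′
    (λ { (x , v , p) → x ∷ v , p })
    (λ { (x ∷ v , p) → x , v , p })
    (Fin.any? λ x → anyVec? λ v → P? (x ∷ v))

  module _ {m n} (G : Graph m) (H : Graph n)
           (Q : Pred (Fin m → Fin n) 0ℓ) (Q? : Decidable₁ Q)
           (Q-resp : ∀ {g h} → (∀ x → g x ≡ h x) → Q g → Q h) where

    Code : Vec (Fin n) m → Vec (Fin m) n → Set
    Code g h = (∀ y → Vec.lookup g (Vec.lookup h y) ≡ y)
             × (∀ x → Vec.lookup h (Vec.lookup g x) ≡ x)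
             × (∀ x y → (G ⊢ x ~ y → H ⊢ Vec.lookup g x ~ Vec.lookup g y)
                      × (H ⊢ Vec.lookup g x ~ Vec.lookup g y → G ⊢ x ~ y))
             × Q (Vec.lookup g)

    code? : Decidable Code
    code? g h = Fin.all? (λ y → Vec.lookup g (Vec.lookup h y) Fin.≟ y)
      ×-dec Fin.all? (λ x → Vec.lookup h (Vec.lookup g x) Fin.≟ x)
      ×-dec Fin.all? (λ x → Fin.all? λ y →
              (Graph._~?_ G x y →-dec Graph._~?_ H (Vec.lookup g x) (Vec.lookup g y))
              ×-dec (Graph._~?_ H (Vec.lookup g x) (Vec.lookup g y) →-dec Graph._~?_ G x y))
      ×-dec Q? (Vec.lookup g)

    decode : (∃ λ g → ∃ (Code g)) → Σ (G ≅ H) λ i → Q (_≅_.to i)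
    decode (g , h , gh , hg , e , q) = record
      { bijection = mk↔ₛ′ (Vec.lookup g) (Vec.lookup h) gh hg
      ; adjacency = λ x y → mk⇔ (proj₁ (e x y)) (proj₂ (e x y))
      } , q

    encode : (Σ (G ≅ H) λ i → Q (_≅_.to i)) → ∃ λ g → ∃ (Code g)
    encode (i , q) = Vec.tabulate to , Vec.tabulate from
      , (λ y → trans (g≗ _) (trans (cong to (h≗ y)) (Inverse.strictlyInverseˡ bijection y)))
      , (λ x → trans (h≗ _) (trans (cong from (g≗ x)) (Inverse.strictlyInverseʳ bijection x)))
      , (λ x y → subst₂ (λ a b → H ⊢ a ~ b) (sym (g≗ x)) (sym (g≗ y)) ∘ Equivalence.to (adjacency x y)
               , Equivalence.from (adjacency x y) ∘ subst₂ (λ a b → H ⊢ a ~ b) (g≗ x) (g≗ y))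
      , Q-resp (sym ∘ g≗) q
      where
      open _≅_ i
      g≗ = Vec.lookup∘tabulate to
      h≗ = Vec.lookup∘tabulate from

    findIso? : Dec (Σ (G ≅ H) λ i → Q (_≅_.to i))
    findIso? = map′ decode encode (anyVec? λ g → anyVec? (code? g))

infix 4 _≅?_ _≅∙?_ _≅_ _≅∙_

_≅?_ : ∀ {m n} (G : Graph m) (H : Graph n) → Dec (G ≅ H)
G ≅? H = map′ proj₁ (_, tt)
  (findIso? G H (λ _ → ⊤) (λ _ → yes tt) (λ _ _ → tt))

_≅∙?_ : ∀ A B → Dec (A ≅∙ B)
A ≅∙? B = findIso? (graph A) (graph B) (λ g → g (root A) ≡ root B)
  (λ g → g (root A) Fin.≟ root B) (λ e q → trans (sym (e (root A))) q)
  where open RootedGraph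

rootedBall : ∀ {n} → Graph n → ℕ → Fin n → RootedGraph
rootedBall G r x = record { graph = ball G r x ; root = centre G r x }

-- α represents an element of U^{r,d}.
record IsRootedBall (r d : ℕ) (α : RootedGraph) : Set where
  open RootedGraph α
  field
    connected : Connected graph
    maxDegree : MaxDegree≤ d graph
    radius    : ∀ x → Dist≤ graph r root x

-- |T(G, α)| / |V(G)|
p : ∀ {n} → Graph n → ℕ → RootedGraph → ℝ
p {n} G r α = ratio (# λ x → rootedBall G r x ≅∙? α) n

record WeaklyConvergent (d : ℕ) {v : ℕ → ℕ} (G : ∀ n → Graph (v n)) : Set₁ where
  field
    unbounded : ∀ M → ∃ λ N → ∀ n → N ℕ.≤ n → M ℕ.≤ v n
    converges : ∀ r → 1 ℕ.≤ r → ∀ α → IsRootedBall r d α →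
                Σ ℝ λ l → (λ n → p (G n) r α) ⟶ l

-- |V_H| / |V(G′)|, where V_H is the union of the components of G′ isomorphic to H.
componentDensity : ∀ {m n} → Graph n → Graph m → ℝ
componentDensity {n = n} G′ H = ratio (# λ x → component G′ x ≅? H) n

{-# OPTIONS --safe #-}

-- Vertices carry independent uniform labels below M.  In round t the vertices labelled t
-- whose label is unique within distance 2R + 1 carve, out of the part of the graph that is
-- still uncarved, the ball of the first radius r ≤ R at which the number of inner edges grows
-- by a factor of at most 1 + 1/k; subexponential growth provides such a radius.  The cut edges
-- are charged to the inner edges of the carved balls, and the edges that are never reached
-- touch a vertex with a label conflict, which is unlikely when M is large compared with the
-- ball sizes.  The radius is chosen by counting edges, so that no degree or isolated vertex
-- enters the comparison with |E(G)|.
--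
-- The component of a vertex in the result depends only on its labelled L-ball, for a fixed L.
-- Hence the expected number of vertices in components isomorphic to H is a fixed linear
-- combination of the ball statistics, and its variance is O(|V|), as distant vertices are
-- independent.  A labelling that is simultaneously cheap and close to all expectations exists
-- by Markov's inequality, and the resulting densities form a Cauchy sequence.
module Submission where

open import Algebra.Bundles using (CommutativeRing)
import Algebra.Properties.Semiring.Sum as Sum
open import Data.Bool as Bool using (Bool; _∧_; false; if_then_else_; not; true)
open import Data.Empty using (⊥; ⊥-elim)
open import Data.Fin as Fin using (Fin; suc; toℕ; zero)
import Data.Fin.Properties as Fin
import Data.Integer as ℤ
import Data.Integer.Properties as ℤ
open import Data.List as List
  using (List; []; _++_; _∷_; allFin; cartesianProduct; cartesianProductWith; concatMap; filter;
    length; lookup; tabulate; upTo)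
open import Data.List.Membership.Propositional using (_∈_)
open import Data.List.Membership.Propositional.Properties
  using (∈-allFin; ∈-cartesianProductWith⁺; ∈-concatMap⁺; ∈-filter⁺; ∈-filter⁻; ∈-lookup;
    ∈-map⁺; ∈-upTo⁺)
import Data.List.Properties as List
import Data.List.Relation.Unary.All as All
open import Data.List.Relation.Unary.AllPairs using ([]; _∷_)
open import Data.List.Relation.Unary.Any as Any using (Any; here; index; there)
import Data.List.Relation.Unary.Any.Properties as Any
open import Data.List.Relation.Unary.Unique.Propositional using (Unique)
import Data.List.Relation.Unary.Unique.Propositional.Properties as Unique
open import Data.Nat as ℕ using (_*_; _+_; _<_; _^_; _≤_; _⊔_; suc; s≤s; zero; z≤n; ℕ)
import Data.Nat.Properties as ℕ
import Data.Nat.Solver as ℕSolver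
open import Data.Product using (_,_; _×_; proj₁; proj₂; Σ; ∃)
open import Data.Rational as ℚ using (0ℚ; 1ℚ; ½; ℚ)
import Data.Rational.Properties as ℚ
open import Data.Rational.Solver using (module +-*-Solver)
import Data.Rational.Unnormalised as ℚᵘ
import Data.Rational.Unnormalised.Properties as ℚᵘ
open import Data.Sum using (_⊎_; inj₁; inj₂)
open import Data.Vec as Vec using (Vec; []; _∷_)
import Data.Vec.Properties as Vec
open import Function.Base using (_∘_; id)
open import Function.Bundles using (Equivalence; Inverse; mk↔ₛ′; mk⇔)
open import Level using (0ℓ)
open import Relation.Binary.Construct.Closure.ReflexiveTransitive using (_◅_; _◅◅_; ε)
open import Relation.Binary.Definitions using (tri<; tri>; tri≈)
open import Relation.Binary.PropositionalEquality
open import Relation.Nullary using (Dec; does; no; yes; ¬_)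
open import Relation.Nullary.Decidable using (_×-dec_; _⊎-dec_; dec-false; dec-true; map′; ¬?)
open import Relation.Unary using (Pred) renaming (Decidable to Decidable₁)
open import Defs

-- Rational arithmetic

-- The obstacle is that `G′` is chosen separately for every `n`, while its component densities must
-- approach a constant common to all `n`. A local rule with a fixed depth would ensure this, but
-- symmetric vertices cannot be told apart locally; labels break the symmetry. Taking them from a
-- finite set stops the run after `M` rounds and so keeps the depth independent of `n`. The price is
-- label conflicts, which are not repaired: an edge still uncarved at the end is given up. The
-- constants are fixed in the order `ε`, `k`, `R`, a bound `D` for balls of radius `2R + 1`, `M`,
-- `L`. Half of the budget pays for the boundaries of carved balls and half for conflicts. All `H`
-- of order at most `D` must be served by one labelling. Up to isomorphism they form a finite list,
-- so their squared deviations add up to a single random variable and Markov's inequality has to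
-- handle only this sum and the number of edges at conflicts. Expectations are finite averages of
-- rationals, so a good labelling is found by finite search. Real numbers occur only at the two ends
-- of the argument, and the limit `c H` is the sequence of densities itself, read as a real.

module ℚΣ = Sum (CommutativeRing.semiring ℚ.+-*-commutativeRing)

opaque
  -- Opaque, so that the gcd normalisation inside `_/_` is never unfolded; `↑-/1` keeps the link
  -- with `fromℕ`.
  ↑_ : ℕ → ℚ
  ↑ n = ℤ.+ n ℚ./ 1

  ↑-/1 : ∀ n → ↑ n ≡ ℤ.+ n ℚ./ 1
  ↑-/1 n = refl

  ↑ᵘ : ∀ n → ℚ.toℚᵘ (↑ n) ℚᵘ.≃ (ℤ.+ n ℚᵘ./ 1)
  ↑ᵘ n = ℚ.toℚᵘ-fromℚᵘ (ℤ.+ n ℚᵘ./ 1)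

  ↑-+ : ∀ m n → ↑ (m ℕ.+ n) ≡ ↑ m ℚ.+ ↑ n
  ↑-+ m n = ℚ.toℚᵘ-injective (begin
    ℚ.toℚᵘ (↑ (m ℕ.+ n))                  ≈⟨ ↑ᵘ (m ℕ.+ n) ⟩
    ℤ.+ (m ℕ.+ n) ℚᵘ./ 1
      ≈⟨ ℚᵘ.*≡* (cong (ℤ._* ℤ.+ 1) (sym (cong₂ ℤ._+_ (ℤ.*-identityʳ (ℤ.+ m)) (ℤ.*-identityʳ (ℤ.+ n))))) ⟩
    (ℤ.+ m ℚᵘ./ 1) ℚᵘ.+ (ℤ.+ n ℚᵘ./ 1)    ≈⟨ ℚᵘ.+-cong (ℚᵘ.≃-sym (↑ᵘ m)) (ℚᵘ.≃-sym (↑ᵘ n)) ⟩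
    ℚ.toℚᵘ (↑ m) ℚᵘ.+ ℚ.toℚᵘ (↑ n)        ≈⟨ ℚᵘ.≃-sym (ℚ.toℚᵘ-homo-+ (↑ m) (↑ n)) ⟩
    ℚ.toℚᵘ (↑ m ℚ.+ ↑ n)                  ∎)
    where open ℚᵘ.≃-Reasoning

  ↑-* : ∀ m n → ↑ (m ℕ.* n) ≡ ↑ m ℚ.* ↑ n
  ↑-* m n = ℚ.toℚᵘ-injective (begin
    ℚ.toℚᵘ (↑ (m ℕ.* n))                  ≈⟨ ↑ᵘ (m ℕ.* n) ⟩
    ℤ.+ (m ℕ.* n) ℚᵘ./ 1                  ≈⟨ ℚᵘ.*≡* (cong (ℤ._* ℤ.+ 1) (ℤ.pos-* m n)) ⟩
    (ℤ.+ m ℚᵘ./ 1) ℚᵘ.* (ℤ.+ n ℚᵘ./ 1)    ≈⟨ ℚᵘ.*-cong (ℚᵘ.≃-sym (↑ᵘ m)) (ℚᵘ.≃-sym (↑ᵘ n)) ⟩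
    ℚ.toℚᵘ (↑ m) ℚᵘ.* ℚ.toℚᵘ (↑ n)        ≈⟨ ℚᵘ.≃-sym (ℚ.toℚᵘ-homo-* (↑ m) (↑ n)) ⟩
    ℚ.toℚᵘ (↑ m ℚ.* ↑ n)                  ∎)
    where open ℚᵘ.≃-Reasoning

  ↑-mono : ∀ {m n} → m ≤ n → ↑ m ℚ.≤ ↑ n
  ↑-mono {m} {n} m≤n = ℚ.toℚᵘ-cancel-≤ (begin
    ℚ.toℚᵘ (↑ m)   ≃⟨ ↑ᵘ m ⟩
    ℤ.+ m ℚᵘ./ 1   ≤⟨ ℚᵘ.*≤* (ℤ.*-monoʳ-≤-nonNeg (ℤ.+ 1) (ℤ.+≤+ m≤n)) ⟩
    ℤ.+ n ℚᵘ./ 1   ≃⟨ ℚᵘ.≃-sym (↑ᵘ n) ⟩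
    ℚ.toℚᵘ (↑ n)   ∎)
    where open ℚᵘ.≤-Reasoning

  ↑-zero : ↑ 0 ≡ 0ℚ
  ↑-zero = refl

  ↑-one : ↑ 1 ≡ 1ℚ
  ↑-one = refl

  ↑-< : ∀ {m n} → m < n → ↑ m ℚ.< ↑ n
  ↑-< {m} {n} m<n = ℚ.<-≤-trans
    (subst₂ ℚ._<_ (ℚ.+-identityʳ (↑ m)) (sym (trans (cong ↑_ (ℕ.+-comm 1 m)) (↑-+ m 1)))
      (ℚ.+-monoʳ-< (↑ m) (ℚ.positive⁻¹ 1ℚ)))
    (↑-mono m<n)

  -- Fractions are used only through this product: label weights and densities are handled by
  -- clearing denominators.
  ↑/ : ∀ a b → (ℤ.+ a ℚ./ suc b) ℚ.* ↑ (suc b) ≡ ↑ a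
  ↑/ a b = ℚ.toℚᵘ-injective (begin
    ℚ.toℚᵘ ((ℤ.+ a ℚ./ suc b) ℚ.* ↑ (suc b))             ≈⟨ ℚ.toℚᵘ-homo-* (ℤ.+ a ℚ./ suc b) (↑ (suc b)) ⟩
    ℚ.toℚᵘ (ℤ.+ a ℚ./ suc b) ℚᵘ.* ℚ.toℚᵘ (↑ (suc b))
      ≈⟨ ℚᵘ.*-cong (ℚ.toℚᵘ-fromℚᵘ (ℤ.+ a ℚᵘ./ suc b)) (↑ᵘ (suc b)) ⟩
    (ℤ.+ a ℚᵘ./ suc b) ℚᵘ.* (ℤ.+ suc b ℚᵘ./ 1)           
      ≈⟨ ℚᵘ.*≡* (trans (ℤ.*-identityʳ (ℤ.+ a ℤ.* ℤ.+ suc b))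
           (cong (λ c → ℤ.+ a ℤ.* ℤ.+ c) (sym (ℕ.*-identityʳ (suc b))))) ⟩
    ℤ.+ a ℚᵘ./ 1                                         ≈⟨ ℚᵘ.≃-sym (↑ᵘ a) ⟩
    ℚ.toℚᵘ (↑ a)                                         ∎)
    where open ℚᵘ.≃-Reasoning

↑-nonneg : ∀ n → 0ℚ ℚ.≤ ↑ n
↑-nonneg n = subst (ℚ._≤ ↑ n) ↑-zero (↑-mono z≤n)

↑-pos : ∀ {n} → 0 < n → 0ℚ ℚ.< ↑ n
↑-pos {n} 0<n = subst (ℚ._< ↑ n) ↑-zero (↑-< 0<n)

↑-cancel-≤ : ∀ {m n} → ↑ m ℚ.≤ ↑ n → m ≤ n
↑-cancel-≤ {m} {n} le with m ℕ.≤? n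
... | yes m≤n = m≤n
... | no m≰n = ⊥-elim (ℚ.<-irrefl refl (ℚ.<-≤-trans (↑-< (ℕ.≰⇒> m≰n)) le))

ℚ-*-monoˡ-≤ : ∀ c {a b} → 0ℚ ℚ.≤ c → a ℚ.≤ b → c ℚ.* a ℚ.≤ c ℚ.* b
ℚ-*-monoˡ-≤ c 0≤c = ℚ.*-monoˡ-≤-nonNeg c {{ℚ.nonNegative 0≤c}}

ℚ-*-monoʳ-≤ : ∀ c {a b} → 0ℚ ℚ.≤ c → a ℚ.≤ b → a ℚ.* c ℚ.≤ b ℚ.* c
ℚ-*-monoʳ-≤ c 0≤c = ℚ.*-monoʳ-≤-nonNeg c {{ℚ.nonNegative 0≤c}}

ℚ-*-mono-≤ : ∀ {a b c d} → 0ℚ ℚ.≤ a → 0ℚ ℚ.≤ d → a ℚ.≤ b → c ℚ.≤ d → a ℚ.* c ℚ.≤ b ℚ.* d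
ℚ-*-mono-≤ {a} {b} {c} {d} 0≤a 0≤d a≤b c≤d = ℚ.≤-trans (ℚ-*-monoˡ-≤ a 0≤a c≤d) (ℚ-*-monoʳ-≤ d 0≤d a≤b)

ℚ-*-cancelʳ-≤ : ∀ c {a b} → 0ℚ ℚ.< c → a ℚ.* c ℚ.≤ b ℚ.* c → a ℚ.≤ b
ℚ-*-cancelʳ-≤ c 0<c = ℚ.*-cancelʳ-≤-pos c {{ℚ.positive 0<c}}

ℚ-*-nonneg : ∀ {a b} → 0ℚ ℚ.≤ a → 0ℚ ℚ.≤ b → 0ℚ ℚ.≤ a ℚ.* b
ℚ-*-nonneg {a} {b} 0≤a 0≤b = subst (ℚ._≤ a ℚ.* b) (ℚ.*-zeroʳ a) (ℚ-*-monoˡ-≤ a 0≤a 0≤b)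

ℚ-*-pos : ∀ {a b} → 0ℚ ℚ.< a → 0ℚ ℚ.< b → 0ℚ ℚ.< a ℚ.* b
ℚ-*-pos {a} {b} 0<a 0<b = subst (ℚ._< a ℚ.* b) (ℚ.*-zeroʳ a) (ℚ.*-monoʳ-<-pos a {{ℚ.positive 0<a}} 0<b)

square-nonneg : ∀ a → 0ℚ ℚ.≤ a ℚ.* a
square-nonneg a with ℚ.≤-total 0ℚ a
... | inj₁ 0≤a = ℚ-*-nonneg 0≤a 0≤a
... | inj₂ a≤0 = subst (0ℚ ℚ.≤_) (solve 1 (λ a → :- a :* :- a := a :* a) refl a) (ℚ-*-nonneg 0≤-a 0≤-a)
  where
  open +-*-Solver
  0≤-a : 0ℚ ℚ.≤ ℚ.- a
  0≤-a = ℚ.neg-antimono-≤ a≤0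

p≤∣p∣ : ∀ q → q ℚ.≤ ℚ.∣ q ∣
p≤∣p∣ q with ℚ.≤-total 0ℚ q
... | inj₁ 0≤q = ℚ.≤-reflexive (sym (ℚ.0≤p⇒∣p∣≡p 0≤q))
... | inj₂ q≤0 = ℚ.≤-trans q≤0 (ℚ.0≤∣p∣ q)

ℚ-sum-mono : ∀ {n} {f g : Fin n → ℚ} → (∀ i → f i ℚ.≤ g i) → ℚΣ.sum f ℚ.≤ ℚΣ.sum g
ℚ-sum-mono {zero}  f≤g = ℚ.≤-refl
ℚ-sum-mono {suc n} f≤g = ℚ.+-mono-≤ (f≤g zero) (ℚ-sum-mono (f≤g ∘ suc))

ℚ-sum-const : ∀ n c → ℚΣ.sum {n} (λ _ → c) ≡ ↑ n ℚ.* c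
ℚ-sum-const zero    c = sym (trans (cong (ℚ._* c) ↑-zero) (ℚ.*-zeroˡ c))
ℚ-sum-const (suc n) c = begin
  c ℚ.+ ℚΣ.sum {n} (λ _ → c)    ≡⟨ cong₂ ℚ._+_ (sym (ℚ.*-identityˡ c)) (ℚ-sum-const n c) ⟩
  1ℚ ℚ.* c ℚ.+ ↑ n ℚ.* c        ≡⟨ sym (ℚ.*-distribʳ-+ c 1ℚ (↑ n)) ⟩
  (1ℚ ℚ.+ ↑ n) ℚ.* c            ≡⟨ cong (λ z → (z ℚ.+ ↑ n) ℚ.* c) (sym ↑-one) ⟩
  (↑ 1 ℚ.+ ↑ n) ℚ.* c           ≡⟨ cong (ℚ._* c) (sym (↑-+ 1 n)) ⟩
  ↑ (suc n) ℚ.* c               ∎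
  where open ≡-Reasoning

ℚ-sum-nonneg : ∀ {n} {f : Fin n → ℚ} → (∀ i → 0ℚ ℚ.≤ f i) → 0ℚ ℚ.≤ ℚΣ.sum f
ℚ-sum-nonneg {n} {f} 0≤f = subst (ℚ._≤ ℚΣ.sum f) (trans (ℚ-sum-const n 0ℚ) (ℚ.*-zeroʳ (↑ n))) (ℚ-sum-mono 0≤f)

ℚ-term≤sum : ∀ {n} {f : Fin n → ℚ} → (∀ i → 0ℚ ℚ.≤ f i) → ∀ i → f i ℚ.≤ ℚΣ.sum f
ℚ-term≤sum {f = f} 0≤f zero    = subst (ℚ._≤ ℚΣ.sum f) (ℚ.+-identityʳ (f zero))
  (ℚ.+-monoʳ-≤ (f zero) (ℚ-sum-nonneg (0≤f ∘ suc)))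
ℚ-term≤sum {f = f} 0≤f (suc i) = subst (ℚ._≤ ℚΣ.sum f) (ℚ.+-identityˡ (f (suc i)))
  (ℚ.+-mono-≤ (0≤f zero) (ℚ-term≤sum (0≤f ∘ suc) i))

-- Independent uniform labels in Fin (suc k)
module Expectation (k : ℕ) where

  Label : Set
  Label = Fin (suc k)

  weight : ℚ
  weight = ℤ.+ 1 ℚ./ suc k

  weight-inverse : weight ℚ.* ↑ (suc k) ≡ 1ℚ
  weight-inverse = trans (↑/ 1 k) ↑-one

  weight-pos : 0ℚ ℚ.< weight
  weight-pos = ℚ.positive⁻¹ weight {{ℚ.normalize-pos 1 (suc k)}}

  weight-nonneg : 0ℚ ℚ.≤ weight
  weight-nonneg = ℚ.<⇒≤ weight-pos

  mean : (Label → ℚ) → ℚ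
  mean f = weight ℚ.* ℚΣ.sum f

  mean-cong : ∀ {f g} → (∀ a → f a ≡ g a) → mean f ≡ mean g
  mean-cong f≗g = cong (weight ℚ.*_) (ℚΣ.sum-cong-≗ f≗g)

  mean-const : ∀ c → mean (λ _ → c) ≡ c
  mean-const c = begin
    weight ℚ.* ℚΣ.sum {suc k} (λ _ → c)  ≡⟨ cong (weight ℚ.*_) (ℚ-sum-const (suc k) c) ⟩
    weight ℚ.* (↑ (suc k) ℚ.* c)         ≡⟨ sym (ℚ.*-assoc weight (↑ (suc k)) c) ⟩
    weight ℚ.* ↑ (suc k) ℚ.* c           ≡⟨ cong (ℚ._* c) weight-inverse ⟩
    1ℚ ℚ.* c                             ≡⟨ ℚ.*-identityˡ c ⟩
    c                                    ∎
    where open ≡-Reasoning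

  mean-+ : ∀ f g → mean (λ a → f a ℚ.+ g a) ≡ mean f ℚ.+ mean g
  mean-+ f g = trans (cong (weight ℚ.*_) (ℚΣ.∑-distrib-+ f g)) (ℚ.*-distribˡ-+ weight (ℚΣ.sum f) (ℚΣ.sum g))

  mean-* : ∀ c f → mean (λ a → c ℚ.* f a) ≡ c ℚ.* mean f
  mean-* c f = trans (cong (weight ℚ.*_) (sym (ℚΣ.*-distribˡ-sum c f)))
    (solve 3 (λ w c s → w :* (c :* s) := c :* (w :* s)) refl weight c (ℚΣ.sum f))
    where open +-*-Solver

  mean-mono : ∀ {f g} → (∀ a → f a ℚ.≤ g a) → mean f ℚ.≤ mean g
  mean-mono f≤g = ℚ-*-monoˡ-≤ weight weight-nonneg (ℚ-sum-mono f≤g)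

  mean-swap : ∀ (f : Label → Label → ℚ) → mean (λ a → mean (f a)) ≡ mean (λ b → mean (λ a → f a b))
  mean-swap f = cong (weight ℚ.*_) (begin
    ℚΣ.sum (λ a → weight ℚ.* ℚΣ.sum (f a))          ≡⟨ sym (ℚΣ.*-distribˡ-sum weight (λ a → ℚΣ.sum (f a))) ⟩
    weight ℚ.* ℚΣ.sum (λ a → ℚΣ.sum (f a))          ≡⟨ cong (weight ℚ.*_) (ℚΣ.∑-comm f) ⟩
    weight ℚ.* ℚΣ.sum (λ b → ℚΣ.sum (λ a → f a b))  ≡⟨ ℚΣ.*-distribˡ-sum weight (λ b → ℚΣ.sum (λ a → f a b)) ⟩
    ℚΣ.sum (λ b → weight ℚ.* ℚΣ.sum (λ a → f a b))  ∎)
    where open ≡-Reasoning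

  𝔼 : ∀ {n} → (Vec Label n → ℚ) → ℚ
  𝔼 {zero}  f = f []
  𝔼 {suc n} f = mean λ a → 𝔼 λ ω → f (a ∷ ω)

  𝔼-cong : ∀ {n} {f g : Vec Label n → ℚ} → (∀ ω → f ω ≡ g ω) → 𝔼 f ≡ 𝔼 g
  𝔼-cong {zero}  f≗g = f≗g []
  𝔼-cong {suc n} f≗g = mean-cong λ a → 𝔼-cong λ ω → f≗g (a ∷ ω)

  𝔼-const : ∀ n c → 𝔼 {n} (λ _ → c) ≡ c
  𝔼-const zero    c = refl
  𝔼-const (suc n) c = trans (mean-cong λ _ → 𝔼-const n c) (mean-const c)

  𝔼-+ : ∀ {n} (f g : Vec Label n → ℚ) → 𝔼 (λ ω → f ω ℚ.+ g ω) ≡ 𝔼 f ℚ.+ 𝔼 g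
  𝔼-+ {zero}  f g = refl
  𝔼-+ {suc n} f g = trans (mean-cong λ a → 𝔼-+ (λ ω → f (a ∷ ω)) (λ ω → g (a ∷ ω)))
    (mean-+ (λ a → 𝔼 λ ω → f (a ∷ ω)) (λ a → 𝔼 λ ω → g (a ∷ ω)))

  𝔼-* : ∀ {n} c (f : Vec Label n → ℚ) → 𝔼 (λ ω → c ℚ.* f ω) ≡ c ℚ.* 𝔼 f
  𝔼-* {zero}  c f = refl
  𝔼-* {suc n} c f = trans (mean-cong λ a → 𝔼-* c (λ ω → f (a ∷ ω))) (mean-* c (λ a → 𝔼 λ ω → f (a ∷ ω)))

  𝔼-mono : ∀ {n} {f g : Vec Label n → ℚ} → (∀ ω → f ω ℚ.≤ g ω) → 𝔼 f ℚ.≤ 𝔼 g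
  𝔼-mono {zero}  f≤g = f≤g []
  𝔼-mono {suc n} f≤g = mean-mono λ a → 𝔼-mono λ ω → f≤g (a ∷ ω)

  𝔼-sum : ∀ {n} m (f : Fin m → Vec Label n → ℚ) → 𝔼 (λ ω → ℚΣ.sum (λ i → f i ω)) ≡ ℚΣ.sum (λ i → 𝔼 (f i))
  𝔼-sum {n} zero    f = 𝔼-const n 0ℚ
  𝔼-sum     (suc m) f = trans (𝔼-+ (f zero) (λ ω → ℚΣ.sum (λ i → f (suc i) ω)))
    (cong (𝔼 (f zero) ℚ.+_) (𝔼-sum m (f ∘ suc)))

  𝔼-resample : ∀ {n} (i : Fin n) (f : Vec Label n → ℚ) → 𝔼 f ≡ mean (λ a → 𝔼 (λ ω → f (ω Vec.[ i ]≔ a)))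
  𝔼-resample {suc n} zero    f = mean-cong λ a → sym (mean-const (𝔼 λ ω → f (a ∷ ω)))
  𝔼-resample {suc n} (suc i) f = trans (mean-cong λ b → 𝔼-resample i (λ ω → f (b ∷ ω)))
    (mean-swap λ b a → 𝔼 λ ω → f (b ∷ (ω Vec.[ i ]≔ a)))

  -- Labels read along an injection are again independent and uniform. `𝔼-resample` brings the
  -- coordinate `ι zero` to the front, and injectivity keeps the other coordinates that are read
  -- untouched by the update. This lets a ball be analysed with labels of its own.
  𝔼-marginal : ∀ {m n} (ι : Fin m → Fin n) → (∀ {i j} → ι i ≡ ι j → i ≡ j) → (g : Vec Label m → ℚ) →
               𝔼 (λ ω → g (Vec.tabulate (λ i → Vec.lookup ω (ι i)))) ≡ 𝔼 g
  𝔼-marginal {zero}  {n} ι inj g = 𝔼-const n (g [])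
  𝔼-marginal {suc m} ι inj g = trans (𝔼-resample (ι zero) _) (mean-cong λ a →
    trans
      (𝔼-cong λ ω → cong g (cong₂ _∷_ (Vec.lookup∘update (ι zero) ω a)
        (Vec.tabulate-cong λ i → Vec.lookup∘update′ (λ e → case (inj e)) ω a)))
      (𝔼-marginal (ι ∘ suc) (Fin.suc-injective ∘ inj) (λ ω → g (a ∷ ω))))
    where
    case : ∀ {i : Fin m} → suc i ≡ zero → ⊥
    case ()

  DependsOn : ∀ {n} → (Fin n → Set) → (Vec Label n → ℚ) → Set
  DependsOn S f = ∀ ω ω′ → (∀ i → S i → Vec.lookup ω i ≡ Vec.lookup ω′ i) → f ω ≡ f ω′

  DependsOn-tail : ∀ {n} {S : Fin (suc n) → Set} {f} → DependsOn S f → ∀ a → DependsOn (S ∘ suc) (λ ω → f (a ∷ ω))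
  DependsOn-tail dep a ω ω′ e = dep (a ∷ ω) (a ∷ ω′) λ { zero _ → refl ; (suc i) s → e i s }

  DependsOn-head : ∀ {n} {S : Fin (suc n) → Set} {f} → DependsOn S f → ¬ S zero → ∀ a b →
                   𝔼 (λ ω → f (a ∷ ω)) ≡ 𝔼 (λ ω → f (b ∷ ω))
  DependsOn-head dep s₀ a b = 𝔼-cong λ ω → dep (a ∷ ω) (b ∷ ω) λ { zero s → ⊥-elim (s₀ s) ; (suc i) _ → refl }

  -- At each coordinate the disjointness hypothesis names a factor that ignores it. The partial
  -- expectation of that factor is then constant in the coordinate and comes out of the mean.
  𝔼-independent : ∀ {n} {S T : Fin n → Set} (f g : Vec Label n → ℚ) → DependsOn S f → DependsOn T g →
                  (∀ i → ¬ S i ⊎ ¬ T i) → 𝔼 (λ ω → f ω ℚ.* g ω) ≡ 𝔼 f ℚ.* 𝔼 g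
  𝔼-independent {zero}  f g _ _ _ = refl
  𝔼-independent {suc n} f g df dg disj = trans
    (mean-cong λ a → 𝔼-independent (λ ω → f (a ∷ ω)) (λ ω → g (a ∷ ω)) (DependsOn-tail df a) (DependsOn-tail dg a) (disj ∘ suc))
    (go (disj zero))
    where
    F G : Label → ℚ
    F a = 𝔼 λ ω → f (a ∷ ω)
    G a = 𝔼 λ ω → g (a ∷ ω)
    const-mean : ∀ (H : Label → ℚ) → (∀ a b → H a ≡ H b) → mean H ≡ H zero
    const-mean H e = trans (mean-cong λ a → e a zero) (mean-const (H zero))
    go : _ → mean (λ a → F a ℚ.* G a) ≡ mean F ℚ.* mean G
    go (inj₁ s₀) = begin
      mean (λ a → F a ℚ.* G a)     ≡⟨ mean-cong (λ a → cong (ℚ._* G a) (DependsOn-head df s₀ a zero)) ⟩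
      mean (λ a → F zero ℚ.* G a)  ≡⟨ mean-* (F zero) G ⟩
      F zero ℚ.* mean G            ≡⟨ cong (ℚ._* mean G) (sym (const-mean F (DependsOn-head df s₀))) ⟩
      mean F ℚ.* mean G            ∎
      where open ≡-Reasoning
    go (inj₂ t₀) = begin
      mean (λ a → F a ℚ.* G a)
        ≡⟨ mean-cong (λ a → trans (cong (F a ℚ.*_) (DependsOn-head dg t₀ a zero)) (ℚ.*-comm (F a) (G zero))) ⟩
      mean (λ a → G zero ℚ.* F a)  ≡⟨ mean-* (G zero) F ⟩
      G zero ℚ.* mean F            ≡⟨ ℚ.*-comm (G zero) (mean F) ⟩
      mean F ℚ.* G zero            ≡⟨ cong (mean F ℚ.*_) (sym (const-mean G (DependsOn-head dg t₀))) ⟩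
      mean F ℚ.* mean G            ∎
      where open ≡-Reasoning

  mean-attains : ∀ (g : Label → ℚ) c → mean g ℚ.≤ c → ∃ λ a → g a ℚ.≤ c
  mean-attains g c le with Fin.any? (λ a → g a ℚ.≤? c)
  ... | yes found = found
  ... | no none = ⊥-elim (ℚ.<-irrefl refl (ℚ.<-≤-trans c<mean le))
    where
    above : ∀ a → c ℚ.< g a
    above a = ℚ.≰⇒> λ le → none (a , le)
    sum-strict : ∀ {m} (h : Fin (suc m) → ℚ) → (∀ a → c ℚ.< h a) → ℚΣ.sum {suc m} (λ _ → c) ℚ.< ℚΣ.sum h
    sum-strict {m} h c<h = ℚ.+-mono-<-≤ (c<h zero) (ℚ-sum-mono {m} (λ i → ℚ.<⇒≤ (c<h (suc i))))
    c<mean : c ℚ.< mean g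
    c<mean = subst (ℚ._< mean g) (mean-const c) (ℚ.*-monoʳ-<-pos weight {{ℚ.positive weight-pos}} (sum-strict g above))

  𝔼-attains : ∀ {n} (f : Vec Label n → ℚ) c → 𝔼 f ℚ.≤ c → ∃ λ ω → f ω ℚ.≤ c
  𝔼-attains {zero}  f c le = [] , le
  𝔼-attains {suc n} f c le with mean-attains (λ a → 𝔼 λ ω → f (a ∷ ω)) c le
  ... | a , le′ with 𝔼-attains (λ ω → f (a ∷ ω)) c le′
  ... | ω , le″ = a ∷ ω , le″

  -- Markov's inequality for X and Y at once, applied to b X + a Y.
  𝔼-attains₂ : ∀ {n} (X Y : Vec Label n → ℚ) a b → (∀ ω → 0ℚ ℚ.≤ X ω) → (∀ ω → 0ℚ ℚ.≤ Y ω) →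
               0ℚ ℚ.< a → 0ℚ ℚ.< b → 𝔼 X ℚ.≤ a → 𝔼 Y ℚ.≤ b →
               ∃ λ ω → X ω ℚ.≤ a ℚ.+ a × Y ω ℚ.≤ b ℚ.+ b
  𝔼-attains₂ {n} X Y a b 0≤X 0≤Y 0<a 0<b X≤a Y≤b = ω , X-bound , Y-bound
    where
    open ℚ.≤-Reasoning
    open +-*-Solver
    0≤a = ℚ.<⇒≤ 0<a
    0≤b = ℚ.<⇒≤ 0<b
    Z : Vec Label n → ℚ
    Z ω = b ℚ.* X ω ℚ.+ a ℚ.* Y ω
    Z-mean : 𝔼 Z ℚ.≤ (a ℚ.+ a) ℚ.* b
    Z-mean = begin
      𝔼 Z                        ≡⟨ 𝔼-+ (λ ω → b ℚ.* X ω) (λ ω → a ℚ.* Y ω) ⟩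
      𝔼 (λ ω → b ℚ.* X ω) ℚ.+ 𝔼 (λ ω → a ℚ.* Y ω) ≡⟨ cong₂ ℚ._+_ (𝔼-* b X) (𝔼-* a Y) ⟩
      b ℚ.* 𝔼 X ℚ.+ a ℚ.* 𝔼 Y    ≤⟨ ℚ.+-mono-≤ (ℚ-*-monoˡ-≤ b 0≤b X≤a) (ℚ-*-monoˡ-≤ a 0≤a Y≤b) ⟩
      b ℚ.* a ℚ.+ a ℚ.* b        ≡⟨ solve 2 (λ a b → b :* a :+ a :* b := (a :+ a) :* b) refl a b ⟩
      (a ℚ.+ a) ℚ.* b            ∎
    chosen = 𝔼-attains Z ((a ℚ.+ a) ℚ.* b) Z-mean
    ω = proj₁ chosen
    X-bound : X ω ℚ.≤ a ℚ.+ a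
    X-bound = ℚ-*-cancelʳ-≤ b 0<b (begin
      X ω ℚ.* b              ≡⟨ solve 2 (λ x b → x :* b := b :* x :+ con ℚ.0ℚ) refl (X ω) b ⟩
      b ℚ.* X ω ℚ.+ 0ℚ       ≤⟨ ℚ.+-monoʳ-≤ (b ℚ.* X ω) (ℚ-*-nonneg 0≤a (0≤Y ω)) ⟩
      Z ω                    ≤⟨ proj₂ chosen ⟩
      (a ℚ.+ a) ℚ.* b        ∎)
    Y-bound : Y ω ℚ.≤ b ℚ.+ b
    Y-bound = ℚ-*-cancelʳ-≤ a 0<a (begin
      Y ω ℚ.* a              ≡⟨ solve 2 (λ y a → y :* a := con ℚ.0ℚ :+ a :* y) refl (Y ω) a ⟩
      0ℚ ℚ.+ a ℚ.* Y ω       ≤⟨ ℚ.+-monoˡ-≤ (a ℚ.* Y ω) (ℚ-*-nonneg 0≤b (0≤X ω)) ⟩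
      Z ω                    ≤⟨ proj₂ chosen ⟩
      (a ℚ.+ a) ℚ.* b        ≡⟨ solve 2 (λ a b → (a :+ a) :* b := (b :+ b) :* a) refl a b ⟩
      (b ℚ.+ b) ℚ.* a        ∎)

-- Counting

module ℕΣ = Sum ℕ.+-*-semiring

⟦_⟧ : ∀ {A : Set} → Dec A → ℕ
⟦ yes _ ⟧ = 1
⟦ no  _ ⟧ = 0

⟦⟧-mono : ∀ {A B : Set} (a? : Dec A) (b? : Dec B) → (A → B) → ⟦ a? ⟧ ≤ ⟦ b? ⟧
⟦⟧-mono (yes a) (yes b) f = ℕ.≤-refl
⟦⟧-mono (yes a) (no ¬b) f = ⊥-elim (¬b (f a))
⟦⟧-mono (no ¬a) b?      f = z≤n

⟦⟧-cong : ∀ {A B : Set} (a? : Dec A) (b? : Dec B) → (A → B) → (B → A) → ⟦ a? ⟧ ≡ ⟦ b? ⟧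
⟦⟧-cong a? b? f g = ℕ.≤-antisym (⟦⟧-mono a? b? f) (⟦⟧-mono b? a? g)

⟦⟧≤1 : ∀ {A : Set} (a? : Dec A) → ⟦ a? ⟧ ≤ 1
⟦⟧≤1 (yes _) = ℕ.≤-refl
⟦⟧≤1 (no _)  = z≤n

⟦⟧-yes : ∀ {A : Set} (a? : Dec A) → A → ⟦ a? ⟧ ≡ 1
⟦⟧-yes (yes _) a = refl
⟦⟧-yes (no ¬a) a = ⊥-elim (¬a a)

⟦⟧-no : ∀ {A : Set} (a? : Dec A) → ¬ A → ⟦ a? ⟧ ≡ 0
⟦⟧-no (yes a) ¬a = ⊥-elim (¬a a)
⟦⟧-no (no _)  ¬a = refl

⟦⟧-× : ∀ {A B : Set} (a? : Dec A) (b? : Dec B) → ⟦ a? ×-dec b? ⟧ ≡ ⟦ a? ⟧ * ⟦ b? ⟧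
⟦⟧-× (yes _) (yes _) = refl
⟦⟧-× (yes _) (no _)  = refl
⟦⟧-× (no _)  b?      = refl

sum-mono : ∀ {n} {f g : Fin n → ℕ} → (∀ i → f i ≤ g i) → ℕΣ.sum f ≤ ℕΣ.sum g
sum-mono {zero}  f≤g = z≤n
sum-mono {suc n} f≤g = ℕ.+-mono-≤ (f≤g zero) (sum-mono (f≤g ∘ suc))

sum-zero : ∀ {n} {f : Fin n → ℕ} → (∀ i → f i ≡ 0) → ℕΣ.sum f ≡ 0
sum-zero {n} f≡0 = trans (ℕΣ.sum-cong-≗ f≡0) (ℕΣ.sum-replicate-zero n)

term≤sum : ∀ {n} (f : Fin n → ℕ) i → f i ≤ ℕΣ.sum f
term≤sum f zero    = ℕ.m≤m+n (f zero) _
term≤sum f (suc i) = ℕ.m≤n⇒m≤o+n (f zero) (term≤sum (f ∘ suc) i)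

↑-sum : ∀ {n} (f : Fin n → ℕ) → ↑ ℕΣ.sum f ≡ ℚΣ.sum (λ i → ↑ f i)
↑-sum {zero}  f = ↑-zero
↑-sum {suc n} f = trans (↑-+ (f zero) (ℕΣ.sum (f ∘ suc))) (cong (↑ f zero ℚ.+_) (↑-sum (f ∘ suc)))

sum-delta : ∀ {n} (x : Fin n) (g : Fin n → ℕ) → ℕΣ.sum (λ w → ⟦ x Fin.≟ w ⟧ * g w) ≡ g x
sum-delta {suc n} zero g = trans
  (cong (ℕ._+_ (g zero ℕ.+ 0)) (sum-zero {n} λ _ → refl))
  (trans (ℕ.+-identityʳ _) (ℕ.+-identityʳ _))
sum-delta {suc n} (suc x) g = trans
  (ℕΣ.sum-cong-≗ {n} λ w → cong (_* g (suc w)) (⟦⟧-cong (suc x Fin.≟ suc w) (x Fin.≟ w) Fin.suc-injective (cong suc)))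
  (sum-delta x (g ∘ suc))

module _ {n} {P : Fin n → Set} (P? : ∀ x → Dec (P x)) (unique : ∀ {x y} → P x → P y → x ≡ y) where

  sum-unique : ∀ {x} → P x → ℕΣ.sum (λ y → ⟦ P? y ⟧) ≡ 1
  sum-unique {x} px = trans
    (ℕΣ.sum-cong-≗ λ y → trans (⟦⟧-cong (P? y) (x Fin.≟ y) (unique px) (λ { refl → px })) (sym (ℕ.*-identityʳ _)))
    (sum-delta x (λ _ → 1))

  -- Exclusive alternatives add up to at most the indicator of their union. This is how an edge is
  -- charged to a single centre and to a single round.
  sum-unique-≤ : ∀ {Q : Set} (q? : Dec Q) → (∀ x → P x → Q) → ℕΣ.sum (λ y → ⟦ P? y ⟧) ≤ ⟦ q? ⟧
  sum-unique-≤ (yes q) f with Fin.any? P?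
  ... | yes (x , px) = ℕ.≤-reflexive (sum-unique px)
  ... | no none = subst (_≤ 1) (sym (sum-zero λ y → ⟦⟧-no (P? y) λ py → none (y , py))) z≤n
  sum-unique-≤ (no ¬q) f = ℕ.≤-reflexive (sum-zero λ y → ⟦⟧-no (P? y) (¬q ∘ f y))

module _ {m n} (ι : Fin m → Fin n) (injective : ∀ {u w} → ι u ≡ ι w → u ≡ w) where

  private
    fibre : Fin n → ℕ
    fibre w = ℕΣ.sum (λ u → ⟦ ι u Fin.≟ w ⟧)

    fibre-unique : ∀ {w u u′} → ι u ≡ w → ι u′ ≡ w → u ≡ u′
    fibre-unique p q = injective (trans p (sym q))

    sum-fibres : ∀ (g : Fin n → ℕ) → ℕΣ.sum (g ∘ ι) ≡ ℕΣ.sum (λ w → fibre w * g w)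
    sum-fibres g = begin
      ℕΣ.sum (λ u → g (ι u))                                  ≡⟨ ℕΣ.sum-cong-≗ (λ u → sym (sum-delta (ι u) g)) ⟩
      ℕΣ.sum (λ u → ℕΣ.sum (λ w → ⟦ ι u Fin.≟ w ⟧ * g w))     ≡⟨ ℕΣ.∑-comm (λ u w → ⟦ ι u Fin.≟ w ⟧ * g w) ⟩
      ℕΣ.sum (λ w → ℕΣ.sum (λ u → ⟦ ι u Fin.≟ w ⟧ * g w))
        ≡⟨ ℕΣ.sum-cong-≗ (λ w → sym (ℕΣ.*-distribʳ-sum (g w) (λ u → ⟦ ι u Fin.≟ w ⟧))) ⟩
      ℕΣ.sum (λ w → fibre w * g w)                            ∎
      where open ≡-Reasoning

  sum-embed-≤ : ∀ (g : Fin n → ℕ) → ℕΣ.sum (g ∘ ι) ≤ ℕΣ.sum g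
  sum-embed-≤ g = ℕ.≤-trans (ℕ.≤-reflexive (sum-fibres g)) (sum-mono λ w →
    ℕ.≤-trans (ℕ.*-monoˡ-≤ (g w) (sum-unique-≤ (λ u → ι u Fin.≟ w) fibre-unique (yes refl) (λ _ _ → refl {x = w})))
      (ℕ.≤-reflexive (ℕ.*-identityˡ (g w))))

  -- Moves counts in a large graph to an embedded one: a count that sees only a ball vanishes off
  -- the image.
  sum-embed : ∀ (g : Fin n → ℕ) → (∀ w → (∃ λ u → ι u ≡ w) ⊎ g w ≡ 0) → ℕΣ.sum g ≡ ℕΣ.sum (g ∘ ι)
  sum-embed g support = sym (trans (sum-fibres g) (ℕΣ.sum-cong-≗ λ w → go w (support w)))
    where
    go : ∀ w → (∃ λ u → ι u ≡ w) ⊎ g w ≡ 0 → fibre w * g w ≡ g w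
    go w (inj₁ (u , e)) = trans (cong (_* g w) (sum-unique (λ u → ι u Fin.≟ w) fibre-unique e)) (ℕ.*-identityˡ (g w))
    go w (inj₂ e) = trans (cong (fibre w *_) e) (trans (ℕ.*-zeroʳ (fibre w)) (sym e))

length-filter-tabulate : ∀ {A : Set} {P : A → Set} (P? : ∀ a → Dec (P a)) {n} (f : Fin n → A) →
                         length (filter P? (tabulate f)) ≡ ℕΣ.sum (λ i → ⟦ P? (f i) ⟧)
length-filter-tabulate P? {zero}  f = refl
length-filter-tabulate P? {suc n} f with P? (f zero)
... | yes _ = cong suc (length-filter-tabulate P? (f ∘ suc))
... | no  _ = length-filter-tabulate P? (f ∘ suc)

#≡sum : ∀ {n} {P : Pred (Fin n) 0ℓ} (P? : Decidable₁ P) → (# P?) ≡ ℕΣ.sum (λ x → ⟦ P? x ⟧)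
#≡sum P? = length-filter-tabulate P? id

#-mono : ∀ {n} {P Q : Pred (Fin n) 0ℓ} (P? : Decidable₁ P) (Q? : Decidable₁ Q) → (∀ x → P x → Q x) → (# P?) ≤ (# Q?)
#-mono P? Q? P⊆Q = subst₂ _≤_ (sym (#≡sum P?)) (sym (#≡sum Q?)) (sum-mono λ x → ⟦⟧-mono (P? x) (Q? x) (P⊆Q x))

length-filter-product : ∀ {A B : Set} {P : A × B → Set} (P? : ∀ c → Dec (P c)) {m} (f : Fin m → A) {n} (g : Fin n → B) →
  length (filter P? (cartesianProduct (tabulate f) (tabulate g))) ≡ ℕΣ.sum (λ i → ℕΣ.sum (λ j → ⟦ P? (f i , g j) ⟧))
length-filter-product P? {zero}  f g = refl
length-filter-product P? {suc m} f g = begin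
  length (filter P? (List.map (f zero ,_) (tabulate g) ++ cartesianProduct (tabulate (f ∘ suc)) (tabulate g)))
    ≡⟨ cong length (List.filter-++ P? (List.map (f zero ,_) (tabulate g)) _) ⟩
  length (filter P? (List.map (f zero ,_) (tabulate g)) ++ filter P? (cartesianProduct (tabulate (f ∘ suc)) (tabulate g)))
    ≡⟨ List.length-++ (filter P? (List.map (f zero ,_) (tabulate g))) ⟩
  length (filter P? (List.map (f zero ,_) (tabulate g))) + length (filter P? (cartesianProduct (tabulate (f ∘ suc)) (tabulate g)))
    ≡⟨ cong₂ _+_
         (trans (cong (length ∘ filter P?) (List.map-tabulate g (f zero ,_))) (length-filter-tabulate P? (λ j → f zero , g j)))
         (length-filter-product P? (f ∘ suc) g) ⟩
  ℕΣ.sum (λ j → ⟦ P? (f zero , g j) ⟧) + ℕΣ.sum (λ i → ℕΣ.sum (λ j → ⟦ P? (f (suc i) , g j) ⟧)) ∎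
  where open ≡-Reasoning

pairs-sum : ∀ {n} {P : Pred (Fin n × Fin n) 0ℓ} (P? : Decidable₁ P) →
            length (filter P? (pairs n)) ≡ ℕΣ.sum (λ x → ℕΣ.sum (λ y → ⟦ P? (x , y) ⟧))
pairs-sum P? = length-filter-product P? id id

-- Ordered pairs keep double sums free of the order on `Fin`, at the cost of counting each edge
-- twice; `pairCount-symmetric` returns to the convention of `edgeCount`.
pairCount : ∀ {n} {P : Fin n → Fin n → Set} → (∀ x y → Dec (P x y)) → ℕ
pairCount P? = ℕΣ.sum λ x → ℕΣ.sum λ y → ⟦ P? x y ⟧

pairCount-symmetric : ∀ {n} {P : Fin n → Fin n → Set} (P? : ∀ x y → Dec (P x y)) →
  (∀ {x y} → P x y → P y x) → (∀ {x} → ¬ P x x) →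
  pairCount P? ≡ 2 * pairCount (λ x y → (x Fin.<? y) ×-dec P? x y)
pairCount-symmetric {n} {P} P? symm irr = begin
  ℕΣ.sum (λ x → ℕΣ.sum (λ y → ⟦ P? x y ⟧))
    ≡⟨ ℕΣ.sum-cong-≗ (λ x → trans (ℕΣ.sum-cong-≗ (split-pair x)) (ℕΣ.∑-distrib-+ (up x) (λ y → up y x))) ⟩
  ℕΣ.sum (λ x → ℕΣ.sum (up x) + ℕΣ.sum (λ y → up y x))
    ≡⟨ ℕΣ.∑-distrib-+ (λ x → ℕΣ.sum (up x)) (λ x → ℕΣ.sum (λ y → up y x)) ⟩
  T + ℕΣ.sum (λ x → ℕΣ.sum (λ y → up y x))
    ≡⟨ cong (T +_) (ℕΣ.∑-comm (λ x y → up y x)) ⟩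
  T + T
    ≡⟨ cong (T +_) (sym (ℕ.+-identityʳ T)) ⟩
  2 * T ∎
  where
  open ≡-Reasoning
  up : Fin n → Fin n → ℕ
  up x y = ⟦ (x Fin.<? y) ×-dec P? x y ⟧
  T : ℕ
  T = ℕΣ.sum (λ x → ℕΣ.sum (up x))
  split-pair : ∀ x y → ⟦ P? x y ⟧ ≡ up x y + up y x
  split-pair x y with Fin.<-cmp x y
  ... | tri< x<y _ y≮x = trans
    (sym (ℕ.+-identityʳ _))
    (cong₂ _+_ (⟦⟧-cong (P? x y) ((x Fin.<? y) ×-dec P? x y) (x<y ,_) proj₂)
      (sym (⟦⟧-no ((y Fin.<? x) ×-dec P? y x) (y≮x ∘ proj₁))))
  ... | tri≈ _ refl _ = trans
    (⟦⟧-no (P? x x) irr)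
    (sym (cong₂ _+_ (⟦⟧-no ((x Fin.<? x) ×-dec P? x x) (irr ∘ proj₂)) (⟦⟧-no ((x Fin.<? x) ×-dec P? x x) (irr ∘ proj₂))))
  ... | tri> x≮y _ y<x = cong₂ _+_
      (sym (⟦⟧-no ((x Fin.<? y) ×-dec P? x y) (x≮y ∘ proj₁)))
      (⟦⟧-cong (P? x y) ((y Fin.<? x) ×-dec P? y x) (λ e → y<x , symm e) (symm ∘ proj₂))

-- The carving procedure and its locality

module _ {n} {G : Graph n} where

  Dist-mono : ∀ {r s x y} → r ≤ s → Dist≤ G r x y → Dist≤ G s x y
  Dist-mono _         here       = here
  Dist-mono (s≤s r≤s) (step e w) = step e (Dist-mono r≤s w)

  Dist-trans : ∀ {r s x y z} → Dist≤ G r x y → Dist≤ G s y z → Dist≤ G (r + s) x z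
  Dist-trans {r} {s} here v = Dist-mono (ℕ.m≤n+m s r) v
  Dist-trans (step e w)   v = step e (Dist-trans w v)

  Dist-snoc : ∀ {r x y z} → Dist≤ G r x y → G ⊢ y ~ z → Dist≤ G (suc r) x z
  Dist-snoc here       e = step e here
  Dist-snoc (step a w) e = step a (Dist-snoc w e)

  Dist-sym : ∀ {r x y} → Dist≤ G r x y → Dist≤ G r y x
  Dist-sym here       = here
  Dist-sym (step e w) = Dist-snoc (Dist-sym w) (Graph.symmetric G e)

  Dist⇒Reachable : ∀ {r x y} → Dist≤ G r x y → Reachable G x y
  Dist⇒Reachable here       = ε
  Dist⇒Reachable (step e w) = e ◅ Dist⇒Reachable w

Dist-⊑ : ∀ {n} {G H : Graph n} → G ⊑ H → ∀ {r x y} → Dist≤ G r x y → Dist≤ H r x y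
Dist-⊑ G⊑H here       = here
Dist-⊑ G⊑H (step e w) = step (G⊑H _ _ e) (Dist-⊑ G⊑H w)

-- The bound itself is returned when no smaller value succeeds, so the result is a legal radius in
-- any case.
search : (ℕ → Bool) → ℕ → ℕ
search P zero    = 0
search P (suc b) = if P 0 then 0 else suc (search (P ∘ suc) b)

search-≤ : ∀ P b → search P b ≤ b
search-≤ P zero = z≤n
search-≤ P (suc b) with P 0
... | true  = z≤n
... | false = s≤s (search-≤ (P ∘ suc) b)

search-cong : ∀ {P Q : ℕ → Bool} b → (∀ r → r < b → P r ≡ Q r) → search P b ≡ search Q b
search-cong zero e = refl
search-cong {P} {Q} (suc b) e rewrite e 0 (s≤s z≤n) with Q 0
... | true  = refl
... | false = cong suc (search-cong b λ r r<b → e (suc r) (s≤s r<b))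

search-finds : ∀ (P : ℕ → Bool) b {r} → r < b → P r ≡ true → P (search P b) ≡ true
search-finds P (suc b) r<b Pr = go (P 0) refl r<b Pr
  where
  go : ∀ c → P 0 ≡ c → ∀ {r} → r < suc b → P r ≡ true → P (if c then 0 else suc (search (P ∘ suc) b)) ≡ true
  go true  P0 _ _ = P0
  go false P0 {zero}  _         Pr with () ← trans (sym P0) Pr
  go false P0 {suc r} (s≤s r<b) Pr = search-finds (P ∘ suc) b r<b Pr

-- Dead vertices stay as isolated ones, so that all rounds share the vertex set. A dead vertex is
-- still at distance 0 from itself; hence `Centre` demands `S z ≡ true`.
within : ∀ {n} → Graph n → (Fin n → Bool) → Graph n
within G S = record
  { _~_         = λ x y → S x ≡ true × S y ≡ true × x ~ y
  ; _~?_        = λ x y → (S x Bool.≟ true) ×-dec (S y Bool.≟ true) ×-dec (x ~? y)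
  ; symmetric   = λ (a , b , e) → b , a , symmetric e
  ; irreflexive = λ x≡y (_ , _ , e) → irreflexive x≡y e
  }
  where open Graph G

within-⊑ : ∀ {n} (G : Graph n) S → within G S ⊑ G
within-⊑ G S x y (_ , _ , e) = e

-- k is the inverse of the boundary ratio of the carved balls and R bounds their radii.
module Carving (k R : ℕ) where

  module Run {n} (G : Graph n) (label : Fin n → ℕ) where
    open Graph G

    InBallEdge : (Fin n → Bool) → ℕ → Fin n → Fin n → Fin n → Set
    InBallEdge S r z x y = Dist≤ (within G S) r z x × Dist≤ (within G S) r z y × within G S ⊢ x ~ y

    inBallEdge? : ∀ S r z x y → Dec (InBallEdge S r z x y)
    inBallEdge? S r z x y =
      dist≤? (within G S) r z x ×-dec dist≤? (within G S) r z y ×-dec Graph._~?_ (within G S) x y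

    ballEdges : (Fin n → Bool) → ℕ → Fin n → ℕ
    ballEdges S r z = pairCount (inBallEdge? S r z)

    SlowGrowth : (Fin n → Bool) → Fin n → ℕ → Set
    SlowGrowth S z r = k * ballEdges S (suc r) z ≤ suc k * ballEdges S r z

    slowGrowth? : ∀ S z r → Dec (SlowGrowth S z r)
    slowGrowth? S z r = k * ballEdges S (suc r) z ℕ.≤? suc k * ballEdges S r z

    radius : (Fin n → Bool) → Fin n → ℕ
    radius S z = search (does ∘ slowGrowth? S z) R

    -- Two clusters of radius at most `R` share a vertex only if their centres are within `2R`, and
    -- are joined by an edge only if these are within `2R + 1`. Distances are taken in the whole of
    -- `G`, so conflicts depend on the labels alone and not on earlier rounds.
    Conflict : Fin n → Set
    Conflict z = ∃ λ z′ → z′ ≢ z × Dist≤ G (suc (R + R)) z z′ × label z′ ≡ label z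

    conflict? : ∀ z → Dec (Conflict z)
    conflict? z = Fin.any? λ z′ → ¬? (z′ Fin.≟ z) ×-dec dist≤? G (suc (R + R)) z z′ ×-dec (label z′ ℕ.≟ label z)

    Centre : ℕ → (Fin n → Bool) → Fin n → Set
    Centre t S z = label z ≡ t × S z ≡ true × ¬ Conflict z

    Carved : ℕ → (Fin n → Bool) → Fin n → Set
    Carved t S x = ∃ λ z → Centre t S z × Dist≤ (within G S) (radius S z) z x

    carved? : ∀ t S x → Dec (Carved t S x)
    carved? t S x = Fin.any? λ z →
      ((label z ℕ.≟ t) ×-dec (S z Bool.≟ true) ×-dec ¬? (conflict? z)) ×-dec dist≤? (within G S) (radius S z) z x

    state : ℕ → Fin n → Bool
    state zero    x = true
    state (suc t) x = state t x ∧ not (does (carved? t (state t) x))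

    CarvedAt : ℕ → Fin n → Set
    CarvedAt t = Carved t (state t)

    -- A common round is demanded rather than a common centre; the spacing of centres makes the two
    -- equivalent for adjacent vertices, see `cluster-edge`.
    output : ℕ → Graph n
    output M = record
      { _~_         = λ x y → x ~ y × ∃ λ (t : Fin M) → CarvedAt (toℕ t) x × CarvedAt (toℕ t) y
      ; _~?_        = λ x y → (x ~? y) ×-dec Fin.any? λ t →
                        carved? (toℕ t) (state (toℕ t)) x ×-dec carved? (toℕ t) (state (toℕ t)) y
      ; symmetric   = λ (e , t , a , b) → symmetric e , t , b , a
      ; irreflexive = λ x≡y (e , _) → irreflexive x≡y e
      }

  -- To decide whether a vertex is carved in a round one looks at most `R` far for a centre,
  -- `2R + 1` further for its conflicts, which also covers the balls compared for its radius, and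
  -- from there at the previous state.
  range : ℕ → ℕ
  range zero    = 0
  range (suc t) = R + (suc (R + R) + range t)

  range-suc : ∀ t → range t ≤ range (suc t)
  range-suc t = ℕ.≤-trans (ℕ.m≤n+m (range t) (suc (R + R))) (ℕ.m≤n+m _ R)

  range-mono : ∀ {s t} → s ℕ.≤′ t → range s ≤ range t
  range-mono ℕ.≤′-refl             = ℕ.≤-refl
  range-mono (ℕ.≤′-step {n = t} p) = ℕ.≤-trans (range-mono p) (range-suc t)

  -- A component stays within `2R` of each of its vertices, and its edges are decided by views of
  -- depth `range M`. The extra 1 keeps the neighbours of its vertices, across which a walk is
  -- pulled back, in view.
  depth : ℕ → ℕ
  depth M = (R + R) + suc (range M)

  -- An embedding between two labelled graphs covers both uses of locality: `ι = id` with two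
  -- labellings shows that only nearby labels matter, and the inclusion of a ball shows that only
  -- its isomorphism type matters.
  module Locality {m n} (H : Graph m) (G : Graph n) (labelᴴ : Fin m → ℕ) (labelᴳ : Fin n → ℕ)
    (ι : Fin m → Fin n) (injective : ∀ {u w} → ι u ≡ ι w → u ≡ w)
    (preserves : ∀ {u w} → H ⊢ u ~ w → G ⊢ ι u ~ ι w)
    (reflects : ∀ {u w} → G ⊢ ι u ~ ι w → H ⊢ u ~ w) where

    module 𝓗 = Run H labelᴴ
    module 𝓖 = Run G labelᴳ

    -- Only the ball in `G` is mentioned. Walks in `H` map into it by `preserves`, and its walks
    -- come back by `reflects`.
    Sees : ℕ → Fin m → Set
    Sees r u = ∀ {w′} → Dist≤ G r (ι u) w′ → ∃ λ w → ι w ≡ w′ × labelᴴ w ≡ labelᴳ w′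

    Sees-mono : ∀ {r s u} → r ≤ s → Sees s u → Sees r u
    Sees-mono r≤s sees d = sees (Dist-mono r≤s d)

    Sees-label : ∀ {r u} → Sees r u → labelᴴ u ≡ labelᴳ (ι u)
    Sees-label sees with sees here
    ... | w , e , l = subst (λ z → labelᴴ z ≡ labelᴳ _) (injective e) l

    Dist-ι : ∀ {r u w} → Dist≤ H r u w → Dist≤ G r (ι u) (ι w)
    Dist-ι here       = here
    Dist-ι (step e w) = step (preserves e) (Dist-ι w)

    Sees-move : ∀ s {r u w} → Dist≤ H s u w → Sees (s + r) u → Sees r w
    Sees-move s d sees d′ = sees (Dist-trans (Dist-ι d) d′)

    Agree : ℕ → (Fin m → Bool) → (Fin n → Bool) → Set
    Agree ρ S S′ = ∀ {u} → Sees ρ u → S u ≡ S′ (ι u)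

    module Step {ρ S S′} (agree : Agree ρ S S′) where

      dist-fwd : ∀ {r u w} → Sees (r + ρ) u → Dist≤ (within H S) r u w → Dist≤ (within G S′) r (ι u) (ι w)
      dist-fwd sees here = here
      dist-fwd {suc r} {u} sees (step {y = v} (Su , Sv , e) d) = step
        ( trans (sym (agree (Sees-mono (ℕ.m≤n+m ρ (suc r)) sees))) Su
        , trans (sym (agree (Sees-mono (ℕ.m≤n+m ρ r) sees′))) Sv
        , preserves e)
        (dist-fwd sees′ d)
        where
        sees′ : Sees (r + ρ) v
        sees′ = Sees-move 1 (step e here) sees

      dist-bwd : ∀ {r u w′} → Sees (r + ρ) u → Dist≤ (within G S′) r (ι u) w′ →
                 ∃ λ w → ι w ≡ w′ × Dist≤ (within H S) r u w
      dist-bwd {u = u} sees here = u , refl , here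
      dist-bwd {suc r} {u} sees (step {y = v′} (Su , Sv , e) d) with sees (step e here)
      ... | v , refl , _ with dist-bwd {r} {v} (Sees-move 1 (step (reflects e) here) sees) d
      ... | w , eq , d′ = w , eq , step
        ( trans (agree (Sees-mono (ℕ.m≤n+m ρ (suc r)) sees)) Su
        , trans (agree (Sees-mono (ℕ.m≤n+m ρ r) (Sees-move 1 (step (reflects e) here) sees))) Sv
        , reflects e) d′

      dist-bwd-ι : ∀ {r u w} → Sees (r + ρ) u → Dist≤ (within G S′) r (ι u) (ι w) → Dist≤ (within H S) r u w
      dist-bwd-ι {r} {u} sees d with dist-bwd sees d
      ... | w , eq , d′ = subst (Dist≤ (within H S) r u) (injective eq) d′

      ballEdges-local : ∀ r {u} → Sees (r + ρ) u → 𝓗.ballEdges S r u ≡ 𝓖.ballEdges S′ r (ι u)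
      ballEdges-local r {u} sees = sym (begin
        ℕΣ.sum (λ x → ℕΣ.sum (λ y → g x y))          ≡⟨ sum-embed ι injective _ outer ⟩
        ℕΣ.sum (λ x → ℕΣ.sum (λ y → g (ι x) y))
          ≡⟨ ℕΣ.sum-cong-≗ (λ x → sum-embed ι injective _ (inner (ι x))) ⟩
        ℕΣ.sum (λ x → ℕΣ.sum (λ y → g (ι x) (ι y)))  ≡⟨ ℕΣ.sum-cong-≗ (λ x → ℕΣ.sum-cong-≗ (λ y →
                                                           ⟦⟧-cong (𝓖.inBallEdge? S′ r (ι u) (ι x) (ι y)) (𝓗.inBallEdge? S r u x y) bwd fwd)) ⟩
        ℕΣ.sum (λ x → ℕΣ.sum (λ y → ⟦ 𝓗.inBallEdge? S r u x y ⟧)) ∎)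
        where
        open ≡-Reasoning
        g : Fin n → Fin n → ℕ
        g x y = ⟦ 𝓖.inBallEdge? S′ r (ι u) x y ⟧
        image? : ∀ w → Dec (∃ λ v → ι v ≡ w)
        image? w = Fin.any? λ v → ι v Fin.≟ w
        image : ∀ {w} → Dist≤ (within G S′) r (ι u) w → ∃ λ v → ι v ≡ w
        image d with dist-bwd sees d
        ... | v , eq , _ = v , eq
        inner : ∀ x y → (∃ λ v → ι v ≡ y) ⊎ g x y ≡ 0
        inner x y with image? y
        ... | yes i = inj₁ i
        ... | no ¬i = inj₂ (⟦⟧-no (𝓖.inBallEdge? S′ r (ι u) x y) λ (_ , d , _) → ¬i (image d))
        outer : ∀ x → (∃ λ v → ι v ≡ x) ⊎ ℕΣ.sum (g x) ≡ 0
        outer x with image? x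
        ... | yes i = inj₁ i
        ... | no ¬i = inj₂ (sum-zero λ y → ⟦⟧-no (𝓖.inBallEdge? S′ r (ι u) x y) λ (d , _) → ¬i (image d))
        member : ∀ {x} → Dist≤ (within H S) r u x → Sees ρ x
        member d = Sees-move r (Dist-⊑ (within-⊑ H S) d) sees
        fwd : ∀ {x y} → 𝓗.InBallEdge S r u x y → 𝓖.InBallEdge S′ r (ι u) (ι x) (ι y)
        fwd (dx , dy , Sx , Sy , e) = dist-fwd sees dx , dist-fwd sees dy
          , trans (sym (agree (member dx))) Sx , trans (sym (agree (member dy))) Sy , preserves e
        bwd : ∀ {x y} → 𝓖.InBallEdge S′ r (ι u) (ι x) (ι y) → 𝓗.InBallEdge S r u x y
        bwd (dx , dy , Sx , Sy , e) = dx′ , dy′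
          , trans (agree (member dx′)) Sx , trans (agree (member dy′)) Sy , reflects e
          where
          dx′ = dist-bwd-ι sees dx
          dy′ = dist-bwd-ι sees dy

      radius-local : ∀ {u} → Sees (R + ρ) u → 𝓗.radius S u ≡ 𝓖.radius S′ (ι u)
      -- Only `r < R` is tested, so the larger ball of each comparison still has radius `suc r ≤ R`.
      radius-local {u} sees = search-cong R λ r r<R → cong₂ (λ a b → does (k * a ℕ.≤? suc k * b))
        (ballEdges-local (suc r) (Sees-mono (ℕ.+-monoˡ-≤ ρ r<R) sees))
        (ballEdges-local r (Sees-mono (ℕ.+-monoˡ-≤ ρ (ℕ.<⇒≤ r<R)) sees))

      conflict-fwd : ∀ {u} → Sees (suc (R + R) + ρ) u → 𝓗.Conflict u → 𝓖.Conflict (ι u)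
      conflict-fwd {u} sees (w , w≢u , d , l) = ι w , w≢u ∘ injective , Dist-ι d
        , trans (sym (Sees-label (Sees-move (suc (R + R)) d sees))) (trans l (Sees-label sees))

      conflict-bwd : ∀ {u} → Sees (suc (R + R) + ρ) u → 𝓖.Conflict (ι u) → 𝓗.Conflict u
      conflict-bwd {u} sees (w′ , w′≢u , d , l) with pull (suc (R + R)) sees d
        where
        pull : ∀ r {u w′} → Sees (r + ρ) u → Dist≤ G r (ι u) w′ → ∃ λ w → ι w ≡ w′ × Dist≤ H r u w
        pull r {u} s here = u , refl , here
        pull (suc r) {u} s (step e d) with s (step e here)
        ... | v , refl , _ with pull r {v} (Sees-move 1 (step (reflects e) here) s) d
        ... | w , eq , d′ = w , eq , step (reflects e) d′
      ... | w , refl , d′ = w , (λ { refl → w′≢u refl }) , d′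
        , trans (Sees-label (Sees-move (suc (R + R)) d′ sees)) (trans l (sym (Sees-label sees)))

      module _ {t : ℕ} {z} (sees : Sees (suc (R + R) + ρ) z) where

        centre-fwd : 𝓗.Centre t S z → 𝓖.Centre t S′ (ι z)
        centre-fwd (l , Sz , nc) = trans (sym (Sees-label sees)) l
          , trans (sym (agree (Sees-mono (ℕ.m≤n+m ρ _) sees))) Sz , nc ∘ conflict-bwd sees

        centre-bwd : 𝓖.Centre t S′ (ι z) → 𝓗.Centre t S z
        centre-bwd (l , Sz , nc) = trans (Sees-label sees) l
          , trans (agree (Sees-mono (ℕ.m≤n+m ρ _) sees)) Sz , nc ∘ conflict-fwd sees

      R≤D : R + ρ ≤ suc (R + R) + ρ
      R≤D = ℕ.+-monoˡ-≤ ρ (ℕ.m≤n⇒m≤1+n (ℕ.m≤m+n R R))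

      module _ {t : ℕ} {u} (sees : Sees (R + (suc (R + R) + ρ)) u) where

        private
          seesR : Sees (R + ρ) u
          seesR = Sees-mono (ℕ.+-monoʳ-≤ R (ℕ.m≤n+m ρ _)) sees

        carved-fwd : 𝓗.Carved t S u → 𝓖.Carved t S′ (ι u)
        carved-fwd (z , c , d) = ι z , centre-fwd sees-z c ,
          subst (λ r → Dist≤ (within G S′) r (ι z) (ι u)) (radius-local (Sees-mono R≤D sees-z))
            (dist-fwd (Sees-mono (ℕ.+-monoˡ-≤ ρ r≤R) (Sees-mono R≤D sees-z)) d)
          where
          r≤R : 𝓗.radius S z ≤ R
          r≤R = search-≤ _ R
          sees-z : Sees (suc (R + R) + ρ) z
          sees-z = Sees-move R (Dist-sym (Dist-mono r≤R (Dist-⊑ (within-⊑ H S) d))) sees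

        carved-bwd : 𝓖.Carved t S′ (ι u) → 𝓗.Carved t S u
        -- Only the view from `ι u` is given, so the path is reversed and the centre is found in the
        -- image by walking away from `u`.
        carved-bwd (z′ , c , d) with dist-bwd (Sees-mono (ℕ.+-monoˡ-≤ ρ (search-≤ _ R)) seesR) (Dist-sym d)
        ... | z , refl , d′ = z , centre-bwd sees-z c ,
          subst (λ r → Dist≤ (within H S) r z u) (sym (radius-local (Sees-mono R≤D sees-z))) (Dist-sym d′)
          where
          r≤R : 𝓖.radius S′ (ι z) ≤ R
          r≤R = search-≤ _ R
          sees-z : Sees (suc (R + R) + ρ) z
          sees-z = Sees-move R (Dist-mono r≤R (Dist-⊑ (within-⊑ H S) d′)) sees

    state-local : ∀ t → Agree (range t) (𝓗.state t) (𝓖.state t)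
    state-local zero    sees = refl
    state-local (suc t) {u} sees = cong₂ (λ a b → a ∧ not b)
      (state-local t (Sees-mono (range-suc t) sees))
      (does-cong (𝓗.carved? t (𝓗.state t) u) (𝓖.carved? t (𝓖.state t) (ι u))
        (Step.carved-fwd (state-local t) sees) (Step.carved-bwd (state-local t) sees))
      where
      does-cong : ∀ {A B : Set} (a? : Dec A) (b? : Dec B) → (A → B) → (B → A) → does a? ≡ does b?
      does-cong (yes a) b? f g = sym (dec-true b? (f a))
      does-cong (no ¬a) b? f g = sym (dec-false b? (¬a ∘ g))

    module _ {M : ℕ} {u} (sees : Sees (range M) u) (t : Fin M) where

      private
        sees-t : Sees (range (suc (toℕ t))) u
        sees-t = Sees-mono (range-mono (ℕ.≤⇒≤′ (Fin.toℕ<n t))) sees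

      carvedAt-fwd : 𝓗.CarvedAt (toℕ t) u → 𝓖.CarvedAt (toℕ t) (ι u)
      carvedAt-fwd = Step.carved-fwd (state-local (toℕ t)) sees-t

      carvedAt-bwd : 𝓖.CarvedAt (toℕ t) (ι u) → 𝓗.CarvedAt (toℕ t) u
      carvedAt-bwd = Step.carved-bwd (state-local (toℕ t)) sees-t

    module _ {M : ℕ} {u w} (su : Sees (range M) u) (sw : Sees (range M) w) where

      output-fwd : 𝓗.output M ⊢ u ~ w → 𝓖.output M ⊢ ι u ~ ι w
      output-fwd (e , t , a , b) = preserves e , t , carvedAt-fwd su t a , carvedAt-fwd sw t b

      output-bwd : 𝓖.output M ⊢ ι u ~ ι w → 𝓗.output M ⊢ u ~ w
      output-bwd (e , t , a , b) = reflects e , t , carvedAt-bwd su t a , carvedAt-bwd sw t b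

-- Clusters and the number of cut edges

lookup-injective : ∀ {A : Set} {xs : List A} → Unique xs → ∀ {i j} → lookup xs i ≡ lookup xs j → i ≡ j
lookup-injective (_ ∷ _)     {zero}  {zero}  e = refl
lookup-injective (x≢ ∷ _)    {zero}  {suc j} e = ⊥-elim (All.lookup x≢ (∈-lookup j) e)
lookup-injective (x≢ ∷ _)    {suc i} {zero}  e = ⊥-elim (All.lookup x≢ (∈-lookup i) (sym e))
lookup-injective (_ ∷ uniq)  {suc i} {suc j} e = cong suc (lookup-injective uniq e)

module _ {n} {P : Pred (Fin n) 0ℓ} (P? : Decidable₁ P) where

  vertex : Fin (# P?) → Fin n
  vertex = lookup (vertices P?)

  vertex-sat : ∀ i → P (vertex i)
  vertex-sat i = proj₂ (∈-filter⁻ P? {xs = allFin n} (∈-lookup {xs = vertices P?} i))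

  vertex-injective : ∀ {i j} → vertex i ≡ vertex j → i ≡ j
  vertex-injective = lookup-injective (Unique.filter⁺ P? (Unique.allFin⁺ n))

  vertexIndex : ∀ {x} → P x → Fin (# P?)
  vertexIndex {x} px = index (∈-filter⁺ P? (∈-allFin x) px)

  vertex-index : ∀ {x} (px : P x) → vertex (vertexIndex px) ≡ x
  vertex-index {x} px = sym (Any.lookup-index (∈-filter⁺ P? (∈-allFin x) px))

module _ {m n} (X : Graph m) (Y : Graph n) {P : Pred (Fin m) 0ℓ} (P? : Decidable₁ P) {Q : Pred (Fin n) 0ℓ} (Q? : Decidable₁ Q)
  (ι : Fin m → Fin n) (injective : ∀ {u w} → ι u ≡ ι w → u ≡ w)
  (into : ∀ {u} → P u → Q (ι u)) (onto : ∀ {w} → Q w → ∃ λ u → ι u ≡ w × P u)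
  (preserves : ∀ {u w} → P u → P w → X ⊢ u ~ w → Y ⊢ ι u ~ ι w)
  (reflects : ∀ {u w} → P u → P w → Y ⊢ ι u ~ ι w → X ⊢ u ~ w) where

  -- Edges are compared only between vertices of `P`, because two carvings are known to agree only
  -- near the chosen vertex.
  induced-≅ : induced X P? ≅ induced Y Q?
  induced-≅ = record
    { bijection = mk↔ₛ′ to from to-from from-to
    ; adjacency = λ i j → mk⇔
        (subst₂ (λ a b → Y ⊢ a ~ b) (sym (vertex-to i)) (sym (vertex-to j)) ∘ preserves (vertex-sat P? i) (vertex-sat P? j))
        (reflects (vertex-sat P? i) (vertex-sat P? j) ∘ subst₂ (λ a b → Y ⊢ a ~ b) (vertex-to i) (vertex-to j))
    }
    where
    to : Fin (# P?) → Fin (# Q?)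
    to i = vertexIndex Q? (into (vertex-sat P? i))
    vertex-to : ∀ i → vertex Q? (to i) ≡ ι (vertex P? i)
    vertex-to i = vertex-index Q? (into (vertex-sat P? i))
    from : Fin (# Q?) → Fin (# P?)
    from j = vertexIndex P? (proj₂ (proj₂ (onto (vertex-sat Q? j))))
    vertex-from : ∀ j → ι (vertex P? (from j)) ≡ vertex Q? j
    vertex-from j = trans (cong ι (vertex-index P? (proj₂ (proj₂ (onto (vertex-sat Q? j))))))
      (proj₁ (proj₂ (onto (vertex-sat Q? j))))
    to-from : ∀ j → to (from j) ≡ j
    to-from j = vertex-injective Q? (trans (vertex-to (from j)) (vertex-from j))
    from-to : ∀ i → from (to i) ≡ i
    from-to i = vertex-injective P? (injective (trans (vertex-from (to i)) (vertex-to i)))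

pairCount-mono : ∀ {n} {P Q : Fin n → Fin n → Set} (P? : ∀ x y → Dec (P x y)) (Q? : ∀ x y → Dec (Q x y)) →
                 (∀ {x y} → P x y → Q x y) → pairCount P? ≤ pairCount Q?
pairCount-mono P? Q? f = sum-mono λ x → sum-mono λ y → ⟦⟧-mono (P? x y) (Q? x y) f

pairCount-≤-+ : ∀ {n} {P Q T : Fin n → Fin n → Set}
  (P? : ∀ x y → Dec (P x y)) (Q? : ∀ x y → Dec (Q x y)) (T? : ∀ x y → Dec (T x y)) →
  (∀ {x y} → P x y → Q x y ⊎ T x y) → pairCount P? ≤ pairCount Q? + pairCount T?
pairCount-≤-+ P? Q? T? f = ℕ.≤-trans
  (sum-mono λ x → ℕ.≤-trans
    (sum-mono λ y → pointwise x y)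
    (ℕ.≤-reflexive (ℕΣ.∑-distrib-+ (λ y → ⟦ Q? x y ⟧) (λ y → ⟦ T? x y ⟧))))
  (ℕ.≤-reflexive (ℕΣ.∑-distrib-+ (λ x → ℕΣ.sum λ y → ⟦ Q? x y ⟧) (λ x → ℕΣ.sum λ y → ⟦ T? x y ⟧)))
  where
  pointwise : ∀ x y → ⟦ P? x y ⟧ ≤ ⟦ Q? x y ⟧ + ⟦ T? x y ⟧
  pointwise x y with P? x y
  ... | no _ = z≤n
  ... | yes pxy with f pxy
  ... | inj₁ q = ℕ.m≤n⇒m≤n+o _ (ℕ.≤-reflexive (sym (⟦⟧-yes (Q? x y) q)))
  ... | inj₂ t = ℕ.m≤n⇒m≤o+n _ (ℕ.≤-reflexive (sym (⟦⟧-yes (T? x y) t)))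

pairCount-× : ∀ {n} {C : Set} (c? : Dec C) {P : Fin n → Fin n → Set} (P? : ∀ x y → Dec (P x y)) →
              pairCount (λ x y → c? ×-dec P? x y) ≡ ⟦ c? ⟧ * pairCount P?
pairCount-× {n} c? P? = begin
  ℕΣ.sum (λ x → ℕΣ.sum (λ y → ⟦ c? ×-dec P? x y ⟧))
    ≡⟨ ℕΣ.sum-cong-≗ (λ x → ℕΣ.sum-cong-≗ (λ y → ⟦⟧-× c? (P? x y))) ⟩
  ℕΣ.sum (λ x → ℕΣ.sum (λ y → ⟦ c? ⟧ * ⟦ P? x y ⟧))
    ≡⟨ ℕΣ.sum-cong-≗ (λ x → sym (ℕΣ.*-distribˡ-sum ⟦ c? ⟧ (λ y → ⟦ P? x y ⟧))) ⟩
  ℕΣ.sum (λ x → ⟦ c? ⟧ * ℕΣ.sum (λ y → ⟦ P? x y ⟧))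
    ≡⟨ sym (ℕΣ.*-distribˡ-sum ⟦ c? ⟧ (λ x → ℕΣ.sum (λ y → ⟦ P? x y ⟧))) ⟩
  ⟦ c? ⟧ * pairCount P?                                 ∎
  where open ≡-Reasoning

sum-pairCount : ∀ {n l} (g : Fin l → Fin n → Fin n → ℕ) →
  ℕΣ.sum (λ z → ℕΣ.sum (λ x → ℕΣ.sum (λ y → g z x y))) ≡ ℕΣ.sum (λ x → ℕΣ.sum (λ y → ℕΣ.sum (λ z → g z x y)))
sum-pairCount g = trans (ℕΣ.∑-comm (λ z x → ℕΣ.sum (g z x))) (ℕΣ.sum-cong-≗ λ x → ℕΣ.∑-comm (λ z y → g z x y))

telescope-from : ∀ k (a c : ℕ → ℕ) → (∀ t → k * a t ≤ suc k * c t + k * a (suc t)) →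
            ∀ l s → k * a s ≤ suc k * ℕΣ.sum {l} (λ t → c (s + toℕ t)) + k * a (s + l)
telescope-from k a c round zero s = ℕ.≤-reflexive
  (cong₂ _+_ (sym (ℕ.*-zeroʳ (suc k))) (cong (λ z → k * a z) (sym (ℕ.+-identityʳ s))))
telescope-from k a c round (suc l) s = begin
  k * a s
    ≤⟨ round s ⟩
  suc k * c s + k * a (suc s)
    ≤⟨ ℕ.+-monoʳ-≤ (suc k * c s) (telescope-from k a c round l (suc s)) ⟩
  suc k * c s + (suc k * ℕΣ.sum {l} (λ t → c (suc s + toℕ t)) + k * a (suc s + l))
    ≡⟨ sym (ℕ.+-assoc (suc k * c s) _ _) ⟩
  suc k * c s + suc k * ℕΣ.sum {l} (λ t → c (suc s + toℕ t)) + k * a (suc s + l)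
    ≡⟨ cong₂ _+_ (sym (ℕ.*-distribˡ-+ (suc k) (c s) _)) (cong (λ z → k * a z) (sym (ℕ.+-suc s l))) ⟩
  suc k * (c s + ℕΣ.sum {l} (λ t → c (suc s + toℕ t))) + k * a (s + suc l)
    ≡⟨ cong (λ z → suc k * z + k * a (s + suc l)) (cong₂ _+_ (cong c (sym (ℕ.+-identityʳ s)))
         (ℕΣ.sum-cong-≗ {l} λ t → cong c (sym (ℕ.+-suc s (toℕ t))))) ⟩
  suc k * ℕΣ.sum {suc l} (λ t → c (s + toℕ t)) + k * a (s + suc l) ∎
  where open ℕ.≤-Reasoning

telescope : ∀ k (a c : ℕ → ℕ) → (∀ t → k * a t ≤ suc k * c t + k * a (suc t)) →
            ∀ l → k * a 0 ≤ suc k * ℕΣ.sum {l} (λ t → c (toℕ t)) + k * a l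
telescope k a c round l = telescope-from k a c round l 0

edges : ∀ {n} → Graph n → ℕ
edges G = pairCount (Graph._~?_ G)

module RunProperties (k R : ℕ) {n} (G : Graph n) (label : Fin n → ℕ) where
  open Carving k R
  open Run G label
  open Graph G using (_~?_)

  within-target : ∀ {S r z x} → S z ≡ true → Dist≤ (within G S) r z x → S x ≡ true
  within-target Sz here                  = Sz
  within-target Sz (step (_ , Sy , _) d) = within-target Sy d

  carved-state : ∀ {t S x} → Carved t S x → S x ≡ true
  carved-state (z , (_ , Sz , _) , d) = within-target Sz d

  state-suc⁻ : ∀ t {x} → state (suc t) x ≡ true → state t x ≡ true × ¬ CarvedAt t x
  state-suc⁻ t {x} e with state t x | carved? t (state t) x
  ... | true | no ¬c = refl , ¬c

  state-suc⁺ : ∀ t {x} → state t x ≡ true → ¬ CarvedAt t x → state (suc t) x ≡ true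
  state-suc⁺ t {x} e ¬c with state t x | carved? t (state t) x
  ... | true | no _  = refl
  ... | true | yes c = ⊥-elim (¬c c)

  state-antitone : ∀ {s t} → s ℕ.≤′ t → ∀ {x} → state t x ≡ true → state s x ≡ true
  state-antitone ℕ.≤′-refl             e = e
  state-antitone (ℕ.≤′-step {n = t} p) e = state-antitone p (proj₁ (state-suc⁻ t e))

  time-unique : ∀ {s t x} → CarvedAt s x → CarvedAt t x → s ≡ t
  time-unique {s} {t} a b with ℕ.<-cmp s t
  ... | tri< s<t _ _ = ⊥-elim (proj₂ (state-suc⁻ s (state-antitone (ℕ.≤⇒≤′ s<t) (carved-state b))) a)
  ... | tri≈ _ e _   = e
  ... | tri> _ _ t<s = ⊥-elim (proj₂ (state-suc⁻ t (state-antitone (ℕ.≤⇒≤′ t<s) (carved-state a))) b)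

  InCluster : ℕ → Fin n → Fin n → Set
  InCluster t z x = Centre t (state t) z × Dist≤ (within G (state t)) (radius (state t) z) z x

  cluster-dist : ∀ {t z x} → InCluster t z x → Dist≤ G R z x
  cluster-dist {t} (_ , d) = Dist-mono (search-≤ _ R) (Dist-⊑ (within-⊑ G (state t)) d)

  centre-unique : ∀ {t S z z′} → Centre t S z → Centre t S z′ → Dist≤ G (suc (R + R)) z z′ → z ≡ z′
  centre-unique {z = z} {z′} (l , _ , ¬c) (l′ , _ , _) d with z′ Fin.≟ z
  ... | yes e = sym e
  ... | no z′≢z = ⊥-elim (¬c (z′ , z′≢z , d , trans l′ (sym l)))

  cluster-unique : ∀ {t z z′ x} → InCluster t z x → InCluster t z′ x → z ≡ z′
  cluster-unique a b = centre-unique (proj₁ a) (proj₁ b)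
    (Dist-mono (ℕ.n≤1+n (R + R)) (Dist-trans (cluster-dist a) (Dist-sym (cluster-dist b))))

  cluster-edge : ∀ {M t z x y} → InCluster t z x → output M ⊢ x ~ y → InCluster t z y
  cluster-edge {x = x} {y} a@(c , d) (e , s , (z₁ , a₁) , (z₂ , a₂)) with time-unique (_ , a) (z₁ , a₁)
  ... | refl = subst (λ z → InCluster (toℕ s) z y) (sym z≡z₂) a₂
    where
    z≡z₂ = centre-unique c (proj₁ a₂)
      (Dist-mono (ℕ.≤-reflexive (ℕ.+-suc R R)) (Dist-trans (cluster-dist a) (step e (Dist-sym (cluster-dist a₂)))))

  cluster-reachable : ∀ {M t z x y} → InCluster t z x → Reachable (output M) x y → InCluster t z y
  cluster-reachable a ε       = a
  cluster-reachable a (e ◅ w) = cluster-reachable (cluster-edge a e) w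

  -- However long the walk is, it never leaves the cluster that its first edge provides, so both
  -- ends are within `R` of one centre. The bound is on distances in `G`, where ball sizes are
  -- controlled.
  reachable-dist : ∀ {M x y} → Reachable (output M) x y → Dist≤ G (R + R) x y
  reachable-dist ε = here
  reachable-dist w@(( _ , t , (z , a) , _) ◅ _) =
    Dist-trans (Dist-sym (cluster-dist a)) (cluster-dist (cluster-reachable a w))

  -- Radius `2R + 1` is used although `2R` suffices here, so that one ball bound serves both
  -- component sizes and conflicts.
  output-componentSize : ∀ M x → componentSize (output M) x ≤ ballSize G (suc (R + R)) x
  output-componentSize M x = #-mono (reachable? (output M) x) (dist≤? G (suc (R + R)) x)
    λ y w → Dist-mono (ℕ.n≤1+n (R + R)) (reachable-dist w)

  -- A surviving vertex without conflict would have been a centre in the round of its own label, and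
  -- a centre carves itself.
  leftover-conflict : ∀ {M x} → label x < M → state M x ≡ true → Conflict x
  leftover-conflict {M} {x} l<M e with conflict? x
  ... | yes c = c
  ... | no ¬c = ⊥-elim (proj₂ alive (x , (refl , proj₁ alive , ¬c) , here))
    where
    alive = state-suc⁻ (label x) (state-antitone (ℕ.≤⇒≤′ l<M) e)

  -- Conflicts are weighted by degree, so that their expected weight is a fraction of the number of
  -- edges rather than of vertices.
  conflictDegree : ℕ
  conflictDegree = pairCount λ x y → conflict? x ×-dec (x ~? y)

  module Cost (slow : ∀ S z → ∃ λ r → r < R × SlowGrowth S z r) where

    slow-radius : ∀ S z → SlowGrowth S z (radius S z)
    slow-radius S z with slow S z
    ... | r , r<R , s = does⁻ (slowGrowth? S z (radius S z))
      (search-finds (does ∘ slowGrowth? S z) R r<R (dec-true (slowGrowth? S z r) s))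
      where
      does⁻ : ∀ {A : Set} (a? : Dec A) → does a? ≡ true → A
      does⁻ (yes a) _ = a

    carvedEdge? : ∀ t x y → Dec (CarvedAt t x × CarvedAt t y × G ⊢ x ~ y)
    carvedEdge? t x y = carved? t (state t) x ×-dec carved? t (state t) y ×-dec (x ~? y)

    carvedEdges : ℕ → ℕ
    carvedEdges t = pairCount (carvedEdge? t)

    centre? : ∀ t z → Dec (Centre t (state t) z)
    centre? t z = (label z ℕ.≟ t) ×-dec (state t z Bool.≟ true) ×-dec ¬? (conflict? z)

    remaining : ℕ → ℕ
    remaining t = edges (within G (state t))

    -- An edge lost in this round has a carved end, so it lies in the ball of radius `r + 1` around
    -- a centre; overlaps among these balls only enlarge the bound. Slow growth replaces them by the
    -- balls of radius `r`, and these are disjoint, so their edges are carved edges counted once.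
    round-cost : ∀ t → k * remaining t ≤ suc k * carvedEdges t + k * remaining (suc t)
    round-cost t = begin
      k * remaining t
        ≤⟨ ℕ.*-monoʳ-≤ k (pairCount-≤-+ (Graph._~?_ (within G S)) touched? (Graph._~?_ (within G (state (suc t)))) split) ⟩
      k * (pairCount touched? + remaining (suc t))
        ≡⟨ ℕ.*-distribˡ-+ k (pairCount touched?) _ ⟩
      k * pairCount touched? + k * remaining (suc t)
        ≤⟨ ℕ.+-monoˡ-≤ (k * remaining (suc t)) (begin
          k * pairCount touched?
            ≤⟨ ℕ.*-monoʳ-≤ k (sum-mono λ x → sum-mono λ y → touched-bound x y) ⟩
          k * ℕΣ.sum (λ x → ℕΣ.sum (λ y → ℕΣ.sum (λ z → ⟦ near? (suc (r z)) z x y ⟧)))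
            ≡⟨ cong (k *_) (sym (sum-pairCount (λ z x y → ⟦ near? (suc (r z)) z x y ⟧))) ⟩
          k * ℕΣ.sum (λ z → pairCount (near? (suc (r z)) z))
            ≡⟨ ℕΣ.*-distribˡ-sum k (λ z → pairCount (near? (suc (r z)) z)) ⟩
          ℕΣ.sum (λ z → k * pairCount (near? (suc (r z)) z))
            ≤⟨ sum-mono ball-bound ⟩
          ℕΣ.sum (λ z → suc k * pairCount (near? (r z) z))
            ≡⟨ sym (ℕΣ.*-distribˡ-sum (suc k) (λ z → pairCount (near? (r z) z))) ⟩
          suc k * ℕΣ.sum (λ z → pairCount (near? (r z) z))
            ≡⟨ cong (suc k *_) (sum-pairCount (λ z x y → ⟦ near? (r z) z x y ⟧)) ⟩
          suc k * ℕΣ.sum (λ x → ℕΣ.sum (λ y → ℕΣ.sum (λ z → ⟦ near? (r z) z x y ⟧)))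
            ≤⟨ ℕ.*-monoʳ-≤ (suc k) (sum-mono λ x → sum-mono λ y → sum-unique-≤ (λ z → near? (r z) z x y)
                 (λ (c , d , _) (c′ , d′ , _) → cluster-unique (c , d) (c′ , d′)) (carvedEdge? t x y)
                 λ z (c , dx , dy , _ , _ , e) → (z , c , dx) , (z , c , dy) , e) ⟩
          suc k * carvedEdges t ∎) ⟩
      suc k * carvedEdges t + k * remaining (suc t) ∎
      where
      open ℕ.≤-Reasoning
      S = state t
      r = radius S
      touched? : ∀ x y → Dec ((within G S ⊢ x ~ y) × (CarvedAt t x ⊎ CarvedAt t y))
      touched? x y = Graph._~?_ (within G S) x y ×-dec (carved? t S x ⊎-dec carved? t S y)
      near? : ∀ r z x y → Dec (Centre t S z × InBallEdge S r z x y)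
      near? r z x y = centre? t z ×-dec inBallEdge? S r z x y
      split : ∀ {x y} → within G S ⊢ x ~ y →
              ((within G S ⊢ x ~ y) × (CarvedAt t x ⊎ CarvedAt t y)) ⊎ within G (state (suc t)) ⊢ x ~ y
      split {x} {y} e@(Sx , Sy , a) = go (carved? t S x) (carved? t S y)
        where
        go : Dec (CarvedAt t x) → Dec (CarvedAt t y) → _
        go (yes c) _       = inj₁ (e , inj₁ c)
        go (no _)  (yes c) = inj₁ (e , inj₂ c)
        go (no cx) (no cy) = inj₂ (state-suc⁺ t Sx cx , state-suc⁺ t Sy cy , a)
      touched-bound : ∀ x y → ⟦ touched? x y ⟧ ≤ ℕΣ.sum (λ z → ⟦ near? (suc (r z)) z x y ⟧)
      touched-bound x y = go (touched? x y)
        where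
        at : ∀ z → Centre t S z × InBallEdge S (suc (r z)) z x y → 1 ≤ ℕΣ.sum (λ z → ⟦ near? (suc (r z)) z x y ⟧)
        at z q = ℕ.≤-trans (ℕ.≤-reflexive (sym (⟦⟧-yes (near? (suc (r z)) z x y) q)))
          (term≤sum (λ z → ⟦ near? (suc (r z)) z x y ⟧) z)
        go : (d : Dec ((within G S ⊢ x ~ y) × (CarvedAt t x ⊎ CarvedAt t y))) →
             ⟦ d ⟧ ≤ ℕΣ.sum (λ z → ⟦ near? (suc (r z)) z x y ⟧)
        go (no _) = z≤n
        go (yes (e , inj₁ (z , c , d))) = at z (c , Dist-mono (ℕ.n≤1+n (r z)) d , Dist-snoc d e , e)
        go (yes (e , inj₂ (z , c , d))) =
          at z (c , Dist-snoc d (Graph.symmetric (within G S) e) , Dist-mono (ℕ.n≤1+n (r z)) d , e)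
      ball-bound : ∀ z → k * pairCount (near? (suc (r z)) z) ≤ suc k * pairCount (near? (r z) z)
      ball-bound z = begin
        k * pairCount (near? (suc (r z)) z)
          ≡⟨ cong (k *_) (pairCount-× (centre? t z) (inBallEdge? S (suc (r z)) z)) ⟩
        k * (⟦ centre? t z ⟧ * ballEdges S (suc (r z)) z)     ≡⟨ swap k ⟦ centre? t z ⟧ _ ⟩
        ⟦ centre? t z ⟧ * (k * ballEdges S (suc (r z)) z)     ≤⟨ ℕ.*-monoʳ-≤ ⟦ centre? t z ⟧ (slow-radius S z) ⟩
        ⟦ centre? t z ⟧ * (suc k * ballEdges S (r z) z)       ≡⟨ sym (swap (suc k) ⟦ centre? t z ⟧ _) ⟩
        suc k * (⟦ centre? t z ⟧ * ballEdges S (r z) z)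
          ≡⟨ cong (suc k *_) (sym (pairCount-× (centre? t z) (inBallEdge? S (r z) z))) ⟩
        suc k * pairCount (near? (r z) z)                     ∎
        where
        swap : ∀ a b c → a * (b * c) ≡ b * (a * c)
        swap a b c = trans (sym (ℕ.*-assoc a b c)) (trans (cong (_* c) (ℕ.*-comm a b)) (ℕ.*-assoc b a c))

    total-cost : ∀ M → k * remaining 0 ≤ suc k * ℕΣ.sum {M} (λ t → carvedEdges (toℕ t)) + k * remaining M
    total-cost M = telescope k remaining carvedEdges round-cost M

    carved≤output : ∀ M → ℕΣ.sum {M} (λ t → carvedEdges (toℕ t)) ≤ edges (output M)
    carved≤output M = ℕ.≤-trans
      (ℕ.≤-reflexive (sum-pairCount (λ (t : Fin M) x y → ⟦ carvedEdge? (toℕ t) x y ⟧)))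
      (sum-mono λ x → sum-mono λ y → sum-unique-≤ (λ t → carvedEdge? (toℕ t) x y)
        (λ (a , _) (b , _) → Fin.toℕ-injective (time-unique a b)) (Graph._~?_ (output M) x y)
        λ t (a , b , e) → e , t , a , b)

    removed? : ∀ M x y → Dec ((G ⊢ x ~ y) × ¬ (output M ⊢ x ~ y))
    removed? M x y = (x ~? y) ×-dec ¬? (Graph._~?_ (output M) x y)

    -- In the telescoped inequality `edges G` is split into removed and kept edges. After cancelling
    -- `k` times the kept edges a single copy of them remains on the right, and it is at most
    -- `edges G`.
    output-cost : ∀ M → (∀ x → label x < M) → k * pairCount (removed? M) ≤ edges G + k * conflictDegree
    output-cost M l<M = ℕ.+-cancelʳ-≤ (k * edges A) _ _ (begin
      k * pairCount (removed? M) + k * edges A   ≡⟨ sym (ℕ.*-distribˡ-+ k (pairCount (removed? M)) (edges A)) ⟩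
      k * (pairCount (removed? M) + edges A)     ≡⟨ cong (k *_) total ⟩
      k * edges G
        ≤⟨ ℕ.*-monoʳ-≤ k (pairCount-mono _~?_ (Graph._~?_ (within G (state 0))) (λ e → refl , refl , e)) ⟩
      k * remaining 0                            ≤⟨ total-cost M ⟩
      suc k * ℕΣ.sum {M} (λ t → carvedEdges (toℕ t)) + k * remaining M
        ≤⟨ ℕ.+-mono-≤ (ℕ.*-monoʳ-≤ (suc k) (carved≤output M)) (ℕ.*-monoʳ-≤ k (pairCount-mono
             (Graph._~?_ (within G (state M))) (λ x y → conflict? x ×-dec (x ~? y))
             λ {x} (Sx , _ , e) → leftover-conflict (l<M x) Sx , e)) ⟩
      (edges A + k * edges A) + k * conflictDegree
        ≤⟨ ℕ.+-monoˡ-≤ (k * conflictDegree) (ℕ.+-monoˡ-≤ (k * edges A) (pairCount-mono (Graph._~?_ A) _~?_ proj₁)) ⟩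
      (edges G + k * edges A) + k * conflictDegree
        ≡⟨ trans (ℕ.+-assoc (edges G) _ _) (trans (cong (edges G +_) (ℕ.+-comm (k * edges A) _)) (sym (ℕ.+-assoc (edges G) _ _))) ⟩
      (edges G + k * conflictDegree) + k * edges A ∎)
      where
      open ℕ.≤-Reasoning
      A = output M
      pointwise : ∀ x y → ⟦ removed? M x y ⟧ + ⟦ Graph._~?_ A x y ⟧ ≡ ⟦ x ~? y ⟧
      pointwise x y = go (x ~? y) (Graph._~?_ A x y)
        where
        go : (a? : Dec (G ⊢ x ~ y)) (b? : Dec (A ⊢ x ~ y)) → ⟦ a? ×-dec ¬? b? ⟧ + ⟦ b? ⟧ ≡ ⟦ a? ⟧
        go (yes a) (yes b) = refl
        go (yes a) (no ¬b) = refl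
        go (no ¬a) (yes b) = ⊥-elim (¬a (proj₁ b))
        go (no ¬a) (no ¬b) = refl
      total : pairCount (removed? M) + edges A ≡ edges G
      total = trans (sym (ℕΣ.∑-distrib-+ (λ x → ℕΣ.sum λ y → ⟦ removed? M x y ⟧) (λ x → ℕΣ.sum λ y → ⟦ Graph._~?_ A x y ⟧)))
        (ℕΣ.sum-cong-≗ λ x → trans (sym (ℕΣ.∑-distrib-+ (λ y → ⟦ removed? M x y ⟧) (λ y → ⟦ Graph._~?_ A x y ⟧)))
          (ℕΣ.sum-cong-≗ (pointwise x)))

-- Locality of components

module ComponentLocality (k R : ℕ) {m n} (H : Graph m) (G : Graph n) (labelᴴ : Fin m → ℕ) (labelᴳ : Fin n → ℕ)
  (ι : Fin m → Fin n) (injective : ∀ {u w} → ι u ≡ ι w → u ≡ w)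
  (preserves : ∀ {u w} → H ⊢ u ~ w → G ⊢ ι u ~ ι w)
  (reflects : ∀ {u w} → G ⊢ ι u ~ ι w → H ⊢ u ~ w) where

  open Carving k R
  open Locality H G labelᴴ labelᴳ ι injective preserves reflects

  component-local : ∀ M {u} → Sees (depth M) u → component (𝓗.output M) u ≅ component (𝓖.output M) (ι u)
  component-local M {u} sees = induced-≅ (𝓗.output M) (𝓖.output M)
    (reachable? (𝓗.output M) u) (reachable? (𝓖.output M) (ι u)) ι injective
    (reach-fwd ε) (reach-bwd ε)
    (λ a b → output-fwd (near a) (near b)) (λ a b → output-bwd (near a) (near b))
    where
    near′ : ∀ {v} → Reachable (𝓗.output M) u v → Sees (suc (range M)) v
    near′ w = Sees-move (R + R) (RunProperties.reachable-dist k R H labelᴴ w) sees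
    near : ∀ {v} → Reachable (𝓗.output M) u v → Sees (range M) v
    near w = Sees-mono (ℕ.n≤1+n (range M)) (near′ w)
    reach-fwd : ∀ {v w} → Reachable (𝓗.output M) u v → Reachable (𝓗.output M) v w → Reachable (𝓖.output M) (ι v) (ι w)
    reach-fwd a ε       = ε
    reach-fwd a (e ◅ b) = output-fwd (near a) (near a′) e ◅ reach-fwd a′ b
      where a′ = a ◅◅ (e ◅ ε)
    reach-bwd : ∀ {v w′} → Reachable (𝓗.output M) u v → Reachable (𝓖.output M) (ι v) w′ →
                ∃ λ w → ι w ≡ w′ × Reachable (𝓗.output M) u w
    reach-bwd {v} a ε = v , refl , a
    reach-bwd {v} a (e ◅ b) with near′ a (step (proj₁ e) here)
    ... | y , refl , _ = reach-bwd (a ◅◅ (output-bwd (near a) (Sees-move 1 (step (reflects (proj₁ e)) here) (near′ a)) e ◅ ε)) b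

-- Ball statistics

≅-sym : ∀ {m n} {G : Graph m} {H : Graph n} → G ≅ H → H ≅ G
≅-sym {H = H} i = record
  { bijection = mk↔ₛ′ from to (Inverse.strictlyInverseʳ bijection) (Inverse.strictlyInverseˡ bijection)
  ; adjacency = λ x y → mk⇔
      (Equivalence.from (adjacency (from x) (from y)) ∘ subst₂ (λ a b → H ⊢ a ~ b) (sym (to-from x)) (sym (to-from y)))
      (subst₂ (λ a b → H ⊢ a ~ b) (to-from x) (to-from y) ∘ Equivalence.to (adjacency (from x) (from y)))
  }
  where
  open _≅_ i
  to-from = Inverse.strictlyInverseˡ bijection

≅-trans : ∀ {l m n} {F : Graph l} {G : Graph m} {H : Graph n} → F ≅ G → G ≅ H → F ≅ H
≅-trans i j = record
  { bijection = mk↔ₛ′ (J.to ∘ I.to) (I.from ∘ J.from)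
      (λ y → trans (cong J.to (Inverse.strictlyInverseˡ I.bijection (J.from y))) (Inverse.strictlyInverseˡ J.bijection y))
      (λ x → trans (cong I.from (Inverse.strictlyInverseʳ J.bijection (I.to x))) (Inverse.strictlyInverseʳ I.bijection x))
  ; adjacency = λ x y → mk⇔
      (Equivalence.to (J.adjacency _ _) ∘ Equivalence.to (I.adjacency x y))
      (Equivalence.from (I.adjacency x y) ∘ Equivalence.from (J.adjacency _ _))
  }
  where
  module I = _≅_ i
  module J = _≅_ j

≅∙-sym : ∀ {A B} → A ≅∙ B → B ≅∙ A
≅∙-sym {A} (i , e) = ≅-sym i , trans (cong (_≅_.from i) (sym e)) (Inverse.strictlyInverseʳ (_≅_.bijection i) (RootedGraph.root A))

≅∙-trans : ∀ {A B C} → A ≅∙ B → B ≅∙ C → A ≅∙ C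
≅∙-trans (i , e) (j , e′) = ≅-trans i j , trans (cong (_≅_.to j) e) e′

module BallEmbedding {n} (G : Graph n) (L : ℕ) (x : Fin n) (α : RootedGraph) (i : rootedBall G L x ≅∙ α) where
  open RootedGraph α
  open _≅_ (proj₁ i)

  private
    in? = dist≤? G L x
    to-from = Inverse.strictlyInverseˡ bijection
    from-to = Inverse.strictlyInverseʳ bijection

  ι : Fin order → Fin n
  ι u = vertex in? (from u)

  injective : ∀ {u w} → ι u ≡ ι w → u ≡ w
  injective {u} {w} e = trans (sym (to-from u)) (trans (cong to (vertex-injective in? e)) (to-from w))

  reflects : ∀ {u w} → G ⊢ ι u ~ ι w → graph ⊢ u ~ w
  reflects {u} {w} e = subst₂ (λ a b → graph ⊢ a ~ b) (to-from u) (to-from w) (Equivalence.to (adjacency (from u) (from w)) e)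

  preserves : ∀ {u w} → graph ⊢ u ~ w → G ⊢ ι u ~ ι w
  preserves {u} {w} e = Equivalence.from (adjacency (from u) (from w))
    (subst₂ (λ a b → graph ⊢ a ~ b) (sym (to-from u)) (sym (to-from w)) e)

  ι-root : ι root ≡ x
  ι-root = trans (cong (vertex in?) (trans (cong from (sym (proj₂ i))) (from-to (centre G L x)))) (vertex-index in? Dist≤.here)

  covers : ∀ {w} → Dist≤ G L x w → ∃ λ u → ι u ≡ w
  covers d = to (vertexIndex in? d) , trans (cong (vertex in?) (from-to _)) (vertex-index in? d)

  -- A walk with `r` steps to go that starts within `s` of the centre stays in the ball when
  -- `s + r ≤ L`, so it survives in the induced subgraph.
  lift : ∀ s r {v w′} → s + r ≤ L → Dist≤ G s x (ι v) → Dist≤ G r (ι v) w′ → ∃ λ w → ι w ≡ w′ × Dist≤ graph r v w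
  lift s r {v} le a Dist≤.here = v , refl , Dist≤.here
  lift s (suc r) {v} le a (step e d) with covers (Dist-mono s<L (Dist-snoc a e))
    where
    s<L : suc s ≤ L
    s<L = ℕ.≤-trans (ℕ.m≤m+n (suc s) r) (ℕ.≤-trans (ℕ.≤-reflexive (sym (ℕ.+-suc s r))) le)
  ... | y , refl with lift (suc s) r {y} (ℕ.≤-trans (ℕ.≤-reflexive (sym (ℕ.+-suc s r))) le) (Dist-snoc a e) d
  ... | w , eq , d′ = w , eq , step (reflects e) d′

  root-dist : ∀ u → Dist≤ graph L root u
  root-dist u with lift 0 L {root} ℕ.≤-refl (subst (Dist≤ G 0 x) (sym ι-root) Dist≤.here)
                     (subst (λ z → Dist≤ G L z (ι u)) (sym ι-root) (vertex-sat in? (from u)))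
  ... | w , eq , d = subst (Dist≤ graph L root) (injective eq) d

  isRootedBall : ∀ {d} → MaxDegree≤ d G → IsRootedBall L d α
  isRootedBall deg = record
    { connected = λ u w → Dist⇒Reachable (Dist-trans (Dist-sym (root-dist u)) (root-dist w))
    ; maxDegree = λ u → ℕ.≤-trans (degree-≤ u) (deg (ι u))
    ; radius    = root-dist
    }
    where
    degree-≤ : ∀ u → degree graph u ≤ degree G (ι u)
    degree-≤ u = begin
      degree graph u                                              ≡⟨ #≡sum (Graph._~?_ graph u) ⟩
      ℕΣ.sum (λ w → ⟦ Graph._~?_ graph u w ⟧)
        ≤⟨ sum-mono (λ w → ⟦⟧-mono (Graph._~?_ graph u w) (Graph._~?_ G (ι u) (ι w)) preserves) ⟩
      ℕΣ.sum (λ w → ⟦ Graph._~?_ G (ι u) (ι w) ⟧)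
        ≤⟨ sum-embed-≤ ι injective (λ w → ⟦ Graph._~?_ G (ι u) w ⟧) ⟩
      ℕΣ.sum (λ w → ⟦ Graph._~?_ G (ι u) w ⟧)                     ≡⟨ sym (#≡sum (Graph._~?_ G (ι u))) ⟩
      degree G (ι u)                                              ∎
      where open ℕ.≤-Reasoning

isRootedBall? : ∀ r d α → Dec (IsRootedBall r d α)
isRootedBall? r d α = map′
  (λ (c , m , b) → record { connected = c ; maxDegree = m ; radius = b })
  (λ β → IsRootedBall.connected β , IsRootedBall.maxDegree β , IsRootedBall.radius β)
  (Fin.all? (λ x → Fin.all? (reachable? graph x))
    ×-dec Fin.all? (λ x → degree graph x ℕ.≤? d)
    ×-dec Fin.all? (dist≤? graph r root))
  where open RootedGraph α

-- Finite lists meeting every isomorphism class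

Matrix : ℕ → Set
Matrix m = Vec (Vec Bool m) m

-- Symmetry and irreflexivity are imposed on reading, so that every Boolean matrix is a graph and no
-- list has to be filtered.
fromMatrix : ∀ {m} → Matrix m → Graph m
fromMatrix b = record
  { _~_         = λ x y → x ≢ y × entry x y ≡ true × entry y x ≡ true
  ; _~?_        = λ x y → ¬? (x Fin.≟ y) ×-dec (entry x y Bool.≟ true) ×-dec (entry y x Bool.≟ true)
  ; symmetric   = λ (x≢y , a , c) → x≢y ∘ sym , c , a
  ; irreflexive = λ x≡y (x≢y , _) → x≢y x≡y
  }
  where
  entry : _ → _ → Bool
  entry x y = Vec.lookup (Vec.lookup b x) y

toMatrix : ∀ {m} → Graph m → Matrix m
toMatrix G = Vec.tabulate λ x → Vec.tabulate λ y → does (Graph._~?_ G x y)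

≅-toMatrix : ∀ {m} (G : Graph m) → G ≅ fromMatrix (toMatrix G)
≅-toMatrix G = record
  { bijection = mk↔ₛ′ id id (λ _ → refl) (λ _ → refl)
  ; adjacency = λ x y → mk⇔
      (λ e → (λ x≡y → irreflexive x≡y e)
           , trans (entry x y) (dec-true (x ~? y) e) , trans (entry y x) (dec-true (y ~? x) (symmetric e)))
      (λ (_ , e , _) → does⁻ (x ~? y) (trans (sym (entry x y)) e))
  }
  where
  open Graph G
  entry : ∀ x y → Vec.lookup (Vec.lookup (toMatrix G) x) y ≡ does (x ~? y)
  entry x y = trans (cong (λ row → Vec.lookup row y) (Vec.lookup∘tabulate _ x)) (Vec.lookup∘tabulate _ y)
  does⁻ : ∀ {A : Set} (a? : Dec A) → does a? ≡ true → A
  does⁻ (yes a) _ = a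

vecs : ∀ {A : Set} → List A → ∀ m → List (Vec A m)
vecs as zero    = [] ∷ []
vecs as (suc m) = cartesianProductWith _∷_ as (vecs as m)

vecs-complete : ∀ {A : Set} {as : List A} → (∀ a → a ∈ as) → ∀ {m} (v : Vec A m) → v ∈ vecs as m
vecs-complete all []      = here refl
vecs-complete all (a ∷ v) = ∈-cartesianProductWith⁺ _∷_ (all a) (vecs-complete all v)

matrices : ∀ m → List (Matrix m)
matrices m = vecs (vecs (true ∷ false ∷ []) m) m

matrices-complete : ∀ {m} (b : Matrix m) → b ∈ matrices m
matrices-complete = vecs-complete (vecs-complete λ { true → here refl ; false → there (here refl) })

-- A `Graph` carries an arbitrary decidable relation and cannot be listed; matrices can, with
-- isomorphic repetitions.
Code : Set
Code = Σ ℕ Matrix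

codes : ℕ → List Code
codes K = concatMap (λ m → List.map (m ,_) (matrices m)) (upTo (suc K))

codes-complete : ∀ {K m} (b : Matrix m) → m ≤ K → (m , b) ∈ codes K
codes-complete {K} {m} b m≤K = ∈-concatMap⁺ (λ m → List.map (m ,_) (matrices m))
  (Any.map (λ { refl → ∈-map⁺ (m ,_) (matrices-complete b) }) (∈-upTo⁺ (s≤s m≤K)))

RootedCode : Set
RootedCode = Σ ℕ λ m → Matrix m × Fin m

decode : RootedCode → RootedGraph
decode (m , b , r) = record { graph = fromMatrix b ; root = r }

rootedCodes : ℕ → List RootedCode
rootedCodes K = concatMap (λ m → cartesianProductWith (λ b r → m , b , r) (matrices m) (allFin m)) (upTo (suc K))

rootedCodes-complete : ∀ {K} A → RootedGraph.order A ≤ K → Any (λ c → A ≅∙ decode c) (rootedCodes K)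
rootedCodes-complete {K} A m≤K = Any.map (λ { refl → ≅-toMatrix graph , refl })
  (∈-concatMap⁺ (λ m → cartesianProductWith (λ b r → m , b , r) (matrices m) (allFin m))
    (Any.map (λ { refl → ∈-cartesianProductWith⁺ (λ b r → order , b , r) (matrices-complete (toMatrix graph)) (∈-allFin root) })
      (∈-upTo⁺ (s≤s m≤K))))
  where open RootedGraph A

-- Opaque copies of the isomorphism tests keep their search procedures folded.
opaque
  rooted≅? : ∀ A B → Dec (A ≅∙ B)
  rooted≅? = _≅∙?_

  graph≅? : ∀ {m n} (G : Graph m) (H : Graph n) → Dec (G ≅ H)
  graph≅? = _≅?_

later? : ∀ c cs → Dec (Any (λ c′ → decode c ≅∙ decode c′) cs)
later? c = Any.any? (λ c′ → rooted≅? (decode c) (decode c′))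

unless when : ∀ {A : Set} → Dec A → ℚ → ℚ
unless (yes _) q = 0ℚ
unless (no _)  q = q
when (yes _) q = q
when (no _)  q = 0ℚ

when-no : ∀ {A : Set} (a? : Dec A) {q} → ¬ A → when a? q ≡ 0ℚ
when-no (yes a) ¬a = ⊥-elim (¬a a)
when-no (no _)  ¬a = refl

when≡* : ∀ {A : Set} (a? : Dec A) q → when a? q ≡ q ℚ.* ↑ ⟦ a? ⟧
when≡* (yes _) q = sym (trans (cong (q ℚ.*_) ↑-one) (ℚ.*-identityʳ q))
when≡* (no _)  q = sym (trans (cong (q ℚ.*_) ↑-zero) (ℚ.*-zeroʳ q))

unless-zero : ∀ {A : Set} (a? : Dec A) → unless a? 0ℚ ≡ 0ℚ
unless-zero (yes _) = refl
unless-zero (no _)  = refl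

unless-* : ∀ {A : Set} (a? : Dec A) a q → a ℚ.* unless a? q ≡ unless a? (a ℚ.* q)
unless-* (yes _) a q = ℚ.*-zeroʳ a
unless-* (no _)  a q = refl

unless-sum : ∀ {A : Set} (a? : Dec A) {n} (f : Fin n → ℚ) → ℚΣ.sum (λ x → unless a? (f x)) ≡ unless a? (ℚΣ.sum f)
unless-sum (yes _) {n} f = ℚΣ.sum-replicate-zero n
unless-sum (no _)  f = refl

-- Sums over isomorphism classes: only the last representative of each class counts.
classSum : List RootedCode → (RootedCode → ℚ) → ℚ
classSum []       h = 0ℚ
classSum (c ∷ cs) h = unless (later? c cs) (h c) ℚ.+ classSum cs h

classSum-cong : ∀ cs {g h} → (∀ c → g c ≡ h c) → classSum cs g ≡ classSum cs h
classSum-cong []       e = refl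
classSum-cong (c ∷ cs) e = cong₂ ℚ._+_ (cong (unless (later? c cs)) (e c)) (classSum-cong cs e)

classSum-zero : ∀ cs {h} → (∀ c → c ∈ cs → h c ≡ 0ℚ) → classSum cs h ≡ 0ℚ
classSum-zero []       z = refl
classSum-zero (c ∷ cs) z = trans
  (cong₂ ℚ._+_ (trans (cong (unless (later? c cs)) (z c (here refl))) (unless-zero (later? c cs)))
    (classSum-zero cs λ c′ → z c′ ∘ there))
  (ℚ.+-identityˡ 0ℚ)

-- If the class of `A` recurs later, the present representative is dropped; otherwise it counts and
-- every later term vanishes. The value of `q` is prescribed on all representatives because the list
-- decides which one counts.
classSum-single : ∀ cs A (q : RootedCode → ℚ) v → (∀ c → A ≅∙ decode c → q c ≡ v) → Any (λ c → A ≅∙ decode c) cs →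
  classSum cs (λ c → when (rooted≅? A (decode c)) (q c)) ≡ v
classSum-single (c ∷ cs) A q v qv found = go (rooted≅? A (decode c)) (later? c cs)
  where
  rest : ℚ
  rest = classSum cs (λ c → when (rooted≅? A (decode c)) (q c))
  go : (a? : Dec (A ≅∙ decode c)) (l? : Dec (Any (λ c′ → decode c ≅∙ decode c′) cs)) →
       unless l? (when a? (q c)) ℚ.+ rest ≡ v
  go (yes i) (yes l) = trans (ℚ.+-identityˡ rest)
    (classSum-single cs A q v qv (Any.map (λ {c′} → ≅∙-trans {A} {decode c} {decode c′} i) l))
  go (yes i) (no ¬l) = trans (cong₂ ℚ._+_ (qv c i) (classSum-zero cs λ c′ c′∈cs → when-no (rooted≅? A (decode c′)) λ j →
    ¬l (Any.map (λ { refl → ≅∙-trans {decode c} {A} {decode c′} (≅∙-sym {A} {decode c} i) j }) c′∈cs))) (ℚ.+-identityʳ v)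
  go (no ¬i) l? = trans (cong (ℚ._+ rest) (unless-zero l?)) (trans (ℚ.+-identityˡ rest)
    (classSum-single cs A q v qv (Any.tail ¬i found)))

classSum-sum : ∀ cs {n} (h : Fin n → RootedCode → ℚ) → ℚΣ.sum (λ x → classSum cs (h x)) ≡
               classSum cs (λ c → ℚΣ.sum (λ x → h x c))
classSum-sum []       {n} h = ℚΣ.sum-replicate-zero n
classSum-sum (c ∷ cs) {n} h = trans
  (ℚΣ.∑-distrib-+ (λ x → unless (later? c cs) (h x c)) (λ x → classSum cs (h x)))
  (cong₂ ℚ._+_ (unless-sum (later? c cs) (λ x → h x c)) (classSum-sum cs h))

classSum-* : ∀ cs {h} a → a ℚ.* classSum cs h ≡ classSum cs (λ c → a ℚ.* h c)
classSum-* []       a = ℚ.*-zeroʳ a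
classSum-* (c ∷ cs) {h} a = trans (ℚ.*-distribˡ-+ a (unless (later? c cs) (h c)) (classSum cs h))
  (cong₂ ℚ._+_ (unless-* (later? c cs) a (h c)) (classSum-* cs a))

-- Concentration

module _ (j : ℕ) where
  open Expectation j

  module Variance {n} (X : Fin n → Vec Label n → ℚ) (0≤X : ∀ x ω → 0ℚ ℚ.≤ X x ω) (X≤1 : ∀ x ω → X x ω ℚ.≤ 1ℚ)
    {S : Fin n → Fin n → Set} (dependsOn : ∀ x → DependsOn (S x) (X x))
    {Near : Fin n → Fin n → Set} (near? : ∀ x y → Dec (Near x y))
    (far : ∀ {x y} → ¬ Near x y → ∀ i → ¬ S x i ⊎ ¬ S y i) where

    deviation : Vec Label n → ℚ
    deviation ω = ℚΣ.sum (λ x → X x ω) ℚ.- ℚΣ.sum (λ x → 𝔼 (X x))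

    private
      μ : Fin n → ℚ
      μ x = 𝔼 (X x)

      Y : Fin n → Vec Label n → ℚ
      Y x ω = X x ω ℚ.- μ x

      0≤μ : ∀ x → 0ℚ ℚ.≤ μ x
      0≤μ x = subst (ℚ._≤ μ x) (𝔼-const n 0ℚ) (𝔼-mono (0≤X x))

      μ≤1 : ∀ x → μ x ℚ.≤ 1ℚ
      μ≤1 x = subst (μ x ℚ.≤_) (𝔼-const n 1ℚ) (𝔼-mono (X≤1 x))

      deviation-sum : ∀ ω → deviation ω ≡ ℚΣ.sum (λ x → Y x ω)
      deviation-sum ω = sym (trans (ℚΣ.∑-distrib-+ (λ x → X x ω) (λ x → ℚ.- μ x))
        (cong (ℚΣ.sum (λ x → X x ω) ℚ.+_) (neg-sum μ)))
        where
        neg-sum : ∀ {m} (f : Fin m → ℚ) → ℚΣ.sum (λ i → ℚ.- f i) ≡ ℚ.- ℚΣ.sum f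
        neg-sum {zero}  f = refl
        neg-sum {suc m} f = trans (cong (ℚ.- f zero ℚ.+_) (neg-sum (f ∘ suc))) (sym (ℚ.neg-distrib-+ (f zero) (ℚΣ.sum (f ∘ suc))))

      square-sum : ∀ ω → deviation ω ℚ.* deviation ω ≡ ℚΣ.sum (λ x → ℚΣ.sum (λ y → Y x ω ℚ.* Y y ω))
      square-sum ω = begin
        deviation ω ℚ.* deviation ω
          ≡⟨ cong₂ ℚ._*_ (deviation-sum ω) (deviation-sum ω) ⟩
        ℚΣ.sum (λ x → Y x ω) ℚ.* ℚΣ.sum (λ y → Y y ω)
          ≡⟨ ℚΣ.*-distribʳ-sum (ℚΣ.sum (λ y → Y y ω)) (λ x → Y x ω) ⟩
        ℚΣ.sum (λ x → Y x ω ℚ.* ℚΣ.sum (λ y → Y y ω))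
          ≡⟨ ℚΣ.sum-cong-≗ (λ x → ℚΣ.*-distribˡ-sum (Y x ω) (λ y → Y y ω)) ⟩
        ℚΣ.sum (λ x → ℚΣ.sum (λ y → Y x ω ℚ.* Y y ω))           ∎
        where open ≡-Reasoning

      bounds : ∀ {a b} → 0ℚ ℚ.≤ a → a ℚ.≤ 1ℚ → 0ℚ ℚ.≤ b → b ℚ.≤ 1ℚ → ℚ.∣ a ℚ.- b ∣ ℚ.≤ 1ℚ
      bounds {a} {b} 0≤a a≤1 0≤b b≤1 with ℚ.∣p∣≡p∨∣p∣≡-p (a ℚ.- b)
      ... | inj₁ e = subst (ℚ._≤ 1ℚ) (sym e) (subst (a ℚ.- b ℚ.≤_) (ℚ.+-identityʳ 1ℚ) (ℚ.+-mono-≤ a≤1 (ℚ.neg-antimono-≤ 0≤b)))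
      ... | inj₂ e = subst (ℚ._≤ 1ℚ) (trans (solve 2 (λ a b → b :- a := :- (a :- b)) refl a b) (sym e))
        (subst (b ℚ.- a ℚ.≤_) (ℚ.+-identityʳ 1ℚ) (ℚ.+-mono-≤ b≤1 (ℚ.neg-antimono-≤ 0≤a)))
        where open +-*-Solver

      product-≤1 : ∀ x y ω → Y x ω ℚ.* Y y ω ℚ.≤ 1ℚ
      product-≤1 x y ω = begin
        Y x ω ℚ.* Y y ω                  ≤⟨ p≤∣p∣ (Y x ω ℚ.* Y y ω) ⟩
        ℚ.∣ Y x ω ℚ.* Y y ω ∣            ≡⟨ ℚ.∣p*q∣≡∣p∣*∣q∣ (Y x ω) (Y y ω) ⟩
        ℚ.∣ Y x ω ∣ ℚ.* ℚ.∣ Y y ω ∣      ≤⟨ ℚ-*-mono-≤ (ℚ.0≤∣p∣ (Y x ω)) (ℚ.nonNegative⁻¹ 1ℚ)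
                                              (bounds (0≤X x ω) (X≤1 x ω) (0≤μ x) (μ≤1 x)) (bounds (0≤X y ω) (X≤1 y ω) (0≤μ y) (μ≤1 y)) ⟩
        1ℚ ℚ.* 1ℚ                        ≡⟨ ℚ.*-identityˡ 1ℚ ⟩
        1ℚ                               ∎
        where
        open ℚ.≤-Reasoning

      Y-mean : ∀ x → 𝔼 (Y x) ≡ 0ℚ
      Y-mean x = trans (𝔼-+ (X x) (λ _ → ℚ.- μ x)) (trans (cong (μ x ℚ.+_) (𝔼-const n (ℚ.- μ x))) (ℚ.+-inverseʳ (μ x)))

      covariance : ∀ x y → 𝔼 (λ ω → Y x ω ℚ.* Y y ω) ℚ.≤ ↑ ⟦ near? x y ⟧
      covariance x y = go (near? x y)
        where
        depends : ∀ x → DependsOn (S x) (Y x)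
        depends x ω ω′ e = cong (ℚ._- μ x) (dependsOn x ω ω′ e)
        go : (d : Dec (Near x y)) → 𝔼 (λ ω → Y x ω ℚ.* Y y ω) ℚ.≤ ↑ ⟦ d ⟧
        go (yes _) = subst (𝔼 (λ ω → Y x ω ℚ.* Y y ω) ℚ.≤_) (trans (𝔼-const n 1ℚ) (sym ↑-one)) (𝔼-mono (product-≤1 x y))
        go (no ¬near) = ℚ.≤-reflexive (begin
          𝔼 (λ ω → Y x ω ℚ.* Y y ω)  ≡⟨ 𝔼-independent (Y x) (Y y) (depends x) (depends y) (far ¬near) ⟩
          𝔼 (Y x) ℚ.* 𝔼 (Y y)        ≡⟨ cong (ℚ._* 𝔼 (Y y)) (Y-mean x) ⟩
          0ℚ ℚ.* 𝔼 (Y y)             ≡⟨ ℚ.*-zeroˡ (𝔼 (Y y)) ⟩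
          0ℚ                         ≡⟨ sym ↑-zero ⟩
          ↑ 0                        ∎)
          where open ≡-Reasoning

    -- The square expands into covariances. Far pairs are independent and contribute 0, while a near
    -- pair contributes at most 1 since centred variables are bounded by 1.
    variance-≤ : 𝔼 (λ ω → deviation ω ℚ.* deviation ω) ℚ.≤ ↑ pairCount near?
    variance-≤ = begin
      𝔼 (λ ω → deviation ω ℚ.* deviation ω)                     ≡⟨ 𝔼-cong square-sum ⟩
      𝔼 (λ ω → ℚΣ.sum (λ x → ℚΣ.sum (λ y → Y x ω ℚ.* Y y ω)))
        ≡⟨ 𝔼-sum n (λ x ω → ℚΣ.sum (λ y → Y x ω ℚ.* Y y ω)) ⟩
      ℚΣ.sum (λ x → 𝔼 (λ ω → ℚΣ.sum (λ y → Y x ω ℚ.* Y y ω)))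
        ≡⟨ ℚΣ.sum-cong-≗ (λ x → 𝔼-sum n (λ y ω → Y x ω ℚ.* Y y ω)) ⟩
      ℚΣ.sum (λ x → ℚΣ.sum (λ y → 𝔼 (λ ω → Y x ω ℚ.* Y y ω)))   ≤⟨ ℚ-sum-mono (λ x → ℚ-sum-mono (covariance x)) ⟩
      ℚΣ.sum (λ x → ℚΣ.sum (λ y → ↑ ⟦ near? x y ⟧))
        ≡⟨ ℚΣ.sum-cong-≗ (λ x → sym (↑-sum (λ y → ⟦ near? x y ⟧))) ⟩
      ℚΣ.sum (λ x → ↑ ℕΣ.sum (λ y → ⟦ near? x y ⟧))
        ≡⟨ sym (↑-sum (λ x → ℕΣ.sum (λ y → ⟦ near? x y ⟧))) ⟩
      ↑ pairCount near?                                         ∎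
      where open ℚ.≤-Reasoning

-- Random carvings and the choice of a labelling

module RandomCarving (k R j : ℕ) where
  open Expectation j
  open Carving k R

  M : ℕ
  M = suc j

  L : ℕ
  L = depth M

  labelling : ∀ {n} → Vec Label n → Fin n → ℕ
  labelling ω x = toℕ (Vec.lookup ω x)

  carve : ∀ {n} → Graph n → Vec Label n → Graph n
  carve G ω = Run.output G (labelling ω) M

  opaque
    hit : ∀ {h n} → Graph h → Graph n → Vec Label n → Fin n → ℕ
    hit H G ω x = ⟦ graph≅? (component (carve G ω) x) H ⟧

    hit≤1 : ∀ {h n} (H : Graph h) (G : Graph n) ω x → hit H G ω x ≤ 1
    hit≤1 H G ω x = ⟦⟧≤1 (graph≅? (component (carve G ω) x) H)

    hit-iso : ∀ {h h′ n} (H : Graph h) (H′ : Graph h′) (G : Graph n) ω x → H ≅ H′ →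
              hit H′ G ω x ≡ ⟦ component (carve G ω) x ≅? H ⟧
    hit-iso H H′ G ω x i = ⟦⟧-cong (graph≅? (component (carve G ω) x) H′) (component (carve G ω) x ≅? H)
      (λ j → ≅-trans j (≅-sym i)) (λ j → ≅-trans j i)

    hit-cong : ∀ {h m n} (H : Graph h) {X : Graph m} {G : Graph n} {ω ω′ u x} →
               component (carve X ω) u ≅ component (carve G ω′) x → hit H X ω u ≡ hit H G ω′ x
    hit-cong H {X} {G} {ω} {ω′} {u} {x} i =
      ⟦⟧-cong (graph≅? (component (carve X ω) u) H) (graph≅? (component (carve G ω′) x) H)
        (≅-trans (≅-sym i)) (≅-trans i)

  hit-depends : ∀ {h n} (H : Graph h) (G : Graph n) x → DependsOn (Dist≤ G L x) (λ ω → ↑ hit H G ω x)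
  hit-depends H G x ω ω′ e = cong ↑_
    (hit-cong H {G} {G} {ω} {ω′} {x} {x} (component-local M λ {w} d → w , refl , cong toℕ (e w d)))
    where open ComponentLocality k R G G (labelling ω) (labelling ω′) id id id id

  hitMean : ∀ {h n} → Graph h → Graph n → Fin n → ℚ
  hitMean H G x = 𝔼 (λ ω → ↑ hit H G ω x)

  -- By locality the component of `x` is the same when the carving is run on the ball alone with
  -- restricted labels, and restricted labels are again uniform by `𝔼-marginal`.
  hitMean-ball : ∀ {h n} (H : Graph h) (G : Graph n) x α → rootedBall G L x ≅∙ α →
                 hitMean H G x ≡ hitMean H (RootedGraph.graph α) (RootedGraph.root α)
  hitMean-ball {n = n} H G x α i = trans
    (𝔼-cong λ ω → cong ↑_ (sym (restricted ω)))
    (𝔼-marginal ι injective (λ ω → ↑ hit H graph ω root))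
    where
    open BallEmbedding G L x α i
    open RootedGraph α
    restrict : Vec Label n → Vec Label order
    restrict ω = Vec.tabulate (λ u → Vec.lookup ω (ι u))
    restricted : ∀ ω → hit H graph (restrict ω) root ≡ hit H G ω x
    restricted ω = trans
      (hit-cong H {graph} {G} {restrict ω} {ω} {root} {ι root} (component-local M sees))
      (cong (hit H G ω) ι-root)
      where
      open ComponentLocality k R graph G (labelling (restrict ω)) (labelling ω) ι injective preserves reflects
      sees : ∀ {w′} → Dist≤ G L (ι root) w′ → ∃ λ w → ι w ≡ w′ × labelling (restrict ω) w ≡ labelling ω w′
      sees {w′} d with covers (subst (λ z → Dist≤ G L z w′) ι-root d)
      ... | w , refl = w , refl , cong toℕ (Vec.lookup∘tabulate _ w)

  hits : ∀ {h n} → Graph h → Graph n → Vec Label n → ℕ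
  hits H G ω = ℕΣ.sum (hit H G ω)

  hits-iso : ∀ {h h′ n} (H : Graph h) (H′ : Graph h′) (G : Graph n) ω → H ≅ H′ →
             (# (λ x → component (carve G ω) x ≅? H)) ≡ hits H′ G ω
  hits-iso H H′ G ω i = trans (#≡sum (λ x → component (carve G ω) x ≅? H))
    (ℕΣ.sum-cong-≗ λ x → sym (hit-iso H H′ G ω x i))

  hitsMean : ∀ {h n} → Graph h → Graph n → ℚ
  hitsMean H G = ℚΣ.sum (hitMean H G)

  hitsDeviation : ∀ {h n} → Graph h → Graph n → Vec Label n → ℚ
  hitsDeviation H G ω = ↑ hits H G ω ℚ.- hitsMean H G

  hits-variance : ∀ {h n} (H : Graph h) (G : Graph n) B → (∀ x → ballSize G (L + L) x ≤ B) →
                  𝔼 (λ ω → hitsDeviation H G ω ℚ.* hitsDeviation H G ω) ℚ.≤ ↑ (n * B)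
  hits-variance {n = n} H G B ball≤B = begin
    𝔼 (λ ω → hitsDeviation H G ω ℚ.* hitsDeviation H G ω)
      ≡⟨ 𝔼-cong (λ ω → cong (λ z → z ℚ.* z) (cong (ℚ._- hitsMean H G) (↑-sum (hit H G ω)))) ⟩
    𝔼 (λ ω → deviation ω ℚ.* deviation ω)                  ≤⟨ variance-≤ ⟩
    ↑ pairCount (dist≤? G (L + L))
      ≤⟨ ↑-mono (sum-mono λ x → ℕ.≤-trans (ℕ.≤-reflexive (sym (#≡sum (dist≤? G (L + L) x)))) (ball≤B x)) ⟩
    ↑ ℕΣ.sum {n} (λ _ → B)                                 ≡⟨ cong ↑_ (sum-const n B) ⟩
    ↑ (n * B)                                              ∎
    where
    open ℚ.≤-Reasoning
    sum-const : ∀ n c → ℕΣ.sum {n} (λ _ → c) ≡ n * c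
    sum-const zero    c = refl
    sum-const (suc n) c = cong (c +_) (sum-const n c)
    -- Beyond distance `2L` the two balls of radius `L` share no label.
    far : ∀ {x y} → ¬ Dist≤ G (L + L) x y → ∀ i → ¬ Dist≤ G L x i ⊎ ¬ Dist≤ G L y i
    far {x} {y} ¬near i with dist≤? G L x i
    ... | yes d = inj₂ λ d′ → ¬near (Dist-trans d (Dist-sym d′))
    ... | no ¬d = inj₁ ¬d
    open Variance j (λ x ω → ↑ hit H G ω x) (λ x ω → ↑-nonneg (hit H G ω x))
      (λ x ω → subst (↑ hit H G ω x ℚ.≤_) ↑-one (↑-mono (hit≤1 H G ω x))) (hit-depends H G) (dist≤? G (L + L)) far

  module Conflicts {n} (G : Graph n) where
    open Graph G

    conflict? : ∀ ω x → Dec (Run.Conflict G (labelling ω) x)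
    conflict? ω = Run.conflict? G (labelling ω)

    conflictDegree : Vec Label n → ℕ
    conflictDegree ω = RunProperties.conflictDegree k R G (labelling ω)

    same? : ∀ (ω : Vec Label n) z x → Dec (z ≢ x × labelling ω z ≡ labelling ω x)
    same? ω z x = ¬? (z Fin.≟ x) ×-dec (labelling ω z ℕ.≟ labelling ω x)

    same-mean : ∀ z x → 𝔼 (λ ω → ↑ ⟦ same? ω z x ⟧) ℚ.≤ weight
    same-mean z x = go (z Fin.≟ x)
      where
      go : Dec (z ≡ x) → 𝔼 (λ ω → ↑ ⟦ same? ω z x ⟧) ℚ.≤ weight
      go (yes refl) = subst (ℚ._≤ weight) (sym (trans
        (𝔼-cong λ ω → trans (cong ↑_ (⟦⟧-no (same? ω x x) λ (x≢x , _) → x≢x refl)) ↑-zero)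
        (𝔼-const n 0ℚ))) weight-nonneg
      go (no z≢x) = ℚ.≤-reflexive (begin
        𝔼 (λ ω → ↑ ⟦ same? ω z x ⟧)
          ≡⟨ 𝔼-cong (λ ω → cong ↑_ (⟦⟧-cong (same? ω z x) (Vec.lookup ω z Fin.≟ Vec.lookup ω x)
               (Fin.toℕ-injective ∘ proj₂) (λ e → z≢x , cong toℕ e))) ⟩
        -- Restricting to the labels of `z` and `x` alone turns the expectation into a double mean.
        𝔼 (λ ω → equal (Vec.tabulate (λ i → Vec.lookup ω (ι i))))
          ≡⟨ 𝔼-marginal ι injective equal ⟩
        mean (λ a → mean (λ b → ↑ ⟦ a Fin.≟ b ⟧))
          ≡⟨ mean-cong (λ a → cong (weight ℚ.*_) (trans (sym (↑-sum (λ b → ⟦ a Fin.≟ b ⟧)))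
               (trans (cong ↑_ (sum-unique (a Fin.≟_) (λ p q → trans (sym p) q) refl)) ↑-one))) ⟩
        mean (λ _ → weight ℚ.* 1ℚ)
          ≡⟨ mean-const (weight ℚ.* 1ℚ) ⟩
        weight ℚ.* 1ℚ
          ≡⟨ ℚ.*-identityʳ weight ⟩
        weight ∎)
        where
        open ≡-Reasoning
        ι : Fin 2 → Fin n
        ι zero    = z
        ι (suc _) = x
        injective : ∀ {a b} → ι a ≡ ι b → a ≡ b
        injective {zero}     {zero}     _ = refl
        injective {zero}     {suc _}    e = ⊥-elim (z≢x e)
        injective {suc _}    {zero}     e = ⊥-elim (z≢x (sym e))
        injective {suc zero} {suc zero} _ = refl
        equal : Vec Label 2 → ℚ
        equal (a ∷ b ∷ []) = ↑ ⟦ a Fin.≟ b ⟧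

    module _ (D : ℕ) (ball≤D : ∀ x → ballSize G (suc (R + R)) x ≤ D) where

      -- A union bound: at most `D` vertices can conflict with `x`, and each carries the same label
      -- with probability at most `weight`.
      conflict-mean : ∀ x → 𝔼 (λ ω → ↑ ⟦ conflict? ω x ⟧) ℚ.≤ ↑ D ℚ.* weight
      conflict-mean x = begin
        𝔼 (λ ω → ↑ ⟦ conflict? ω x ⟧)                                   ≤⟨ 𝔼-mono pointwise ⟩
        𝔼 (λ ω → ℚΣ.sum (λ z → near z ℚ.* ↑ ⟦ same? ω z x ⟧))
          ≡⟨ 𝔼-sum n (λ z ω → near z ℚ.* ↑ ⟦ same? ω z x ⟧) ⟩
        ℚΣ.sum (λ z → 𝔼 (λ ω → near z ℚ.* ↑ ⟦ same? ω z x ⟧))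
          ≡⟨ ℚΣ.sum-cong-≗ (λ z → 𝔼-* (near z) (λ ω → ↑ ⟦ same? ω z x ⟧)) ⟩
        ℚΣ.sum (λ z → near z ℚ.* 𝔼 (λ ω → ↑ ⟦ same? ω z x ⟧))
          ≤⟨ ℚ-sum-mono (λ z → ℚ-*-monoˡ-≤ (near z) (↑-nonneg ⟦ dist≤? G (suc (R + R)) x z ⟧) (same-mean z x)) ⟩
        ℚΣ.sum (λ z → near z ℚ.* weight)                                ≡⟨ sym (ℚΣ.*-distribʳ-sum weight near) ⟩
        ℚΣ.sum near ℚ.* weight
          ≡⟨ cong (ℚ._* weight) (sym (↑-sum (λ z → ⟦ dist≤? G (suc (R + R)) x z ⟧))) ⟩
        ↑ ℕΣ.sum (λ z → ⟦ dist≤? G (suc (R + R)) x z ⟧) ℚ.* weight      ≤⟨ ℚ-*-monoʳ-≤ weight weight-nonneg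
                                                                             (↑-mono (ℕ.≤-trans (ℕ.≤-reflexive (sym (#≡sum (dist≤? G (suc (R + R)) x)))) (ball≤D x))) ⟩
        ↑ D ℚ.* weight                                                  ∎
        where
        open ℚ.≤-Reasoning
        near : Fin n → ℚ
        near z = ↑ ⟦ dist≤? G (suc (R + R)) x z ⟧
        pointwise : ∀ ω → ↑ ⟦ conflict? ω x ⟧ ℚ.≤ ℚΣ.sum (λ z → near z ℚ.* ↑ ⟦ same? ω z x ⟧)
        pointwise ω = ℚ.≤-trans (↑-mono (go (conflict? ω x)))
          (ℚ.≤-reflexive (trans (↑-sum f) (ℚΣ.sum-cong-≗ λ z → ↑-* ⟦ dist≤? G (suc (R + R)) x z ⟧ ⟦ same? ω z x ⟧)))
          where
          f : Fin n → ℕ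
          f z = ⟦ dist≤? G (suc (R + R)) x z ⟧ * ⟦ same? ω z x ⟧
          go : (d : Dec (Run.Conflict G (labelling ω) x)) → ⟦ d ⟧ ≤ ℕΣ.sum f
          go (no _) = z≤n
          go (yes (z , z≢x , d , l)) = ℕ.≤-trans
            (ℕ.≤-reflexive (sym (cong₂ _*_ (⟦⟧-yes (dist≤? G (suc (R + R)) x z) d) (⟦⟧-yes (same? ω z x) (z≢x , l)))))
            (term≤sum f z)

      conflictDegree-mean : 𝔼 (λ ω → ↑ conflictDegree ω) ℚ.≤ ↑ edges G ℚ.* (↑ D ℚ.* weight)
      conflictDegree-mean = begin
        𝔼 (λ ω → ↑ conflictDegree ω)                                     ≡⟨ 𝔼-cong expand ⟩
        𝔼 (λ ω → ℚΣ.sum (λ x → deg x ℚ.* ↑ ⟦ conflict? ω x ⟧))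
          ≡⟨ 𝔼-sum n (λ x ω → deg x ℚ.* ↑ ⟦ conflict? ω x ⟧) ⟩
        ℚΣ.sum (λ x → 𝔼 (λ ω → deg x ℚ.* ↑ ⟦ conflict? ω x ⟧))
          ≡⟨ ℚΣ.sum-cong-≗ (λ x → 𝔼-* (deg x) (λ ω → ↑ ⟦ conflict? ω x ⟧)) ⟩
        ℚΣ.sum (λ x → deg x ℚ.* 𝔼 (λ ω → ↑ ⟦ conflict? ω x ⟧))
          ≤⟨ ℚ-sum-mono (λ x → ℚ-*-monoˡ-≤ (deg x) (↑-nonneg (ℕΣ.sum (λ y → ⟦ x ~? y ⟧))) (conflict-mean x)) ⟩
        ℚΣ.sum (λ x → deg x ℚ.* (↑ D ℚ.* weight))
          ≡⟨ sym (ℚΣ.*-distribʳ-sum (↑ D ℚ.* weight) deg) ⟩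
        ℚΣ.sum deg ℚ.* (↑ D ℚ.* weight)
          ≡⟨ cong (ℚ._* (↑ D ℚ.* weight)) (sym (↑-sum (λ x → ℕΣ.sum (λ y → ⟦ x ~? y ⟧)))) ⟩
        ↑ edges G ℚ.* (↑ D ℚ.* weight)                                   ∎
        where
        open ℚ.≤-Reasoning
        deg : Fin n → ℚ
        deg x = ↑ ℕΣ.sum (λ y → ⟦ x ~? y ⟧)
        expand : ∀ ω → ↑ conflictDegree ω ≡ ℚΣ.sum (λ x → deg x ℚ.* ↑ ⟦ conflict? ω x ⟧)
        expand ω = trans (↑-sum (λ x → ℕΣ.sum (λ y → ⟦ conflict? ω x ×-dec (x ~? y) ⟧))) (ℚΣ.sum-cong-≗ λ x →
          trans (cong ↑_ (trans (ℕΣ.sum-cong-≗ λ y → trans (⟦⟧-× (conflict? ω x) (x ~? y)) (ℕ.*-comm ⟦ conflict? ω x ⟧ ⟦ x ~? y ⟧))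
            (sym (ℕΣ.*-distribʳ-sum ⟦ conflict? ω x ⟧ (λ y → ⟦ x ~? y ⟧)))))
            (↑-* (ℕΣ.sum (λ y → ⟦ x ~? y ⟧)) ⟦ conflict? ω x ⟧))

    conflictDegree≤edges : ∀ ω → conflictDegree ω ≤ edges G
    conflictDegree≤edges ω = pairCount-mono (λ x y → conflict? ω x ×-dec (x ~? y)) _~?_ proj₂

  module Choice (cs : List Code) (D B : ℕ) (0<D : 0 < D) {n} (G : Graph n)
    (ball≤D : ∀ x → ballSize G (suc (R + R)) x ≤ D) (ball≤B : ∀ x → ballSize G (L + L) x ≤ B) where
    open Conflicts G

    -- The successor makes the bound positive, as Markov's inequality requires, even for an empty
    -- graph.
    spread : ℕ
    spread = suc (length cs * (n * B))

    squares : Vec Label n → Fin (length cs) → ℚ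
    squares ω i = hitsDeviation H G ω ℚ.* hitsDeviation H G ω
      where H = fromMatrix (proj₂ (lookup cs i))

    squares-nonneg : ∀ ω i → 0ℚ ℚ.≤ squares ω i
    squares-nonneg ω i = square-nonneg (hitsDeviation (fromMatrix (proj₂ (lookup cs i))) G ω)

    potential : Vec Label n → ℚ
    potential ω = ℚΣ.sum (squares ω)

    potential-mean : 𝔼 potential ℚ.≤ ↑ spread
    potential-mean = begin
      𝔼 potential                                  ≡⟨ 𝔼-sum (length cs) (λ i ω → squares ω i) ⟩
      ℚΣ.sum (λ i → 𝔼 (λ ω → squares ω i))
        ≤⟨ ℚ-sum-mono (λ i → hits-variance (fromMatrix (proj₂ (lookup cs i))) G B ball≤B) ⟩
      ℚΣ.sum {length cs} (λ _ → ↑ (n * B))         ≡⟨ ℚ-sum-const (length cs) (↑ (n * B)) ⟩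
      ↑ length cs ℚ.* ↑ (n * B)                    ≡⟨ sym (↑-* (length cs) (n * B)) ⟩
      ↑ (length cs * (n * B))                      ≤⟨ ↑-mono (ℕ.n≤1+n _) ⟩
      ↑ spread                                     ∎
      where open ℚ.≤-Reasoning

    -- Both bounds are twice a bound on the mean. The second one is multiplied by `M`, the inverse
    -- of `weight`, to become a statement about naturals.
    Good : Vec Label n → Set
    Good ω = potential ω ℚ.≤ ↑ spread ℚ.+ ↑ spread × M * conflictDegree ω ≤ 2 * (edges G * D)

    0<spread : 0ℚ ℚ.< ↑ spread
    0<spread = ↑-pos (s≤s z≤n)

    -- Here the bound on the mean of the conflicts is 0, which `𝔼-attains₂` does not allow; but then
    -- no edge can be at a conflict, and only the potential has to be controlled.
    good-edgeless : edges G ≡ 0 → ∃ Good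
    good-edgeless e =
      let ω , le = 𝔼-attains potential (↑ spread) potential-mean in
      ω , ℚ.≤-trans le (subst (ℚ._≤ ↑ spread ℚ.+ ↑ spread) (ℚ.+-identityʳ (↑ spread)) (ℚ.+-monoʳ-≤ (↑ spread) (ℚ.<⇒≤ 0<spread)))
        , ℕ.≤-trans (ℕ.*-monoʳ-≤ M (ℕ.≤-trans (conflictDegree≤edges ω) (ℕ.≤-reflexive e)))
            (ℕ.≤-trans (ℕ.≤-reflexive (ℕ.*-zeroʳ M)) z≤n)

    good-edges : 0 < edges G → ∃ Good
    good-edges 0<e =
      let ω , le , le′ = 𝔼-attains₂ potential (λ ω → ↑ conflictDegree ω) (↑ spread) b
            (λ ω → ℚ-sum-nonneg (squares-nonneg ω)) (λ ω → ↑-nonneg (conflictDegree ω)) 0<spread 0<b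
            potential-mean (conflictDegree-mean D ball≤D)
      in ω , le , rescale (conflictDegree ω) (edges G) le′
      where
      b : ℚ
      b = ↑ edges G ℚ.* (↑ D ℚ.* weight)
      0<b : 0ℚ ℚ.< b
      0<b = ℚ-*-pos (↑-pos 0<e) (ℚ-*-pos (↑-pos 0<D) weight-pos)
      rescale : ∀ c e → ↑ c ℚ.≤ ↑ e ℚ.* (↑ D ℚ.* weight) ℚ.+ ↑ e ℚ.* (↑ D ℚ.* weight) → M * c ≤ 2 * (e * D)
      rescale c e le = ↑-cancel-≤ (begin
        ↑ (M * c)                                       ≡⟨ ↑-* M c ⟩
        ↑ M ℚ.* ↑ c                                     ≤⟨ ℚ-*-monoˡ-≤ (↑ M) (↑-nonneg M) le ⟩
        ↑ M ℚ.* (↑ e ℚ.* (↑ D ℚ.* weight) ℚ.+ ↑ e ℚ.* (↑ D ℚ.* weight))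
          ≡⟨ solve 4 (λ m e d w → m :* (e :* (d :* w) :+ e :* (d :* w)) := (w :* m) :* (e :* d :+ e :* d)) refl (↑ M) (↑ e) (↑ D) weight ⟩
        (weight ℚ.* ↑ M) ℚ.* (↑ e ℚ.* ↑ D ℚ.+ ↑ e ℚ.* ↑ D)
          ≡⟨ trans (cong (ℚ._* (↑ e ℚ.* ↑ D ℚ.+ ↑ e ℚ.* ↑ D)) weight-inverse) (ℚ.*-identityˡ (↑ e ℚ.* ↑ D ℚ.+ ↑ e ℚ.* ↑ D)) ⟩
        ↑ e ℚ.* ↑ D ℚ.+ ↑ e ℚ.* ↑ D                     ≡⟨ cong₂ ℚ._+_ (sym (↑-* e D)) (sym (↑-* e D)) ⟩
        ↑ (e * D) ℚ.+ ↑ (e * D)                         ≡⟨ sym (↑-+ (e * D) (e * D)) ⟩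
        ↑ (e * D + e * D)
          ≡⟨ cong (λ z → ↑ (e * D + z)) (sym (ℕ.+-identityʳ (e * D))) ⟩
        ↑ (2 * (e * D))                                 ∎)
        where
        open ℚ.≤-Reasoning
        open +-*-Solver

    good : ∃ Good
    good with ℕ.m≤n⇒m<n∨m≡n (z≤n {edges G})
    ... | inj₁ 0<e = good-edges 0<e
    ... | inj₂ 0≡e = good-edgeless (sym 0≡e)

    deviation-bound : ∀ {ω} → Good ω → ∀ {c} → c ∈ cs →
      hitsDeviation (fromMatrix (proj₂ c)) G ω ℚ.* hitsDeviation (fromMatrix (proj₂ c)) G ω ℚ.≤ ↑ spread ℚ.+ ↑ spread
    deviation-bound {ω} (le , _) {c} c∈cs = begin
      square c                          ≡⟨ cong square (Any.lookup-index c∈cs) ⟩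
      squares ω (index c∈cs)            ≤⟨ ℚ-term≤sum (squares-nonneg ω) (index c∈cs) ⟩
      potential ω                       ≤⟨ le ⟩
      ↑ spread ℚ.+ ↑ spread             ∎
      where
      open ℚ.≤-Reasoning
      square : Code → ℚ
      square c = hitsDeviation (fromMatrix (proj₂ c)) G ω ℚ.* hitsDeviation (fromMatrix (proj₂ c)) G ω

-- Subexponential growth

archimedean : ∀ q → ∃ λ c → q ℚ.≤ ↑ c
archimedean q@(ℚ.mkℚ _ _ _) = ℤ.∣ ℚ.↥ q ∣ , ℚ.toℚᵘ-cancel-≤ (begin
  ℚ.toℚᵘ q                              ≤⟨ ℚᵘ.*≤* numerators ⟩
  ℤ.+ ℤ.∣ ℚ.↥ q ∣ ℚᵘ./ 1                ≃⟨ ℚᵘ.≃-sym (↑ᵘ ℤ.∣ ℚ.↥ q ∣) ⟩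
  ℚ.toℚᵘ (↑ ℤ.∣ ℚ.↥ q ∣)                ∎)
  where
  open ℚᵘ.≤-Reasoning
  i≤∣i∣ : ∀ i → i ℤ.≤ ℤ.+ ℤ.∣ i ∣
  i≤∣i∣ (ℤ.+ n)      = ℤ.≤-refl
  i≤∣i∣ (ℤ.-[1+ n ]) = ℤ.-≤+
  numerators : ℚᵘ.↥ (ℚ.toℚᵘ q) ℤ.* ℤ.+ 1 ℤ.≤ ℤ.+ ℤ.∣ ℚ.↥ q ∣ ℤ.* ℚᵘ.↧ (ℚ.toℚᵘ q)
  numerators = ℤ.≤-trans (ℤ.≤-reflexive (ℤ.*-identityʳ _))
    (ℤ.≤-trans (i≤∣i∣ (ℚ.↥ q)) (subst (ℤ._≤ ℤ.+ ℤ.∣ ℚ.↥ q ∣ ℤ.* ℚ.↧ q) (ℤ.*-identityʳ (ℤ.+ ℤ.∣ ℚ.↥ q ∣))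
      (ℤ.*-monoˡ-≤-nonNeg (ℤ.+ ℤ.∣ ℚ.↥ q ∣) (ℤ.+≤+ (s≤s z≤n)))))

reciprocal : ∀ e → 0ℚ ℚ.< e → ∃ λ q → 1ℚ ℚ.≤ ↑ suc q ℚ.* e
reciprocal e 0<e = c , (begin
  1ℚ                ≡⟨ sym (ℚ.*-inverseˡ e) ⟩
  ℚ.1/ e ℚ.* e      ≤⟨ ℚ-*-monoʳ-≤ e (ℚ.<⇒≤ 0<e) (ℚ.≤-trans (proj₂ bound) (↑-mono (ℕ.n≤1+n c))) ⟩
  ↑ suc c ℚ.* e     ∎)
  where
  open ℚ.≤-Reasoning
  instance
    e≢0 : ℚ.NonZero e
    e≢0 = ℚ.pos⇒nonZero e {{ℚ.positive 0<e}}
  bound = archimedean (ℚ.1/ e)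
  c = proj₁ bound

half-pos : ∀ {e} → 0ℚ ℚ.< e → 0ℚ ℚ.< ½ ℚ.* e
half-pos = ℚ-*-pos (ℚ.positive⁻¹ ½)

halves : ∀ e → ½ ℚ.* e ℚ.+ ½ ℚ.* e ≡ e
halves e = trans (sym (ℚ.*-distribʳ-+ e ½ ½)) (ℚ.*-identityˡ e)

-- This is `(1 + 1/a)^n ≥ 1 + n/a` without denominators.
bernoulli : ∀ a n → (a + n) * a ^ n ≤ a * suc a ^ n
bernoulli a zero    = ℕ.≤-reflexive (cong (_* 1) (ℕ.+-identityʳ a))
bernoulli a (suc n) = begin
  (a + suc n) * (a * a ^ n)                  ≡⟨ solve 3 (λ a n b → (a :+ (con 1 :+ n)) :* (a :* b) := a :* ((a :+ n) :* b) :+ a :* b) refl a n (a ^ n) ⟩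
  a * ((a + n) * a ^ n) + a * a ^ n
    ≤⟨ ℕ.+-mono-≤ (ℕ.*-monoʳ-≤ a (bernoulli a n)) (ℕ.*-monoˡ-≤ (a ^ n) (ℕ.m≤m+n a n)) ⟩
  a * (a * suc a ^ n) + (a + n) * a ^ n      ≤⟨ ℕ.+-monoʳ-≤ (a * (a * suc a ^ n)) (bernoulli a n) ⟩
  a * (a * suc a ^ n) + a * suc a ^ n
    ≡⟨ solve 2 (λ a b → a :* (a :* b) :+ a :* b := a :* ((con 1 :+ a) :* b)) refl a (suc a ^ n) ⟩
  a * (suc a * suc a ^ n)                    ∎
  where
  open ℕ.≤-Reasoning
  open ℕSolver.+-*-Solver

*-^ : ∀ x y n → (x * y) ^ n ≡ x ^ n * y ^ n
*-^ x y zero    = refl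
*-^ x y (suc n) = trans (cong (x * y *_) (*-^ x y n))
  (solve 4 (λ x y p q → x :* y :* (p :* q) := x :* p :* (y :* q)) refl x y (x ^ n) (y ^ n))
  where open ℕSolver.+-*-Solver

≤-of-distance : ∀ x y t → ℚ.∣ x ℚ.- y ∣ ℚ.< t → x ℚ.≤ y ℚ.+ t
≤-of-distance x y t d = begin
  x                  ≡⟨ solve 2 (λ x y → x := y :+ (x :- y)) refl x y ⟩
  y ℚ.+ (x ℚ.- y)    ≤⟨ ℚ.+-monoʳ-≤ y (ℚ.≤-trans (p≤∣p∣ (x ℚ.- y)) (ℚ.<⇒≤ d)) ⟩
  y ℚ.+ t            ∎
  where
  open ℚ.≤-Reasoning
  open +-*-Solver

eventually-bounded : ∀ x → ∃ λ c → ∃ λ N → ∀ m → N ≤ m → seq x m ℚ.≤ ↑ c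
eventually-bounded x =
  let N , close = cauchy x 1ℚ (ℚ.positive⁻¹ 1ℚ)
      c , le    = archimedean (seq x N ℚ.+ 1ℚ)
  in c , N , λ m N≤m → ℚ.≤-trans (≤-of-distance (seq x m) (seq x N) 1ℚ (close m N N≤m ℕ.≤-refl)) le

ℚ-power : ℚ → ℕ → ℚ
ℚ-power q zero    = 1ℚ
ℚ-power q (suc n) = q ℚ.* ℚ-power q n

seq-+ : ∀ x y m → seq (x +ᴿ y) m ≡ seq x m ℚ.+ seq y m
seq-+ x y m = refl

seq-* : ∀ x y m → seq (x *ᴿ y) m ≡ seq x m ℚ.* seq y m
seq-* x y m = refl

seq-^ : ∀ x q → (∀ m → seq x m ≡ q) → ∀ n m → seq (x ^ᴿ n) m ≡ ℚ-power q n
seq-^ x q e zero    m = refl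
seq-^ x q e (suc n) m = trans (seq-* x (x ^ᴿ n) m) (cong₂ ℚ._*_ (e m) (seq-^ x q e n m))

ℚ-power-nonneg : ∀ q → 0ℚ ℚ.≤ q → ∀ n → 0ℚ ℚ.≤ ℚ-power q n
ℚ-power-nonneg q 0≤q zero    = ℚ.nonNegative⁻¹ 1ℚ
ℚ-power-nonneg q 0≤q (suc n) = ℚ-*-nonneg 0≤q (ℚ-power-nonneg q 0≤q n)

ℚ-power-scaled : ∀ q a b → q ℚ.* ↑ a ≡ ↑ b → ∀ n → ℚ-power q n ℚ.* ↑ (a ^ n) ≡ ↑ (b ^ n)
ℚ-power-scaled q a b e zero    = ℚ.*-identityˡ (↑ 1)
ℚ-power-scaled q a b e (suc n) = begin
  q ℚ.* ℚ-power q n ℚ.* ↑ (a * a ^ n)            ≡⟨ cong (q ℚ.* ℚ-power q n ℚ.*_) (↑-* a (a ^ n)) ⟩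
  q ℚ.* ℚ-power q n ℚ.* (↑ a ℚ.* ↑ (a ^ n))
    ≡⟨ solve 4 (λ q p a b → q :* p :* (a :* b) := (q :* a) :* (p :* b)) refl q (ℚ-power q n) (↑ a) (↑ (a ^ n)) ⟩
  (q ℚ.* ↑ a) ℚ.* (ℚ-power q n ℚ.* ↑ (a ^ n))    ≡⟨ cong₂ ℚ._*_ e (ℚ-power-scaled q a b e n) ⟩
  ↑ b ℚ.* ↑ (b ^ n)                              ≡⟨ sym (↑-* b (b ^ n)) ⟩
  ↑ (b * b ^ n)                                  ∎
  where
  open ≡-Reasoning
  open +-*-Solver

eventually-exceeded : ∀ C P p c N F → (∀ m → N ≤ m → seq C m ℚ.≤ ↑ c) → (∀ m → seq P m ≡ p) → 0ℚ ℚ.≤ p →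
                      ↑ c ℚ.* p ℚ.< ↑ F → C *ᴿ P <ᴿ fromℕ F
eventually-exceeded C P p c N F C≤c P≡p 0≤p lt = gap , gap-pos , N , λ m N≤m → begin
  seq (C *ᴿ P) m ℚ.+ gap        ≡⟨ cong (ℚ._+ gap) (trans (seq-* C P m) (cong (seq C m ℚ.*_) (P≡p m))) ⟩
  seq C m ℚ.* p ℚ.+ gap         ≤⟨ ℚ.+-monoˡ-≤ gap (ℚ-*-monoʳ-≤ p 0≤p (C≤c m N≤m)) ⟩
  ↑ c ℚ.* p ℚ.+ gap             ≡⟨ solve 2 (λ x y → x :+ (y :- x) := y) refl (↑ c ℚ.* p) (↑ F) ⟩
  ↑ F                           ≡⟨ ↑-/1 F ⟩
  seq (fromℕ F) m               ∎
  where
  open ℚ.≤-Reasoning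
  open +-*-Solver
  gap : ℚ
  gap = ↑ F ℚ.- ↑ c ℚ.* p
  gap-pos : 0ℚ ℚ.< gap
  gap-pos = subst (ℚ._< gap) (ℚ.+-inverseʳ (↑ c ℚ.* p)) (ℚ.+-monoˡ-< (ℚ.- (↑ c ℚ.* p)) lt)

-- `_≤ᴿ_` is a negation, but the order of naturals is decidable, so a contradiction is enough: a
-- strict reverse inequality of naturals leaves a rational gap valid on a whole tail, which is what
-- `_<ᴿ_` asks for.
scaled-bound : ∀ a δ → 0ℚ ℚ.< δ → δ ℚ.* ↑ a ≡ 1ℚ → ∀ C c N F n → (∀ m → N ≤ m → seq C m ℚ.≤ ↑ c) →
               fromℕ F ≤ᴿ C *ᴿ (1ᴿ +ᴿ fromℚ δ) ^ᴿ n → F * a ^ n ≤ c * suc a ^ n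
scaled-bound a δ 0<δ δa C c N F n C≤c F≤ = ℕ.≮⇒≥ λ lt → F≤
  (eventually-exceeded C ((1ᴿ +ᴿ fromℚ δ) ^ᴿ n) (ℚ-power ρ n) c N F C≤c
    (seq-^ (1ᴿ +ᴿ fromℚ δ) ρ (seq-+ 1ᴿ (fromℚ δ)) n)
    (ℚ-power-nonneg ρ (ℚ.<⇒≤ (ℚ.+-mono-< (ℚ.positive⁻¹ 1ℚ) 0<δ)) n)
    (ℚ.*-cancelʳ-<-nonNeg (↑ (a ^ n)) {{ℚ.nonNegative (↑-nonneg (a ^ n))}} (scaled lt)))
  where
  ρ : ℚ
  ρ = 1ℚ ℚ.+ δ
  ρa : ρ ℚ.* ↑ a ≡ ↑ suc a
  ρa = begin
    (1ℚ ℚ.+ δ) ℚ.* ↑ a           ≡⟨ ℚ.*-distribʳ-+ (↑ a) 1ℚ δ ⟩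
    1ℚ ℚ.* ↑ a ℚ.+ δ ℚ.* ↑ a     ≡⟨ cong₂ ℚ._+_ (ℚ.*-identityˡ (↑ a)) (trans δa (sym ↑-one)) ⟩
    ↑ a ℚ.+ ↑ 1                  ≡⟨ ℚ.+-comm (↑ a) (↑ 1) ⟩
    ↑ 1 ℚ.+ ↑ a                  ≡⟨ sym (↑-+ 1 a) ⟩
    ↑ suc a                      ∎
    where open ≡-Reasoning
  scaled : c * suc a ^ n < F * a ^ n → (↑ c ℚ.* ℚ-power ρ n) ℚ.* ↑ (a ^ n) ℚ.< ↑ F ℚ.* ↑ (a ^ n)
  scaled lt = subst₂ ℚ._<_
    (trans (↑-* c (suc a ^ n)) (trans (cong (↑ c ℚ.*_) (sym (ℚ-power-scaled ρ a (suc a) ρa n)))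
      (sym (ℚ.*-assoc (↑ c) (ℚ-power ρ n) (↑ (a ^ n))))))
    (↑-* F (a ^ n)) (↑-< lt)

module SubexponentialBound (f : ℕ → ℕ) (subexp : Subexponential f) where

  scale-bound : ∀ a δ → 0ℚ ℚ.< δ → δ ℚ.* ↑ a ≡ 1ℚ → ∃ λ c → ∀ n → 1 ≤ n → f n * a ^ n ≤ c * suc a ^ n
  scale-bound a δ 0<δ δa =
    let C , _ , f≤    = subexp (fromℚ δ) (δ , 0<δ , 0 , λ _ _ → ℚ.≤-reflexive (ℚ.+-identityˡ δ))
        c , N , C≤c   = eventually-bounded C
    in c , λ n 1≤n → scaled-bound a δ 0<δ δa C c N (f n) n C≤c (f≤ n 1≤n)

  growth-bound : ∀ b → ∃ λ c → ∀ n → 1 ≤ n → f n * suc b ^ n ≤ c * suc (suc b) ^ n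
  growth-bound b = scale-bound (suc b) (ℤ.+ 1 ℚ./ suc b)
    (ℚ.positive⁻¹ (ℤ.+ 1 ℚ./ suc b) {{ℚ.normalize-pos 1 (suc b)}}) (trans (↑/ 1 b) ↑-one)

  -- With a = 3k one has (1 + 1/a)² ≤ 1 + 1/k, and (1 + 1/a)ⁿ outgrows every constant.
  radius-bound : ∀ d k → 0 < k → ∃ λ n → d * f (suc n) * k ^ n < suc k ^ n
  radius-bound d (suc j) _ = n , ℕ.≰⇒> λ Q≤ → ℕ.<-irrefl refl (begin-strict
      a * (Q * (B * B))                        ≤⟨ ℕ.*-monoʳ-≤ a (ℕ.*-monoˡ-≤ (B * B) Q≤) ⟩
      a * (d * F * P * (B * B))
        ≡⟨ solve 5 (λ a d F P B → a :* (d :* F :* P :* (B :* B)) := d :* P :* B :* (F :* (a :* B))) refl a d F P B ⟩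
      d * P * B * (F * (a * B))
        ≤⟨ ℕ.*-monoʳ-≤ (d * P * B) (proj₂ (growth-bound b) (suc n) (s≤s z≤n)) ⟩
      d * P * B * (c * (suc a * A))
        ≡⟨ solve 6 (λ d P B c a A → d :* P :* B :* (c :* (a :* A)) := P :* A :* (d :* (c :* a) :* B)) refl d P B c (suc a) A ⟩
      P * A * (n * B)                          <⟨ ℕ.*-monoʳ-< (P * A) {{ℕ.>-nonZero (ℕ.*-mono-< P>0 A>0)}}
                                                    (ℕ.<-≤-trans (ℕ.*-monoˡ-< B {{ℕ.>-nonZero B>0}} (ℕ.m<n+m n {a} (s≤s z≤n))) (bernoulli a n)) ⟩
      P * A * (a * A)
        ≡⟨ solve 3 (λ P A a → P :* A :* (a :* A) := a :* (P :* (A :* A))) refl P A a ⟩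
      a * (P * (A * A))                        ≤⟨ ℕ.*-monoʳ-≤ a squares ⟩
      a * (Q * (B * B))                        ∎)
    where
    open ℕ.≤-Reasoning
    open ℕSolver.+-*-Solver
    k a b c n A B P Q F : ℕ
    k = suc j
    b = 2 + 3 * j
    a = suc b
    c = proj₁ (growth-bound b)
    -- This collects the constants that remain once the growth bound is applied to `f (suc n)`: the
    -- degree factor `d`, the constant `c`, and `suc a` from the exponent `suc n`.
    n = d * (c * suc a)
    A = suc a ^ n
    B = a ^ n
    P = k ^ n
    Q = suc k ^ n
    F = f (suc n)
    P>0 : 0 < P
    P>0 = ℕ.m^n>0 k n
    A>0 : 0 < A
    A>0 = ℕ.m^n>0 (suc a) n
    B>0 : 0 < B
    B>0 = ℕ.m^n>0 a n
    product-power : ∀ x y → (x * (y * y)) ^ n ≡ x ^ n * (y ^ n * y ^ n)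
    product-power x y = trans (*-^ x (y * y) n) (cong (x ^ n *_) (*-^ y y n))
    base : k * (suc a * suc a) ≤ suc k * (a * a)
    base = ℕ.≤-trans (ℕ.m≤m+n _ (2 + 5 * j + 3 * (j * j))) (ℕ.≤-reflexive
      (solve 1 (λ j → let k = con 1 :+ j ; a = con 3 :+ con 3 :* j in
        k :* ((con 1 :+ a) :* (con 1 :+ a)) :+ (con 2 :+ con 5 :* j :+ con 3 :* (j :* j)) := (con 1 :+ k) :* (a :* a)) refl j))
    squares : P * (A * A) ≤ Q * (B * B)
    squares = subst₂ _≤_ (product-power k (suc a)) (product-power (suc k) a) (ℕ.^-monoˡ-≤ n base)

module _ (k : ℕ) (0<k : 0 < k) {n} (G : Graph n) (label : Fin n → ℕ) {d f} (cls : Graph[ d , f ] G)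
  (N : ℕ) (bound : d * f (suc N) * k ^ N < suc k ^ N) where

  open Carving k (suc N)
  open Run G label

  ballEdges≤ : ∀ S r z → 1 ≤ r → ballEdges S r z ≤ d * f r
  ballEdges≤ S r z 1≤r = begin
    ballEdges S r z
      ≤⟨ pairCount-mono (inBallEdge? S r z) (λ x y → dist≤? G r z x ×-dec Graph._~?_ G x y)
           (λ (dx , _ , _ , _ , e) → Dist-⊑ (within-⊑ G S) dx , e) ⟩
    ℕΣ.sum (λ x → ℕΣ.sum (λ y → ⟦ dist≤? G r z x ×-dec Graph._~?_ G x y ⟧))
      ≡⟨ ℕΣ.sum-cong-≗ (λ x → trans (ℕΣ.sum-cong-≗ (λ y → ⟦⟧-× (dist≤? G r z x) (Graph._~?_ G x y)))
           (trans (sym (ℕΣ.*-distribˡ-sum ⟦ dist≤? G r z x ⟧ (λ y → ⟦ Graph._~?_ G x y ⟧)))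
             (trans (ℕ.*-comm ⟦ dist≤? G r z x ⟧ _) (cong (_* ⟦ dist≤? G r z x ⟧) (sym (#≡sum (Graph._~?_ G x))))))) ⟩
    ℕΣ.sum (λ x → degree G x * ⟦ dist≤? G r z x ⟧)
      ≤⟨ sum-mono (λ x → ℕ.*-monoˡ-≤ ⟦ dist≤? G r z x ⟧ (Graph[_,_].maxDegree cls x)) ⟩
    ℕΣ.sum (λ x → d * ⟦ dist≤? G r z x ⟧)
      ≡⟨ sym (ℕΣ.*-distribˡ-sum d (λ x → ⟦ dist≤? G r z x ⟧)) ⟩
    d * ℕΣ.sum (λ x → ⟦ dist≤? G r z x ⟧)
      ≡⟨ cong (d *_) (sym (#≡sum (dist≤? G r z))) ⟩
    d * ballSize G r z
      ≤⟨ ℕ.*-monoʳ-≤ d (Graph[_,_].growth cls z r 1≤r) ⟩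
    d * f r ∎
    where open ℕ.≤-Reasoning

  -- Fast growth at every radius up to `N` would multiply the edge count by more than `1 + 1/k` each
  -- time and exceed `d * f (suc N)`. The induction starts because fast growth at radius 0 forces an
  -- edge at radius 1; around an isolated or dead vertex radius 0 is already slow.
  slow-exists : ∀ S z → ∃ λ r → r < suc N × SlowGrowth S z r
  slow-exists S z with search-slow (suc N)
    where
    search-slow : ∀ l → (∃ λ r → r < l × SlowGrowth S z r) ⊎ (∀ r → r < l → ¬ SlowGrowth S z r)
    search-slow zero = inj₂ λ _ ()
    search-slow (suc l) with search-slow l | slowGrowth? S z l
    ... | inj₁ (r , r<l , s) | _     = inj₁ (r , ℕ.m<n⇒m<1+n r<l , s)
    ... | inj₂ none          | yes s = inj₁ (l , ℕ.≤-refl , s)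
    ... | inj₂ none          | no ¬s = inj₂ λ r r<sl → case r r<sl
      where
      case : ∀ r → r < suc l → ¬ SlowGrowth S z r
      case r (s≤s r≤l) with ℕ.m≤n⇒m<n∨m≡n r≤l
      ... | inj₁ r<l  = none r r<l
      ... | inj₂ refl = ¬s
  ... | inj₁ found = found
  ... | inj₂ none = ⊥-elim (ℕ.<-irrefl refl (begin-strict
      suc k ^ N                        ≤⟨ grows N ℕ.≤-refl ⟩
      k ^ N * e (suc N)                ≤⟨ ℕ.*-monoʳ-≤ (k ^ N) (ballEdges≤ S (suc N) z (s≤s z≤n)) ⟩
      k ^ N * (d * f (suc N))          ≡⟨ ℕ.*-comm (k ^ N) (d * f (suc N)) ⟩
      d * f (suc N) * k ^ N            <⟨ bound ⟩
      suc k ^ N                        ∎))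
    where
    open ℕ.≤-Reasoning
    e : ℕ → ℕ
    e r = ballEdges S r z
    fast : ∀ r → r ≤ N → suc k * e r < k * e (suc r)
    fast r r≤N = ℕ.≰⇒> (none r (s≤s r≤N))
    grows : ∀ r → r ≤ N → suc k ^ r ≤ k ^ r * e (suc r)
    grows zero    _   = ℕ.≤-trans (ℕ.n≢0⇒n>0 (λ e₁≡0 → ℕ.n≮0 (subst (suc k * e 0 <_) (trans (cong (k *_) e₁≡0) (ℕ.*-zeroʳ k)) (fast 0 z≤n))))
      (ℕ.≤-reflexive (sym (ℕ.+-identityʳ (e 1))))
    grows (suc r) r<N = begin
      suc k * suc k ^ r                ≤⟨ ℕ.*-monoʳ-≤ (suc k) (grows r (ℕ.<⇒≤ r<N)) ⟩
      suc k * (k ^ r * e (suc r))      ≡⟨ swap (suc k) (k ^ r) (e (suc r)) ⟩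
      k ^ r * (suc k * e (suc r))      ≤⟨ ℕ.*-monoʳ-≤ (k ^ r) (ℕ.<⇒≤ (fast (suc r) r<N)) ⟩
      k ^ r * (k * e (suc (suc r)))    ≡⟨ sym (trans (ℕ.*-assoc k (k ^ r) _) (swap k (k ^ r) (e (suc (suc r))))) ⟩
      k * k ^ r * e (suc (suc r))      ∎
      where
      swap : ∀ a b c → a * (b * c) ≡ b * (a * c)
      swap a b c = trans (sym (ℕ.*-assoc a b c)) (trans (cong (_* c) (ℕ.*-comm a b)) (ℕ.*-assoc b a c))

-- Convergence of the densities

Cauchy : (ℕ → ℚ) → Set
Cauchy s = ∀ e → 0ℚ ℚ.< e → ∃ λ N → ∀ m n → N ≤ m → N ≤ n → ℚ.∣ s m ℚ.- s n ∣ ℚ.< e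

Null : (ℕ → ℚ) → Set
Null s = ∀ e → 0ℚ ℚ.< e → ∃ λ N → ∀ n → N ≤ n → ℚ.∣ s n ∣ ℚ.< e

Cauchy-cong : ∀ {s t} → (∀ n → s n ≡ t n) → Cauchy s → Cauchy t
Cauchy-cong s≗t cs e 0<e = let N , close = cs e 0<e in
  N , λ m n p q → subst (ℚ._< e) (cong₂ (λ a b → ℚ.∣ a ℚ.- b ∣) (s≗t m) (s≗t n)) (close m n p q)

Cauchy-const : ∀ q → Cauchy (λ _ → q)
Cauchy-const q = cauchy (fromℚ q)

Cauchy-+ : ∀ {s t} → Cauchy s → Cauchy t → Cauchy (λ n → s n ℚ.+ t n)
Cauchy-+ {s} {t} cs ct = cauchy (mkℝ s cs +ᴿ mkℝ t ct)

Cauchy-* : ∀ {s} q → Cauchy s → Cauchy (λ n → q ℚ.* s n)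
Cauchy-* {s} q cs = cauchy (fromℚ q *ᴿ mkℝ s cs)

Null⇒Cauchy : ∀ {s} → Null s → Cauchy s
Null⇒Cauchy {s} null e 0<e = let N , small = null (½ ℚ.* e) (half-pos 0<e) in
  N , λ m n p q → ℚ.≤-<-trans (ℚ.∣p-q∣≤∣p∣+∣q∣ (s m) (s n))
    (subst (ℚ.∣ s m ∣ ℚ.+ ℚ.∣ s n ∣ ℚ.<_) (halves e) (ℚ.+-mono-< (small m p) (small n q)))

Cauchy-near : ∀ {s t} → Cauchy t → Null (λ n → s n ℚ.- t n) → Cauchy s
Cauchy-near {s} {t} ct null = Cauchy-cong {λ n → t n ℚ.+ (s n ℚ.- t n)} {s}
  (λ n → solve 2 (λ s t → t :+ (s :- t) := s) refl (s n) (t n))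
  (Cauchy-+ {t} {λ n → s n ℚ.- t n} ct (Null⇒Cauchy {λ n → s n ℚ.- t n} null))
  where open +-*-Solver

Cauchy-classSum : ∀ cs (h : ℕ → RootedCode → ℚ) → (∀ c → Cauchy (λ n → h n c)) → Cauchy (λ n → classSum cs (h n))
Cauchy-classSum []       h ch = Cauchy-const 0ℚ
Cauchy-classSum (c ∷ cs) h ch = Cauchy-+ {λ n → unless (later? c cs) (h n c)} {λ n → classSum cs (h n)}
  (go (later? c cs)) (Cauchy-classSum cs h ch)
  where
  go : ∀ {A : Set} (a? : Dec A) → Cauchy (λ n → unless a? (h n c))
  go (yes _) = Cauchy-const 0ℚ
  go (no _)  = ch c

seq-distance : ∀ x y j → seq ∣ x -ᴿ y ∣ᴿ j ≡ ℚ.∣ seq x j ℚ.- seq y j ∣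
seq-distance x y j = refl

-- Each `a n` is a constant rational, so the sequence of these rationals, taken as a real number, is
-- its own limit.
Cauchy⇒⟶ : ∀ (a : ℕ → ℝ) {s} → (∀ n j → seq (a n) j ≡ s n) → (cs : Cauchy s) → a ⟶ mkℝ s cs
Cauchy⇒⟶ a {s} a≡s cs e (e₁ , 0<e₁ , N₁ , e₁≤e) =
  let N , close = cs (½ ℚ.* e₁) (half-pos 0<e₁) in
  N , λ n N≤n → ½ ℚ.* e₁ , half-pos 0<e₁ , N ⊔ N₁ , λ j p → begin
    seq ∣ a n -ᴿ mkℝ s cs ∣ᴿ j ℚ.+ ½ ℚ.* e₁
      ≡⟨ cong (ℚ._+ ½ ℚ.* e₁) (trans (seq-distance (a n) (mkℝ s cs) j) (cong (λ z → ℚ.∣ z ℚ.- s j ∣) (a≡s n j))) ⟩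
    ℚ.∣ s n ℚ.- s j ∣ ℚ.+ ½ ℚ.* e₁
      ≤⟨ ℚ.+-monoˡ-≤ (½ ℚ.* e₁) (ℚ.<⇒≤ (close n j N≤n (ℕ.m⊔n≤o⇒m≤o N N₁ p))) ⟩
    ½ ℚ.* e₁ ℚ.+ ½ ℚ.* e₁
      ≡⟨ trans (halves e₁) (sym (ℚ.+-identityˡ e₁)) ⟩
    0ℚ ℚ.+ e₁
      ≤⟨ e₁≤e j (ℕ.m⊔n≤o⇒n≤o N N₁ p) ⟩
    seq e j ∎
  where open ℚ.≤-Reasoning

⟶⇒Cauchy : ∀ (a : ℕ → ℝ) {s} → (∀ n j → seq (a n) j ≡ s n) → ∀ l → a ⟶ l → Cauchy s
⟶⇒Cauchy a {s} a≡s l lim e 0<e =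
  let N , close = lim (fromℚ (½ ℚ.* e)) (½ ℚ.* e , half-pos 0<e , 0 , λ _ _ → ℚ.≤-reflexive (ℚ.+-identityˡ (½ ℚ.* e)))
  in N , λ m n p q → combine m n (close m p) (close n q)
  where
  near : ∀ n j g → 0ℚ ℚ.< g → seq ∣ a n -ᴿ l ∣ᴿ j ℚ.+ g ℚ.≤ ½ ℚ.* e → ℚ.∣ s n ℚ.- seq l j ∣ ℚ.< ½ ℚ.* e
  near n j g 0<g le = ℚ.<-≤-trans
    (subst₂ ℚ._<_ (ℚ.+-identityʳ ℚ.∣ s n ℚ.- seq l j ∣)
      (cong (ℚ._+ g) (sym (trans (seq-distance (a n) l j) (cong (λ z → ℚ.∣ z ℚ.- seq l j ∣) (a≡s n j)))))
      (ℚ.+-monoʳ-< ℚ.∣ s n ℚ.- seq l j ∣ 0<g)) le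
  combine : ∀ m n → ∣ a m -ᴿ l ∣ᴿ <ᴿ fromℚ (½ ℚ.* e) → ∣ a n -ᴿ l ∣ᴿ <ᴿ fromℚ (½ ℚ.* e) → ℚ.∣ s m ℚ.- s n ∣ ℚ.< e
  combine m n (g , 0<g , N , le) (g′ , 0<g′ , N′ , le′) = ℚ.≤-<-trans
    (subst (λ z → ℚ.∣ z ∣ ℚ.≤ ℚ.∣ s m ℚ.- t ∣ ℚ.+ ℚ.∣ s n ℚ.- t ∣)
      (solve 3 (λ x y t → (x :- t) :- (y :- t) := x :- y) refl (s m) (s n) t)
      (ℚ.∣p-q∣≤∣p∣+∣q∣ (s m ℚ.- t) (s n ℚ.- t)))
    (subst (ℚ.∣ s m ℚ.- t ∣ ℚ.+ ℚ.∣ s n ℚ.- t ∣ ℚ.<_) (halves e)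
      (ℚ.+-mono-< (near m j g 0<g (le j (ℕ.m≤m⊔n N N′))) (near n j g′ 0<g′ (le′ j (ℕ.m≤n⊔m N N′)))))
    where
    open +-*-Solver
    -- A term of `l` late enough for both estimates stands in for `l`.
    j = N ⊔ N′
    t = seq l j

opaque
  -- `ratio` is a constant sequence, so any term would do; the value 0 for an empty graph is
  -- inherited from it.
  density : ℕ → ℕ → ℚ
  density a b = seq (ratio a b) 0

  seq-ratio : ∀ a b j → seq (ratio a b) j ≡ density a b
  seq-ratio a zero    j = refl
  seq-ratio a (suc b) j = refl

  density-scaled : ∀ a {b} → 0 < b → density a b ℚ.* ↑ b ≡ ↑ a
  density-scaled a {suc b} _ = ↑/ a b

  density-zero : ∀ b → density 0 b ≡ 0ℚ
  density-zero zero    = refl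
  density-zero (suc b) = ℚ.0/n≡0 (suc b)

-- The last step of Chebyshev's argument. With `suc q` at least the inverse of `e²`, the threshold
-- makes `e² v` at least `c + 1`, so an error of size `e` or more would violate the bound.
large-square : ∀ c e → 0ℚ ℚ.< e → ∃ λ T → ∀ v u → T ≤ v → u ℚ.* u ℚ.* ↑ v ℚ.≤ ↑ c → ℚ.∣ u ∣ ℚ.< e
large-square c e 0<e = suc q * suc c , λ v u T≤v le → ℚ.≰⇒> λ e≤∣u∣ → ℚ.<-irrefl refl (begin-strict
  ↑ c                                   <⟨ ↑-< (ℕ.n<1+n c) ⟩
  ↑ suc c                               ≡⟨ sym (ℚ.*-identityˡ (↑ suc c)) ⟩
  1ℚ ℚ.* ↑ suc c                        ≤⟨ ℚ-*-monoʳ-≤ (↑ suc c) (↑-nonneg (suc c)) 1≤qee ⟩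
  ↑ suc q ℚ.* (e ℚ.* e) ℚ.* ↑ suc c
    ≡⟨ solve 3 (λ q e c → q :* (e :* e) :* c := (e :* e) :* (q :* c)) refl (↑ suc q) e (↑ suc c) ⟩
  (e ℚ.* e) ℚ.* (↑ suc q ℚ.* ↑ suc c)   ≡⟨ cong (e ℚ.* e ℚ.*_) (sym (↑-* (suc q) (suc c))) ⟩
  (e ℚ.* e) ℚ.* ↑ (suc q * suc c)       ≤⟨ ℚ-*-monoˡ-≤ (e ℚ.* e) (square-nonneg e) (↑-mono T≤v) ⟩
  (e ℚ.* e) ℚ.* ↑ v                     ≤⟨ ℚ-*-monoʳ-≤ (↑ v) (↑-nonneg v) (ℚ-*-mono-≤ (ℚ.<⇒≤ 0<e) (ℚ.0≤∣p∣ u) e≤∣u∣ e≤∣u∣) ⟩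
  ℚ.∣ u ∣ ℚ.* ℚ.∣ u ∣ ℚ.* ↑ v
    ≡⟨ cong (ℚ._* ↑ v) (trans (sym (ℚ.∣p*q∣≡∣p∣*∣q∣ u u)) (ℚ.0≤p⇒∣p∣≡p (square-nonneg u))) ⟩
  u ℚ.* u ℚ.* ↑ v                       ≤⟨ le ⟩
  ↑ c                                   ∎)
  where
  open ℚ.≤-Reasoning
  open +-*-Solver
  rec = reciprocal (e ℚ.* e) (ℚ-*-pos 0<e 0<e)
  q = proj₁ rec
  1≤qee = proj₂ rec

module Assembly (k R j : ℕ) {d : ℕ} {f : ℕ → ℕ} {v : ℕ → ℕ} (G : ∀ n → Graph (v n))
  (cls : ∀ n → Graph[ d , f ] (G n)) (weak : WeaklyConvergent d G) where

  open Expectation j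
  open RandomCarving k R j
  open WeaklyConvergent weak

  1≤L : 1 ≤ L
  1≤L = ℕ.≤-trans (s≤s z≤n) (ℕ.m≤n+m (suc (Carving.range k R M)) (R + R))

  -- The growth condition bounds balls of radius `L` by `f L`, so every ball that occurs has a code
  -- here.
  types : List RootedCode
  types = rootedCodes (f L)

  typeCount : RootedCode → ∀ {n} → Graph n → ℕ
  typeCount c G = # (λ x → rootedBall G L x ≅∙? decode c)

  typeCount-sum : ∀ c {n} (G : Graph n) → typeCount c G ≡ ℕΣ.sum (λ x → ⟦ rooted≅? (rootedBall G L x) (decode c) ⟧)
  typeCount-sum c G = trans (#≡sum (λ x → rootedBall G L x ≅∙? decode c))
    (ℕΣ.sum-cong-≗ λ x → ⟦⟧-cong (rootedBall G L x ≅∙? decode c) (rooted≅? (rootedBall G L x) (decode c)) id id)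

  typeDensity : ℕ → RootedCode → ℚ
  typeDensity n c = density (typeCount c (G n)) (v n)

  typeDensity-cauchy : ∀ c → Cauchy (λ n → typeDensity n c)
  typeDensity-cauchy c = go (isRootedBall? L d (decode c))
    where
    go : Dec (IsRootedBall L d (decode c)) → Cauchy (λ n → typeDensity n c)
    go (yes isBall) = let l , lim = converges L 1≤L (decode c) isBall in
      ⟶⇒Cauchy (λ n → p (G n) L (decode c)) (λ n → seq-ratio (typeCount c (G n)) (v n)) l lim
    -- Weak convergence speaks only of codes that are `(L, d)`-balls. Any other code never occurs in
    -- a graph of degree at most `d`, so its density is constantly 0.
    go (no ¬isBall) = Cauchy-cong {λ _ → 0ℚ} {λ n → typeDensity n c}
      (λ n → sym (trans (cong (λ a → density a (v n)) (none n)) (density-zero (v n))))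
      (Cauchy-const 0ℚ)
      where
      none : ∀ n → typeCount c (G n) ≡ 0
      none n = trans (typeCount-sum c (G n)) (sum-zero λ x → ⟦⟧-no (rooted≅? (rootedBall (G n) L x) (decode c)) λ i →
        ¬isBall (BallEmbedding.isRootedBall (G n) L x (decode c) i (Graph[_,_].maxDegree (cls n))))

  module _ {h} (H : Graph h) where

    typeMean : RootedCode → ℚ
    typeMean c = hitMean H (RootedGraph.graph (decode c)) (RootedGraph.root (decode c))

    expected : ℕ → ℚ
    expected n = classSum types (λ c → typeMean c ℚ.* typeDensity n c)

    expected-cauchy : Cauchy expected
    expected-cauchy = Cauchy-classSum types (λ n c → typeMean c ℚ.* typeDensity n c)
      λ c → Cauchy-* {λ n → typeDensity n c} (typeMean c) (typeDensity-cauchy c)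

    expected-scaled : ∀ n → 0 < v n → expected n ℚ.* ↑ v n ≡ hitsMean H (G n)
    expected-scaled n 0<v = sym (begin
      ℚΣ.sum (hitMean H (G n))
        ≡⟨ ℚΣ.sum-cong-≗ (λ x → sym (classSum-single types (rootedBall (G n) L x) typeMean (hitMean H (G n) x)
             (λ c i → sym (hitMean-ball H (G n) x (decode c) i))
             (rootedCodes-complete (rootedBall (G n) L x) (Graph[_,_].growth (cls n) x L 1≤L)))) ⟩
      ℚΣ.sum (λ x → classSum types (λ c → when (rooted≅? (rootedBall (G n) L x) (decode c)) (typeMean c)))
        ≡⟨ classSum-sum types (λ x c → when (rooted≅? (rootedBall (G n) L x) (decode c)) (typeMean c)) ⟩
      classSum types (λ c → ℚΣ.sum (λ x → when (rooted≅? (rootedBall (G n) L x) (decode c)) (typeMean c)))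
        ≡⟨ classSum-cong types per-type ⟩
      classSum types (λ c → ↑ v n ℚ.* (typeMean c ℚ.* typeDensity n c))
        ≡⟨ sym (classSum-* types (↑ v n)) ⟩
      ↑ v n ℚ.* expected n
        ≡⟨ ℚ.*-comm (↑ v n) (expected n) ⟩
      expected n ℚ.* ↑ v n ∎)
      where
      open ≡-Reasoning
      per-type : ∀ c → ℚΣ.sum (λ x → when (rooted≅? (rootedBall (G n) L x) (decode c)) (typeMean c)) ≡
                 ↑ v n ℚ.* (typeMean c ℚ.* typeDensity n c)
      per-type c = begin
        ℚΣ.sum (λ x → when (rooted≅? (rootedBall (G n) L x) (decode c)) (typeMean c))
          ≡⟨ ℚΣ.sum-cong-≗ (λ x → when≡* (rooted≅? (rootedBall (G n) L x) (decode c)) (typeMean c)) ⟩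
        ℚΣ.sum (λ x → typeMean c ℚ.* ↑ ⟦ rooted≅? (rootedBall (G n) L x) (decode c) ⟧)
          ≡⟨ sym (ℚΣ.*-distribˡ-sum (typeMean c) (λ x → ↑ ⟦ rooted≅? (rootedBall (G n) L x) (decode c) ⟧)) ⟩
        typeMean c ℚ.* ℚΣ.sum (λ x → ↑ ⟦ rooted≅? (rootedBall (G n) L x) (decode c) ⟧)
          ≡⟨ cong (typeMean c ℚ.*_) (trans (sym (↑-sum (λ x → ⟦ rooted≅? (rootedBall (G n) L x) (decode c) ⟧)))
               (trans (cong ↑_ (sym (typeCount-sum c (G n)))) (sym (density-scaled (typeCount c (G n)) 0<v)))) ⟩
        typeMean c ℚ.* (typeDensity n c ℚ.* ↑ v n)
          ≡⟨ solve 3 (λ q t v → q :* (t :* v) := v :* (q :* t)) refl (typeMean c) (typeDensity n c) (↑ v n) ⟩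
        ↑ v n ℚ.* (typeMean c ℚ.* typeDensity n c) ∎
        where open +-*-Solver using (solve; _:*_; _:=_)

    module _ (ω : ∀ n → Vec Label (v n)) (A : ℕ)
      (concentrated : ∀ n → hitsDeviation H (G n) (ω n) ℚ.* hitsDeviation H (G n) (ω n) ℚ.≤
                            ↑ suc (A * v n) ℚ.+ ↑ suc (A * v n)) where

      hitDensity : ℕ → ℚ
      hitDensity n = density (hits H (G n) (ω n)) (v n)

      -- Multiplying the error by `v n` gives the deviation of the count, whose square is linear in
      -- `v n`. One factor `v n` is then cancelled, and the other one forces the error to 0 in
      -- `large-square`.
      square-bound : ∀ n → 0 < v n →
        (hitDensity n ℚ.- expected n) ℚ.* (hitDensity n ℚ.- expected n) ℚ.* ↑ v n ℚ.≤ ↑ (2 * suc A)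
      square-bound n 0<v = ℚ-*-cancelʳ-≤ (↑ v n) (↑-pos 0<v) (begin
        u ℚ.* u ℚ.* ↑ v n ℚ.* ↑ v n
          ≡⟨ solve 3 (λ s m v → (s :- m) :* (s :- m) :* v :* v := (s :* v :- m :* v) :* (s :* v :- m :* v)) refl
               (hitDensity n) (expected n) (↑ v n) ⟩
        (hitDensity n ℚ.* ↑ v n ℚ.- expected n ℚ.* ↑ v n) ℚ.* (hitDensity n ℚ.* ↑ v n ℚ.- expected n ℚ.* ↑ v n)
          ≡⟨ cong (λ z → z ℚ.* z) (cong₂ ℚ._-_ (density-scaled (hits H (G n) (ω n)) 0<v) (expected-scaled n 0<v)) ⟩
        hitsDeviation H (G n) (ω n) ℚ.* hitsDeviation H (G n) (ω n)
          ≤⟨ concentrated n ⟩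
        ↑ suc (A * v n) ℚ.+ ↑ suc (A * v n)        ≡⟨ sym (↑-+ (suc (A * v n)) (suc (A * v n))) ⟩
        ↑ (suc (A * v n) + suc (A * v n))
          ≤⟨ ↑-mono (ℕ.≤-trans (ℕ.+-mono-≤ le le) (ℕ.≤-reflexive (double (suc A) (v n)))) ⟩
        ↑ (2 * suc A * v n)                        ≡⟨ ↑-* (2 * suc A) (v n) ⟩
        ↑ (2 * suc A) ℚ.* ↑ v n                    ∎)
        where
        open ℚ.≤-Reasoning
        open +-*-Solver
        u = hitDensity n ℚ.- expected n
        -- The successor coming from `spread` is absorbed because the graph is not empty.
        le : suc (A * v n) ≤ suc A * v n
        le = ℕ.+-monoˡ-≤ (A * v n) 0<v
        double : ∀ a b → a * b + a * b ≡ 2 * a * b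
        double a b = trans (sym (ℕ.*-distribʳ-+ b a a)) (cong (λ z → (a + z) * b) (sym (ℕ.+-identityʳ a)))

      hitDensity-cauchy : Cauchy hitDensity
      hitDensity-cauchy = Cauchy-near {hitDensity} {expected} expected-cauchy λ e 0<e →
        let T , small = large-square (2 * suc A) e 0<e
            N , big   = unbounded (1 ⊔ T)
        in N , λ n N≤n → small (v n) (hitDensity n ℚ.- expected n) (ℕ.≤-trans (ℕ.m≤n⊔m 1 T) (big n N≤n))
             (square-bound n (ℕ.≤-trans (ℕ.m≤m⊔n 1 T) (big n N≤n)))

-- The removal bound and the final constants

edges≡2*edgeCount : ∀ {n} (G : Graph n) → edges G ≡ 2 * edgeCount G
edges≡2*edgeCount G = trans
  (pairCount-symmetric (Graph._~?_ G) (Graph.symmetric G) (Graph.irreflexive G refl))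
  (cong (2 *_) (sym (pairs-sum (λ (x , y) → (x Fin.<? y) ×-dec Graph._~?_ G x y))))

removed≡2*removedCount : ∀ {n} (G G′ : Graph n) →
  pairCount (λ x y → Graph._~?_ G x y ×-dec ¬? (Graph._~?_ G′ x y)) ≡ 2 * removedCount G G′
removed≡2*removedCount G G′ = trans
  (pairCount-symmetric (λ x y → Graph._~?_ G x y ×-dec ¬? (Graph._~?_ G′ x y))
    (λ (e , ¬e′) → Graph.symmetric G e , λ e′ → ¬e′ (Graph.symmetric G′ e′))
    (λ (e , _) → Graph.irreflexive G refl e))
  (cong (2 *_) (sym (pairs-sum (λ (x , y) → (x Fin.<? y) ×-dec Graph._~?_ G x y ×-dec ¬? (Graph._~?_ G′ x y)))))

-- The two halves of the budget meet here. The factors 2 at `rm` and `E` come from ordered pairs,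
-- the outer one in the bound for `U` from Markov's inequality. The `4 * q * D` below the number of
-- labels yields `q * U ≤ E`, so boundaries and conflicts cost `2 * E` each.
removal-arithmetic : ∀ q D U E rm → 0 < D → 2 * q * (2 * rm) ≤ 2 * E + 2 * q * U →
                     suc (4 * q * D) * U ≤ 2 * (2 * E * D) → q * rm ≤ E
removal-arithmetic q D U E rm 0<D cost conflicts = ℕ.*-cancelˡ-≤ 4 (begin
  4 * (q * rm)               ≡⟨ solve 2 (λ q r → con 4 :* (q :* r) := con 2 :* q :* (con 2 :* r)) refl q rm ⟩
  2 * q * (2 * rm)           ≤⟨ cost ⟩
  2 * E + 2 * q * U          ≡⟨ cong (2 * E +_) (ℕ.*-assoc 2 q U) ⟩
  2 * E + 2 * (q * U)        ≤⟨ ℕ.+-monoʳ-≤ (2 * E) (ℕ.*-monoʳ-≤ 2 qU≤E) ⟩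
  2 * E + 2 * E              ≡⟨ solve 1 (λ e → con 2 :* e :+ con 2 :* e := con 4 :* e) refl E ⟩
  4 * E                      ∎)
  where
  open ℕ.≤-Reasoning
  open ℕSolver.+-*-Solver
  qU≤E : q * U ≤ E
  qU≤E = ℕ.*-cancelˡ-≤ (4 * D) {{ℕ.>-nonZero (ℕ.*-mono-< {0} {4} {0} {D} (s≤s z≤n) 0<D)}} (begin
    4 * D * (q * U)          ≡⟨ solve 3 (λ d q u → con 4 :* d :* (q :* u) := con 4 :* q :* d :* u) refl D q U ⟩
    4 * q * D * U            ≤⟨ ℕ.m≤n+m (4 * q * D * U) U ⟩
    suc (4 * q * D) * U      ≤⟨ conflicts ⟩
    2 * (2 * E * D)          ≡⟨ solve 2 (λ e d → con 2 :* (con 2 :* e :* d) := con 4 :* d :* e) refl E D ⟩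
    4 * D * E                ∎)

-- Only a tail of `η` is known to exceed `e`, and this is enough: a strict reverse inequality would
-- hold at some index of that tail, where `η` is at least the inverse of `suc q`.
scaled-≤ᴿ : ∀ η e q N → (∀ n → N ≤ n → 0ℚ ℚ.+ e ℚ.≤ seq η n) → 1ℚ ℚ.≤ ↑ suc q ℚ.* e →
            ∀ a b → suc q * a ≤ b → fromℕ a ≤ᴿ η *ᴿ fromℕ b
scaled-≤ᴿ η e q N e≤η 1≤qe a b qa≤b (g , 0<g , N′ , le) = ℚ.<-irrefl refl (begin-strict
  ↑ a                                   ≡⟨ sym (ℚ.+-identityʳ (↑ a)) ⟩
  ↑ a ℚ.+ 0ℚ                            <⟨ ℚ.+-monoʳ-< (↑ a) 0<g ⟩
  ↑ a ℚ.+ g                             ≤⟨ ℚ.+-monoˡ-≤ g a≤ ⟩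
  seq η m ℚ.* ↑ b ℚ.+ g                 ≡⟨ cong (λ z → seq η m ℚ.* z ℚ.+ g) (↑-/1 b) ⟩
  seq η m ℚ.* seq (fromℕ b) m ℚ.+ g     ≡⟨ cong (ℚ._+ g) (sym (seq-* η (fromℕ b) m)) ⟩
  seq (η *ᴿ fromℕ b) m ℚ.+ g            ≤⟨ le m (ℕ.m≤n⊔m N N′) ⟩
  seq (fromℕ a) m                       ≡⟨ sym (↑-/1 a) ⟩
  ↑ a                                   ∎)
  where
  open ℚ.≤-Reasoning
  m = N ⊔ N′
  e≤ : e ℚ.≤ seq η m
  e≤ = subst (ℚ._≤ seq η m) (ℚ.+-identityˡ e) (e≤η m (ℕ.m≤m⊔n N N′))
  a≤ : ↑ a ℚ.≤ seq η m ℚ.* ↑ b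
  a≤ = ℚ-*-cancelʳ-≤ (↑ suc q) (↑-pos (s≤s z≤n)) (begin
    ↑ a ℚ.* ↑ suc q                     ≡⟨ trans (ℚ.*-comm (↑ a) (↑ suc q)) (sym (↑-* (suc q) a)) ⟩
    ↑ (suc q * a)                       ≤⟨ ↑-mono qa≤b ⟩
    ↑ b                                 ≡⟨ sym (ℚ.*-identityˡ (↑ b)) ⟩
    1ℚ ℚ.* ↑ b
      ≤⟨ ℚ-*-monoʳ-≤ (↑ b) (↑-nonneg b) (ℚ.≤-trans 1≤qe (ℚ-*-monoˡ-≤ (↑ suc q) (↑-nonneg (suc q)) e≤)) ⟩
    ↑ suc q ℚ.* seq η m ℚ.* ↑ b
      ≡⟨ solve 3 (λ q s b → q :* s :* b := s :* b :* q) refl (↑ suc q) (seq η m) (↑ b) ⟩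
    seq η m ℚ.* ↑ b ℚ.* ↑ suc q         ∎)
    where open +-*-Solver

module Conclusion {d : ℕ} {f v : ℕ → ℕ} (G : ∀ n → Graph (v n)) (cls : ∀ n → Graph[ d , f ] (G n)) (weak : WeaklyConvergent d G)
  (q N : ℕ) (bound : d * f (suc N) * (2 * suc q) ^ N < suc (2 * suc q) ^ N) where

  k R D j : ℕ
  -- Here `suc q` plays the role of `1/ε`. Doubling it in `k` leaves half of the budget for
  -- conflicts; `M = suc j` is the number of labels required by `removal-arithmetic`, and the
  -- successor in `D` makes it positive.
  k = 2 * suc q
  R = suc N
  D = suc (f (suc (R + R)))
  j = 4 * suc q * D

  open RandomCarving k R j
  open Expectation j using (Label)
  open Assembly k R j G cls weak using (hitDensity; hitDensity-cauchy)

  B : ℕ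
  B = f (L + L)

  A : ℕ
  A = length (codes D) * B

  1≤L+L : 1 ≤ L + L
  1≤L+L = ℕ.≤-trans (Assembly.1≤L k R j G cls weak) (ℕ.m≤m+n L L)

  module Chosen (n : ℕ) = Choice (codes D) D B (s≤s z≤n) (G n)
    (λ x → ℕ.m≤n⇒m≤1+n (Graph[_,_].growth (cls n) x (suc (R + R)) (s≤s z≤n)))
    (λ x → Graph[_,_].growth (cls n) x (L + L) 1≤L+L)

  ω : ∀ n → Vec Label (v n)
  ω n = proj₁ (Chosen.good n)

  G′ : ∀ n → Graph (v n)
  G′ n = carve (G n) (ω n)

  G′⊑G : ∀ n → G′ n ⊑ G n
  G′⊑G n x y = proj₁

  componentSize≤D : ∀ n x → componentSize (G′ n) x ≤ D
  componentSize≤D n x = ℕ.≤-trans (RunProperties.output-componentSize k R (G n) (labelling (ω n)) M x)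
    (ℕ.m≤n⇒m≤1+n (Graph[_,_].growth (cls n) x (suc (R + R)) (s≤s z≤n)))

  removed-≤ : ∀ n → suc q * removedCount (G n) (G′ n) ≤ edgeCount (G n)
  removed-≤ n = removal-arithmetic (suc q) D conflicts (edgeCount (G n)) (removedCount (G n) (G′ n)) (s≤s z≤n)
    (subst₂ (λ r e → k * r ≤ e + k * conflicts) (removed≡2*removedCount (G n) (G′ n)) (edges≡2*edgeCount (G n))
      (output-cost M (λ x → Fin.toℕ<n (Vec.lookup (ω n) x))))
    (subst (λ e → M * conflicts ≤ 2 * (e * D)) (edges≡2*edgeCount (G n)) (proj₂ (proj₂ (Chosen.good n))))
    where
    open RunProperties k R (G n) (labelling (ω n))
    open Cost (slow-exists k (s≤s z≤n) (G n) (labelling (ω n)) (cls n) N bound)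
    conflicts : ℕ
    conflicts = conflictDegree

  module _ {h} (H : Graph h) (h≤D : h ≤ D) where

    -- Concentration was arranged for the listed graphs only, so `H` is replaced by its listed copy;
    -- isomorphic graphs have the same hits. The labelling `ω` was fixed before `H`, so one `G′`
    -- serves all `H`.
    H′ : Graph h
    H′ = fromMatrix (toMatrix H)

    concentrated : ∀ n → hitsDeviation H′ (G n) (ω n) ℚ.* hitsDeviation H′ (G n) (ω n) ℚ.≤
                   ↑ suc (A * v n) ℚ.+ ↑ suc (A * v n)
    concentrated n = subst (λ s → hitsDeviation H′ (G n) (ω n) ℚ.* hitsDeviation H′ (G n) (ω n) ℚ.≤ ↑ suc s ℚ.+ ↑ suc s)
      (trans (cong (length (codes D) *_) (ℕ.*-comm (v n) B)) (sym (ℕ.*-assoc (length (codes D)) B (v n))))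
      (Chosen.deviation-bound n {ω n} (proj₂ (Chosen.good n)) {h , toMatrix H} (codes-complete (toMatrix H) h≤D))

    frequency-cauchy : Cauchy (hitDensity H′ ω A concentrated)
    frequency-cauchy = hitDensity-cauchy H′ ω A concentrated

    frequency : ℝ
    frequency = mkℝ (hitDensity H′ ω A concentrated) frequency-cauchy

    frequency-limit : (λ n → componentDensity (G′ n) H) ⟶ frequency
    frequency-limit = Cauchy⇒⟶ (λ n → componentDensity (G′ n) H)
      (λ n j → trans (seq-ratio (# (λ x → component (G′ n) x ≅? H)) (v n) j)
        (cong (λ a → density a (v n)) (hits-iso H H′ (G n) (ω n) (≅-toMatrix H))))
      frequency-cauchy

theorem1 : (d : ℕ) → 2 ≤ d →
    (f : ℕ → ℕ) → Subexponential f →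
    (v : ℕ → ℕ) (G : ∀ n → Graph (v n)) →
    (∀ n → Graph[ d , f ] (G n)) →
    WeaklyConvergent d G →
    (ε : ℝ) → 0ᴿ <ᴿ ε →
    Σ ℕ λ K → 0 < K ×
    Σ (∀ {m} (H : Graph m) → Connected H → Graph[ d , f ] H → m ≤ K → ℝ) λ c →
    Σ (∀ n → Graph (v n)) λ G′ →
    (∀ n → G′ n ⊑ G n × fromℕ (removedCount (G n) (G′ n)) ≤ᴿ ε *ᴿ fromℕ (edgeCount (G n)))
    × (∀ n x → componentSize (G′ n) x ≤ K)
    × (∀ {m} (H : Graph m) (con : Connected H) (cls : Graph[ d , f ] H) (m≤K : m ≤ K) →
    (λ n → componentDensity (G′ n) H) ⟶ c H con cls m≤K)
theorem1 d _ f subexp v G cls weak η (e , 0<e , N₀ , e≤η) =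
  let q , 1≤qe  = reciprocal e 0<e
      N , bound = SubexponentialBound.radius-bound f subexp d (2 * suc q) (s≤s z≤n)
      open Conclusion G cls weak q N bound
  in D , s≤s z≤n , (λ H _ _ m≤D → frequency H m≤D) , G′
   , (λ n → G′⊑G n , scaled-≤ᴿ η e q N₀ e≤η 1≤qe (removedCount (G n) (G′ n)) (edgeCount (G n)) (removed-≤ n))
   , componentSize≤D
   , λ H _ _ m≤D → frequency-limit H m≤D
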